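{- There is an absolute constant $r_0$ such that the following holds. Let $k,r,\Delta$ be positive integers with $r\geq r_0$ and $\Delta\geq 3$. Let $G$ be a graph (with at least one vertex) not containing $K_{k,k}$ as a subgraph, with maximum degree at most $\Delta$ and average degree at least $80r^2\log\log\Delta$. Then $G$ has a $64$-almost-regular subgraph with average degree at least $\frac{r}{160(k+1)\log r}$.
   Context: Logarithms are to base $2$. A graph is $K$-almost-regular if its maximum degree is at most $K$ times its minimum degree; subgraphs are non-empty; average degree is $2e/|V|$. -}

module Defs where

open import Algebra.Definitions.RawSemiring using () renaming (_^_ to pow)
open import Data.Fin using (Fin; _<_)
open import Data.Fin.Properties using (_<?_)
open import Data.Fin.Subset using (Subset; _∈_; _∉_; _⊆_; ∣_∣)
open import Data.Fin.Subset.Properties using (_∈?_)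
open import Data.Integer using (ℤ; +_; -[1+_])
open import Data.List using (List; allFin; cartesianProduct; filter; length; map)
open import Data.List.Extrema.Nat using (max; min)
open import Data.Nat using (ℕ; suc; NonZero)
import Data.Nat as ℕ
import Data.Nat.Properties as ℕ
open import Data.Product using (_×_; _,_; ∃-syntax)
open import Data.Rational.Unnormalised using (ℚᵘ; mkℚᵘ; 0ℚᵘ; _/_; ↥_; ↧ₙ_; +-*-rawSemiring)
import Data.Rational.Unnormalised as ℚ
open import Relation.Binary.PropositionalEquality using (_≡_)
open import Relation.Nullary using (Dec)
open import Relation.Nullary.Decidable using (_×-dec_)

-- A finite simple graph whose vertex set is a subset of Fin n.  Letting the
-- vertex set vary makes a subgraph of a graph a graph of the same type.
record Graph (n : ℕ) : Set where
  field
    V        : Subset n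
    N        : Fin n → Subset n
    N-sym    : ∀ {u v} → v ∈ N u → u ∈ N v
    N-irrefl : ∀ {v} → v ∉ N v
    N⊆V      : ∀ {v} → N v ⊆ V

open Graph public

private
  variable
    n : ℕ

infix 4 _⊆ᴳ_

-- Not necessarily induced.
_⊆ᴳ_ : Graph n → Graph n → Set
H ⊆ᴳ G = V H ⊆ V G × (∀ {v} → N H v ⊆ N G v)

ContainsK : ℕ → ℕ → Graph n → Set
ContainsK {n} s t G =
  ∃[ A ] ∃[ B ] A ⊆ V G × B ⊆ V G × ∣ A ∣ ≡ s × ∣ B ∣ ≡ t
    × (∀ {v : Fin n} → v ∈ A → v ∉ B)
    × (∀ {a b : Fin n} → a ∈ A → b ∈ B → b ∈ N G a)

order : Graph n → ℕ
order G = ∣ V G ∣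

-- Each edge is listed once, with its smaller endpoint first.
edges : Graph n → List (Fin n × Fin n)
edges {n} G = filter edge? (cartesianProduct (allFin n) (allFin n))
  where
  edge? : (e : Fin n × Fin n) → Dec (let (u , v) = e in u < v × v ∈ N G u)
  edge? (u , v) = (u <? v) ×-dec (v ∈? N G u)

degree : Graph n → Fin n → ℕ
degree G v = ∣ N G v ∣

degrees : Graph n → List ℕ
degrees {n} G = map (degree G) (filter (_∈? V G) (allFin n))

-- The first arguments of max and min are only base values: every degree lies
-- between 0 and n, so they matter only when G has no vertices.
maxDegree : Graph n → ℕ
maxDegree G = max 0 (degrees G)

minDegree : Graph n → ℕ
minDegree {n} G = min n (degrees G)

avgDegree : (G : Graph n) → .{{NonZero (order G)}} → ℚᵘ
avgDegree G = (+ (2 ℕ.* length (edges G))) / order G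

_AlmostRegular_ : ℕ → Graph n → Set
K AlmostRegular G = maxDegree G ℕ.≤ K ℕ.* minDegree G

-- A real number x given by its two Dedekind cuts: lower p means p < x and
-- upper p means x < p.  The cut axioms are not bundled; they hold for the cuts
-- built below as long as the operations are applied to the arguments for which
-- they are intended.
record Cut : Set₁ where
  field
    lower : ℚᵘ → Set
    upper : ℚᵘ → Set

open Cut public

infix 4 _≤ᶜ_

_≤ᶜ_ : Cut → Cut → Set
x ≤ᶜ y = ∀ p → lower x p → lower y p

fromℚ : ℚᵘ → Cut
fromℚ q = record { lower = λ p → p ℚ.< q ; upper = λ p → q ℚ.< p }

natℚ : ℕ → ℚᵘ
natℚ m = (+ m) / 1

fromℕ : ℕ → Cut
fromℕ m = fromℚ (natℚ m)

infixr 7 _·_ _÷_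

-- The product c · x, intended for c > 0.
_·_ : ℕ → Cut → Cut
c · x = record
  { lower = λ p → ∃[ l ] lower x l × p ℚ.< natℚ c ℚ.* l
  ; upper = λ p → ∃[ u ] upper x u × natℚ c ℚ.* u ℚ.< p
  }

-- The quotient c / x, intended for c > 0 and x > 0.  (For x = 0 it is +∞:
-- every rational is below it.)
_÷_ : ℕ → Cut → Cut
c ÷ x = record
  { lower = λ p → ∃[ u ] upper x u × p ℚ.* u ℚ.< natℚ c
  ; upper = λ p → ∃[ l ] lower x l × 0ℚᵘ ℚ.< l × natℚ c ℚ.< p ℚ.* l
  }

infixr 8 _^_

_^_ : ℚᵘ → ℕ → ℚᵘ
_^_ = pow +-*-rawSemiring

2^ℤ_ : ℤ → ℚᵘ
2^ℤ (+ m)    = natℚ (2 ℕ.^ m)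
2^ℤ -[1+ m ] = _/_ (+ 1) (2 ℕ.^ suc m) {{ℕ.m^n≢0 2 (suc m)}}

-- The logarithm to base 2, intended for x > 0.  For p = a / b with b > 0 and a
-- rational q > 0, 2^p < q is expressed as 2^a < q^b, and q < 2^p as q^b < 2^a.
log : Cut → Cut
log x = record
  { lower = λ p → ∃[ l ] lower x l × 0ℚᵘ ℚ.< l × 2^ℤ (↥ p) ℚ.< l ^ (↧ₙ p)
  ; upper = λ p → ∃[ u ] upper x u × 0ℚᵘ ℚ.< u × u ^ (↧ₙ p) ℚ.< 2^ℤ (↥ p)
  }

{-# OPTIONS --safe #-}
-- Repeatedly deleting edges between two vertices of degree above δ leaves a graph in which the
-- vertices of degree exactly δ form a set A and the others an independent set B.  If A spans many
-- edges, its induced subgraph is almost regular up to passing to a dense part.  Otherwise split the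
-- degrees of B into O(r log log Δ) windows [M, M ρ], dyadic at first and then with log ρ a small
-- proportion of log M, and keep the richest one.  Pack its edges into stars with centre in A and h
-- leaves in B, keep a leaf b independently with probability proportional to its degree, and keep a
-- star whose leaves all survive with a probability that makes every star equally likely (h / T).
-- A leaf then expects about h surviving stars, and if few pairs of stars meet twice, a second-moment
-- bound discards the vertices of large degree at small cost.  Pairs of leaves with large codegree are
-- avoided beforehand: as there is no K_{k,k}, in most stars at least half of the leaves have fewer
-- than k such partners within the star, which therefore contains a large substar without such pairs.
module Submission where

open import Data.Bool using (Bool; true; false; _∧_; _∨_; not; if_then_else_)
import Data.Bool as 𝔹
open import Data.Bool.Properties using (∧-conicalˡ; ∧-conicalʳ; ∨-idem)
open import Data.Empty using (⊥; ⊥-elim)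
open import Data.Fin using (Fin; zero; suc; fromℕ<)
open import Data.Fin.Properties using (_≟_; any?)
import Data.Fin.Properties as Fin
open import Data.List using (length; filter; cartesianProduct; allFin; map; tabulate; _++_)
open import Data.Nat hiding (_≟_)
import Data.Nat as ℕ
open import Data.Nat.DivMod using (/-monoˡ-≤; m/n*n≤m; m%n<n; m≡m%n+[m/n]*n)
open import Data.Nat.Properties hiding (_≟_)
open import Data.Nat.Tactic.RingSolver using (solve-∀)
open import Data.Product using (Σ; ∃-syntax; _×_; _,_; proj₁; proj₂)
open import Data.Sum using (_⊎_; inj₁; inj₂)
import Data.Vec.Functional as Vector
open import Function using (_∘_; case_of_)
open import Relation.Binary.PropositionalEquality
open import Relation.Nullary using (¬_; Dec; yes; no; does; contradiction)
open import Relation.Nullary.Decidable using (_×-dec_; ¬?; dec-true; dec-false)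
open import Algebra.Properties.Semiring.Sum +-*-semiring using (sum; sum-cong-≗; ∑-comm; ∑-distrib-+; *-distribˡ-sum; *-distribʳ-sum)
open import Algebra.Properties.CommutativeMonoid.Sum *-1-commutativeMonoid using () renaming (sum to product; ∑-distrib-+ to product-*; sum-cong-≗ to product-cong)

-- The width of a window, which in the code runs from `2 ^ lo` to `2 ^ (lo + suc ρ)`, is where the
-- costs meet. Once a star survives, one sharing several of its leaves is up to `R ^ h` times
-- likelier to survive, where `1 / R` bounds the keeping probabilities from below. So about
-- `T / R ^ h` such stars per leaf are tolerable, which fixes the codegree threshold `e₀`. A leaf
-- can then have `Γ * s` partners of large codegree, with `Γ` at least `h * R ^ h`, and the counting
-- against K_{k,k} needs leaf degrees above about `(Γ * s) ^ k`. So `ρ * k * h` must be a small part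
-- of `lo`, whence `ρ = lo / g` with `g = 8 * k * h * L`. Reaching the maximum degree takes about g
-- log log Δ windows, and each may hold `5 * s` edges per vertex of `A`, with `s = 2 * k * h`,
-- before it is rich enough. The product is of order k² q² log r log log Δ, which the assumed
-- density covers when q is about r / (k log r). The constant 64 is 8 times 8: stars have
-- `h = 8 * q` leaves, and degrees in their union are capped at `8 * h`.

-- A certificate for linear inequalities: `a ≤ b` is the sum of the hypotheses used, `e` the slack,
-- and the equation is left to the ring solver.
≤-from : ∀ {a b x y} e → a ≤ b → x + b + e ≡ y + a → x ≤ y
≤-from {a} {b} {x} {y} e a≤b eq = +-cancelʳ-≤ b x y (begin
  x + b      ≤⟨ m≤m+n (x + b) e ⟩
  x + b + e  ≡⟨ eq ⟩
  y + a      ≤⟨ +-monoʳ-≤ y a≤b ⟩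
  y + b      ∎)
  where open ≤-Reasoning

does-true : ∀ {p} {P : Set p} (d : Dec P) → does d ≡ true → P
does-true (yes p) _ = p

does-false : ∀ {p} {P : Set p} (d : Dec P) → does d ≡ false → ¬ P
does-false (no ¬p) _ = ¬p

∧-true : ∀ {a b} → a ∧ b ≡ true → a ≡ true × b ≡ true
∧-true {a} {b} p = ∧-conicalˡ a b p , ∧-conicalʳ a b p

true-∧ : ∀ {a b} → a ≡ true → b ≡ true → a ∧ b ≡ true
true-∧ refl refl = refl

-- Indicators, finite sums and counting

⟦_⟧ : Bool → ℕ
⟦ true ⟧ = 1
⟦ false ⟧ = 0

⟦⟧≤1 : ∀ b → ⟦ b ⟧ ≤ 1
⟦⟧≤1 true = ≤-refl
⟦⟧≤1 false = z≤n

⟦⟧≡1 : ∀ {b} → b ≡ true → ⟦ b ⟧ ≡ 1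
⟦⟧≡1 refl = refl

⟦⟧>0 : ∀ {b} → 0 < ⟦ b ⟧ → b ≡ true
⟦⟧>0 {true} _ = refl

⟦∧⟧ : ∀ a b → ⟦ a ∧ b ⟧ ≡ ⟦ a ⟧ * ⟦ b ⟧
⟦∧⟧ true b = sym (+-identityʳ _)
⟦∧⟧ false b = refl

⟦⟧-mono : ∀ {a b} → (a ≡ true → b ≡ true) → ⟦ a ⟧ ≤ ⟦ b ⟧
⟦⟧-mono {false} _ = z≤n
⟦⟧-mono {true} h rewrite h refl = ≤-refl

⟦⟧*-≤ : ∀ b {x y} → (b ≡ true → x ≤ y) → ⟦ b ⟧ * x ≤ ⟦ b ⟧ * y
⟦⟧*-≤ false _ = z≤n
⟦⟧*-≤ true h = +-monoˡ-≤ 0 (h refl)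

⟦⟧*≤ : ∀ b x → ⟦ b ⟧ * x ≤ x
⟦⟧*≤ false x = z≤n
⟦⟧*≤ true x = ≤-reflexive (+-identityʳ x)

sum-mono : ∀ {n} {f g : Fin n → ℕ} → (∀ i → f i ≤ g i) → sum f ≤ sum g
sum-mono {zero} h = z≤n
sum-mono {suc n} h = +-mono-≤ (h zero) (sum-mono (h ∘ suc))

sum-mono-< : ∀ {n} {f g : Fin n → ℕ} → (∀ i → f i ≤ g i) → ∀ i → f i < g i → sum f < sum g
sum-mono-< h zero lt = +-mono-<-≤ lt (sum-mono (h ∘ suc))
sum-mono-< h (suc i) lt = +-mono-≤-< (h zero) (sum-mono-< (h ∘ suc) i lt)

sum-0 : ∀ {n} {f : Fin n → ℕ} → (∀ i → f i ≡ 0) → sum f ≡ 0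
sum-0 {zero} h = refl
sum-0 {suc n} h = cong₂ _+_ (h zero) (sum-0 (h ∘ suc))

sum-const : ∀ n c → sum {n} (λ _ → c) ≡ n * c
sum-const zero c = refl
sum-const (suc n) c = cong (c +_) (sum-const n c)

term≤sum : ∀ {n} (f : Fin n → ℕ) i → f i ≤ sum f
term≤sum f zero = m≤m+n _ _
term≤sum f (suc i) = ≤-trans (term≤sum (f ∘ suc) i) (m≤n+m _ _)

two-terms≤sum : ∀ {n} (f : Fin n → ℕ) {i j} → i ≢ j → f i + f j ≤ sum f
two-terms≤sum f {zero} {zero} i≢j = contradiction refl i≢j
two-terms≤sum f {zero} {suc j} i≢j = +-monoʳ-≤ (f zero) (term≤sum (f ∘ suc) j)
two-terms≤sum f {suc i} {zero} i≢j = subst (_≤ sum f) (+-comm (f zero) _) (+-monoʳ-≤ (f zero) (term≤sum (f ∘ suc) i))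
two-terms≤sum f {suc i} {suc j} i≢j = ≤-trans (two-terms≤sum (f ∘ suc) (i≢j ∘ cong suc)) (m≤n+m _ _)

sum-< : ∀ {n} (f g : Fin n → ℕ) → sum f < sum g → ∃[ i ] f i < g i
sum-< {suc n} f g lt with f zero <? g zero
... | yes p = zero , p
... | no p = let i , q = sum-< (f ∘ suc) (g ∘ suc) (+-cancelˡ-< (f zero) _ _ (<-≤-trans lt (+-monoˡ-≤ _ (≮⇒≥ p)))) in suc i , q

sum>0 : ∀ {n} (f : Fin n → ℕ) → 0 < sum f → ∃[ i ] 0 < f i
sum>0 {n} f lt = sum-< (λ _ → 0) f (subst (_< sum f) (sym (sum-0 {n} {λ _ → 0} (λ _ → refl))) lt)

sum-δ : ∀ {n} (j : Fin n) (f : Fin n → ℕ) → sum (λ i → ⟦ does (i ≟ j) ⟧ * f i) ≡ f j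
sum-δ {suc n} zero f = trans (cong₂ _+_ (+-identityʳ (f zero)) (sum-0 {n} {λ _ → 0} (λ _ → refl))) (+-identityʳ _)
sum-δ (suc j) f = sum-δ j (f ∘ suc)

sum-comm : ∀ {m n} (f : Fin m → Fin n → ℕ) → sum (λ i → sum (f i)) ≡ sum (λ j → sum (λ i → f i j))
sum-comm {m} {n} f = ∑-comm {m} {n} f

sum-+ : ∀ {n} (f g : Fin n → ℕ) → sum (λ i → f i + g i) ≡ sum f + sum g
sum-+ {n} f g = ∑-distrib-+ {n} f g

*-sum : ∀ {n} c (f : Fin n → ℕ) → c * sum f ≡ sum (λ i → c * f i)
*-sum c f = *-distribˡ-sum c f

sum-* : ∀ {n} c (f : Fin n → ℕ) → sum f * c ≡ sum (λ i → f i * c)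
sum-* c f = *-distribʳ-sum c f

# : ∀ {n} → (Fin n → Bool) → ℕ
# p = sum (λ i → ⟦ p i ⟧)

#-mono : ∀ {n} {p q : Fin n → Bool} → (∀ i → p i ≡ true → q i ≡ true) → # p ≤ # q
#-mono h = sum-mono (λ i → ⟦⟧-mono (h i))

subset-of-size : ∀ {n} (p : Fin n → Bool) k → k ≤ # p →
  ∃[ q ] (∀ i → q i ≡ true → p i ≡ true) × # q ≡ k
subset-of-size {zero} p .zero z≤n = p , (λ _ x → x) , refl
subset-of-size {suc n} p zero _ = (λ _ → false) , (λ _ ()) , sum-0 {suc n} {λ _ → 0} (λ _ → refl)
subset-of-size {suc n} p (suc k) le with p zero in eq
... | true = let q , sub , sz = subset-of-size (p ∘ suc) k (s≤s⁻¹ le) in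
  (λ { zero → true ; (suc i) → q i }) , (λ { zero _ → eq ; (suc i) → sub i }) , cong suc sz
... | false = let q , sub , sz = subset-of-size (p ∘ suc) (suc k) le in
  (λ { zero → false ; (suc i) → q i }) , (λ { zero () ; (suc i) → sub i }) , sz

-- Graphs as Boolean relations and two deletion processes

Rel : ℕ → Set
Rel n = Fin n → Fin n → Bool

module _ {n : ℕ} where

  deg : Rel n → Fin n → ℕ
  deg E v = # (E v)

  Symmetric : Rel n → Set
  Symmetric E = ∀ u v → E u v ≡ true → E v u ≡ true

  Irreflexive : Rel n → Set
  Irreflexive E = ∀ v → E v v ≡ true → ⊥

  _⊑_ : Rel n → Rel n → Set
  F ⊑ E = ∀ u v → F u v ≡ true → E u v ≡ true

  ⊑-refl : ∀ {E} → E ⊑ E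
  ⊑-refl _ _ p = p

  ⊑-trans : ∀ {E F G} → E ⊑ F → F ⊑ G → E ⊑ G
  ⊑-trans p q u v = q u v ∘ p u v

  deg-mono : ∀ {E F} → F ⊑ E → ∀ v → deg F v ≤ deg E v
  deg-mono sub v = #-mono (sub v)

  column-sum : ∀ {E} → Symmetric E → ∀ v → sum (λ u → ⟦ E u v ⟧) ≡ deg E v
  column-sum sy v = ≤-antisym (sum-mono λ u → ⟦⟧-mono (sy u v)) (sum-mono λ u → ⟦⟧-mono (sy v u))

  -- Isolated vertices are regarded as absent.
  MinDegree : ℕ → Rel n → Set
  MinDegree q F = Symmetric F × (∃[ v ] 0 < deg F v) × (∀ v → deg F v ≡ 0 ⊎ q ≤ deg F v)

  -- Deleting a vertex of degree below `q` lowers the degree sum by less than `2 * q` and `# X` by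
  -- one, so the density hypothesis persists; being strict, it also leaves an edge at the end. `N`
  -- is fuel for the recursion.
  minDegree-subgraph : ∀ q N (E : Rel n) (X : Fin n → Bool) → # X ≤ N → Symmetric E →
    (∀ u v → E u v ≡ true → X u ≡ true) → 2 * q * # X < sum (deg E) →
    ∃[ F ] F ⊑ E × MinDegree q F
  minDegree-subgraph q N E X X≤N sy supp dense
    with any? (λ v → (X v 𝔹.≟ true) ×-dec (deg E v <? q))
  ... | no none = E , ⊑-refl , sy , sum>0 (deg E) (≤-<-trans z≤n dense) , low
    where
    low : ∀ v → deg E v ≡ 0 ⊎ q ≤ deg E v
    low v with q ≤? deg E v
    ... | yes p = inj₂ p
    ... | no p with deg E v in eq
    ...   | zero = inj₁ refl
    ...   | suc d = let u , pos = sum>0 (λ u → ⟦ E v u ⟧) (subst (0 <_) (sym eq) z<s) in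
                    ⊥-elim (none (v , supp v u (⟦⟧>0 pos) , subst (_< q) (sym eq) (≰⇒> p)))
  minDegree-subgraph q zero E X X≤N sy supp dense
    | yes (v , Xv , small) = contradiction (≤-trans (subst (_≤ # X) (⟦⟧≡1 Xv) (term≤sum (λ i → ⟦ X i ⟧) v)) X≤N) λ ()
  minDegree-subgraph q (suc N) E X X≤N sy supp dense
    | yes (v , Xv , small) =
    let F , sub , rest = minDegree-subgraph q N E′ X′ X′≤N sy′ supp′ dense′
    in F , ⊑-trans {F} {E′} {E} sub (λ a b p → proj₁ (∧-true p)) , rest
    where
    X′ : Fin n → Bool
    X′ u = X u ∧ not (does (u ≟ v))
    E′ : Rel n
    E′ a b = E a b ∧ (not (does (a ≟ v)) ∧ not (does (b ≟ v)))
    sy′ : Symmetric E′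
    sy′ a b p = let e , r = ∧-true p ; a≢ , b≢ = ∧-true {not (does (a ≟ v))} r in true-∧ (sy a b e) (true-∧ b≢ a≢)
    supp′ : ∀ a b → E′ a b ≡ true → X′ a ≡ true
    supp′ a b p = let e , r = ∧-true p in true-∧ (supp a b e) (proj₁ (∧-true {not (does (a ≟ v))} r))
    X-split : # X ≡ # X′ + 1
    X-split = begin
      # X ≡⟨ sum-cong-≗ pt ⟩
      sum (λ u → ⟦ X′ u ⟧ + ⟦ does (u ≟ v) ⟧ * 1) ≡⟨ sum-+ (λ u → ⟦ X′ u ⟧) _ ⟩
      # X′ + sum (λ u → ⟦ does (u ≟ v) ⟧ * 1) ≡⟨ cong (# X′ +_) (sum-δ v (λ _ → 1)) ⟩
      # X′ + 1 ∎
      where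
      open ≡-Reasoning
      pt : ∀ u → ⟦ X u ⟧ ≡ ⟦ X′ u ⟧ + ⟦ does (u ≟ v) ⟧ * 1
      pt u with u ≟ v
      ... | yes refl rewrite Xv = refl
      ... | no _ with X u
      ...   | true = refl
      ...   | false = refl
    X′≤N : # X′ ≤ N
    X′≤N = +-cancelʳ-≤ 1 _ _ (subst (# X′ + 1 ≤_) (+-comm 1 N) (subst (_≤ suc N) X-split X≤N))
    lost : sum (deg E) ≤ sum (deg E′) + (deg E v + deg E v)
    lost = begin
      sum (deg E) ≤⟨ sum-mono (λ a → sum-mono (pt a)) ⟩
      sum (λ a → sum λ b → ⟦ E′ a b ⟧ + (⟦ does (a ≟ v) ⟧ * ⟦ E a b ⟧ + ⟦ does (b ≟ v) ⟧ * ⟦ E a b ⟧))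
        ≡⟨ sum-cong-≗ (λ a → trans (sum-+ (λ b → ⟦ E′ a b ⟧) _) (cong (deg E′ a +_) (trans (sum-+ (λ b → ⟦ does
            (a ≟ v) ⟧ * ⟦ E a b ⟧) _) (cong₂ _+_ (sym (*-sum ⟦ does (a ≟ v) ⟧ (λ b → ⟦ E a b ⟧)))
            (sum-δ v (λ b → ⟦ E a b ⟧)))))) ⟩
      sum (λ a → deg E′ a + (⟦ does (a ≟ v) ⟧ * deg E a + ⟦ E a v ⟧)) ≡⟨ sum-+ (deg E′) _ ⟩
      sum (deg E′) + sum (λ a → ⟦ does (a ≟ v) ⟧ * deg E a + ⟦ E a v ⟧) ≡⟨ cong (sum (deg E′) +_)
          (trans (sum-+ (λ a → ⟦ does (a ≟ v) ⟧ * deg E a) _) (cong₂ _+_ (sum-δ v (deg E)) (column-sum {E} sy v))) ⟩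
      sum (deg E′) + (deg E v + deg E v) ∎
      where
      open ≤-Reasoning
      pt : ∀ a b → ⟦ E a b ⟧ ≤ ⟦ E′ a b ⟧ + (⟦ does (a ≟ v) ⟧ * ⟦ E a b ⟧ + ⟦ does (b ≟ v) ⟧ * ⟦ E a b ⟧)
      pt a b with E a b | a ≟ v | b ≟ v
      ... | false | _     | _     = z≤n
      ... | true  | yes _ | _     = s≤s z≤n
      ... | true  | no _  | yes _ = s≤s z≤n
      ... | true  | no _  | no _  = s≤s z≤n
    dense′ : 2 * q * # X′ < sum (deg E′)
    dense′ = arith (subst (λ x → 2 * q * x < sum (deg E)) X-split dense) lost small
      where
      arith : ∀ {q x s s′ d} → 2 * q * (x + 1) < s → s ≤ s′ + (d + d) → d < q → 2 * q * x < s′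
      arith {q} {x} {s} {s′} {d} h₁ h₂ h₃ =
        ≤-from 2 (+-mono-≤ (+-mono-≤ h₃ h₃) (+-mono-≤ h₁ h₂)) (ring q x s s′ d)
        where
        ring : ∀ q x s s′ d → suc (2 * q * x) + (q + q + (s + (s′ + (d + d)))) + 2 ≡ s′ +
            (suc d + suc d + (suc (2 * q * (x + 1)) + s))
        ring = solve-∀

  -- Afterwards the vertices of degree above δ are independent, and the other non-isolated ones have degree δ.
  high-ends-split : ∀ δ → 1 ≤ δ → ∀ N (E : Rel n) → sum (deg E) ≤ N → Irreflexive E → MinDegree δ E →
    ∃[ F ] F ⊑ E × MinDegree δ F × (∀ u v → F u v ≡ true → deg F u ≤ δ ⊎ deg F v ≤ δ)
  high-ends-split δ δ≥1 N E S≤N irr (sy , ne , md)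
    with any? (λ u → any? (λ v → (E u v 𝔹.≟ true) ×-dec ((δ <? deg E u) ×-dec (δ <? deg E v))))
  ... | no none = E , ⊑-refl , (sy , ne , md) , low
    where
    low : ∀ u v → E u v ≡ true → deg E u ≤ δ ⊎ deg E v ≤ δ
    low u v e with deg E u ≤? δ | deg E v ≤? δ
    ... | yes p | _ = inj₁ p
    ... | _ | yes p = inj₂ p
    ... | no p | no p′ = ⊥-elim (none (u , v , e , ≰⇒> p , ≰⇒> p′))
  high-ends-split δ δ≥1 zero E S≤N irr (sy , ne , md)
    | yes (u , v , e , du , dv) = contradiction (≤-trans (≤-trans du (term≤sum (deg E) u)) S≤N) λ ()
  high-ends-split δ δ≥1 (suc N) E S≤N irr (sy , ne , md)
    | yes (u , v , e , du , dv) =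
    let F , sub , rest = high-ends-split δ δ≥1 N E′ S′≤N (λ w p → irr w (proj₁ (∧-true p))) (sy′ , (u , ≤-trans δ≥1 du′) , md′)
    in F , ⊑-trans {F} {E′} {E} sub E′⊑E , rest
    where
    is : Fin n → Fin n → Bool
    is x y = does (x ≟ y)
    -- Only the edge between `u` and `v` goes. Both ends had degree above `δ` and lose one, so the
    -- minimum degree survives, and the falling degree sum bounds the number of rounds.
    E′ : Rel n
    E′ x y = E x y ∧ (not (is x u ∧ is y v) ∧ not (is y u ∧ is x v))
    E′⊑E : E′ ⊑ E
    E′⊑E a b p = proj₁ (∧-true p)
    u≢v : u ≢ v
    u≢v refl = irr u e
    sy′ : Symmetric E′
    sy′ a b p = let e , r = ∧-true p ; r₁ , r₂ = ∧-true {not (is a u ∧ is b v)} r in true-∧ (sy a b e) (true-∧ r₂ r₁)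
    loss : ∀ x → deg E x ≤ deg E′ x + (⟦ is x u ⟧ + ⟦ is x v ⟧)
    loss x = begin
      deg E x ≤⟨ sum-mono pt ⟩
      sum (λ y → ⟦ E′ x y ⟧ + (⟦ is y v ⟧ * ⟦ is x u ⟧ + ⟦ is y u ⟧ * ⟦ is x v ⟧)) ≡⟨ sum-+ (λ y → ⟦ E′ x y ⟧) _ ⟩
      deg E′ x + sum (λ y → ⟦ is y v ⟧ * ⟦ is x u ⟧ + ⟦ is y u ⟧ * ⟦ is x v ⟧)
        ≡⟨ cong (deg E′ x +_) (trans (sum-+ (λ y → ⟦ is y v ⟧ * ⟦ is x u ⟧) _) (cong₂ _+_ (sum-δ v _) (sum-δ u _))) ⟩
      deg E′ x + (⟦ is x u ⟧ + ⟦ is x v ⟧) ∎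
      where
      open ≤-Reasoning
      pt : ∀ y → ⟦ E x y ⟧ ≤ ⟦ E′ x y ⟧ + (⟦ is y v ⟧ * ⟦ is x u ⟧ + ⟦ is y u ⟧ * ⟦ is x v ⟧)
      pt y with E x y | is x u | is y v | is y u | is x v
      ... | false | _ | _ | _ | _ = z≤n
      ... | true | true | true | _ | _ = s≤s z≤n
      ... | true | true | false | true | true = s≤s z≤n
      ... | true | true | false | true | false = s≤s z≤n
      ... | true | true | false | false | _ = s≤s z≤n
      ... | true | false | a | true | true = m≤n+m 1 (⟦ a ⟧ * 0)
      ... | true | false | _ | true | false = s≤s z≤n
      ... | true | false | _ | false | _ = s≤s z≤n
    loss-by : ∀ x {c} → ⟦ is x u ⟧ + ⟦ is x v ⟧ ≡ c → deg E x ≤ c + deg E′ x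
    loss-by x refl = subst (deg E x ≤_) (+-comm (deg E′ x) _) (loss x)
    is-refl : ∀ x → ⟦ is x x ⟧ ≡ 1
    is-refl x = ⟦⟧≡1 (dec-true (x ≟ x) refl)
    is-≢ : ∀ {x y} → x ≢ y → ⟦ is x y ⟧ ≡ 0
    is-≢ {x} {y} x≢y = cong ⟦_⟧ (dec-false (x ≟ y) x≢y)
    du′ : δ ≤ deg E′ u
    du′ = s≤s⁻¹ (≤-trans du (loss-by u (cong₂ _+_ (is-refl u) (is-≢ u≢v))))
    dv′ : δ ≤ deg E′ v
    dv′ = s≤s⁻¹ (≤-trans dv (loss-by v (cong₂ _+_ (is-≢ (u≢v ∘ sym)) (is-refl v))))
    md′ : ∀ x → deg E′ x ≡ 0 ⊎ δ ≤ deg E′ x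
    md′ x = case (x ≟ u) of λ where
      (yes refl) → inj₂ du′
      (no x≢u) → case (x ≟ v) of λ where
        (yes refl) → inj₂ dv′
        (no x≢v) → case md x of λ where
          (inj₁ z) → inj₁ (n≤0⇒n≡0 (subst (deg E′ x ≤_) z (deg-mono {E} {E′} E′⊑E x)))
          (inj₂ p) → inj₂ (≤-trans p (loss-by x (cong₂ _+_ (is-≢ x≢u) (is-≢ x≢v))))
    E′uv : ⟦ E′ u v ⟧ ≡ 0
    E′uv rewrite dec-true (u ≟ u) refl | dec-true (v ≟ v) refl with E u v
    ... | true = refl
    ... | false = refl
    S′<S : sum (deg E′) < sum (deg E)
    S′<S = sum-mono-< (deg-mono {E} {E′} E′⊑E) u
      (sum-mono-< (λ y → ⟦⟧-mono (E′⊑E u y)) v (subst₂ _<_ (sym E′uv) (sym (⟦⟧≡1 e)) z<s))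
    S′≤N : sum (deg E′) ≤ N
    S′≤N = s≤s⁻¹ (≤-trans S′<S S≤N)

-- Expectations

-- Expectation over independent coordinates, the i-th of them true with probability
-- p i / (p i + r i), scaled by the product of all p i + r i.
𝔼 : ∀ {n} (p r : Fin n → ℕ) → ((Fin n → Bool) → ℕ) → ℕ
𝔼 {zero} p r f = f λ ()
𝔼 {suc n} p r f = p zero * 𝔼 (p ∘ suc) (r ∘ suc) (λ x → f (true Vector.∷ x))
                + r zero * 𝔼 (p ∘ suc) (r ∘ suc) (λ x → f (false Vector.∷ x))

𝔼-cong : ∀ {n} (p r : Fin n → ℕ) {f g} → (∀ x → f x ≡ g x) → 𝔼 p r f ≡ 𝔼 p r g
𝔼-cong {zero} p r h = h _
𝔼-cong {suc n} p r h = cong₂ _+_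
  (cong (p zero *_) (𝔼-cong (p ∘ suc) (r ∘ suc) (λ x → h (true Vector.∷ x))))
  (cong (r zero *_) (𝔼-cong (p ∘ suc) (r ∘ suc) (λ x → h (false Vector.∷ x))))

𝔼-+ : ∀ {n} (p r : Fin n → ℕ) f g → 𝔼 p r (λ x → f x + g x) ≡ 𝔼 p r f + 𝔼 p r g
𝔼-+ {zero} p r f g = refl
𝔼-+ {suc n} p r f g
  rewrite 𝔼-+ (p ∘ suc) (r ∘ suc) (λ x → f (true Vector.∷ x)) (λ x → g (true Vector.∷ x))
        | 𝔼-+ (p ∘ suc) (r ∘ suc) (λ x → f (false Vector.∷ x)) (λ x → g (false Vector.∷ x)) = ring (p zero)
            (r zero) _ _ _ _
  where
  ring : ∀ a b x y z w → a * (x + y) + b * (z + w) ≡ a * x + b * z + (a * y + b * w)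
  ring = solve-∀

𝔼-* : ∀ {n} (p r : Fin n → ℕ) c f → 𝔼 p r (λ x → c * f x) ≡ c * 𝔼 p r f
𝔼-* {zero} p r c f = refl
𝔼-* {suc n} p r c f
  rewrite 𝔼-* (p ∘ suc) (r ∘ suc) c (λ x → f (true Vector.∷ x))
        | 𝔼-* (p ∘ suc) (r ∘ suc) c (λ x → f (false Vector.∷ x)) = ring (p zero) (r zero) c _ _
  where
  ring : ∀ a b c x y → a * (c * x) + b * (c * y) ≡ c * (a * x + b * y)
  ring = solve-∀

𝔼-sum : ∀ {n} (p r : Fin n → ℕ) {m} (f : Fin m → (Fin n → Bool) → ℕ) →
  𝔼 p r (λ x → sum (λ i → f i x)) ≡ sum (λ i → 𝔼 p r (f i))
𝔼-sum p r {zero} f = 𝔼-* p r 0 (λ _ → 0)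
𝔼-sum p r {suc m} f = trans (𝔼-+ p r (f zero) _) (cong (𝔼 p r (f zero) +_) (𝔼-sum p r (f ∘ suc)))

-- The first-moment method by conditional expectations: if the inequality fails with the first
-- coordinate true, it holds with it false.
𝔼-< : ∀ {n} (p r : Fin n → ℕ) f g → 𝔼 p r f < 𝔼 p r g → ∃[ x ] f x < g x
𝔼-< {zero} p r f g lt = _ , lt
𝔼-< {suc n} p r f g lt
  with 𝔼 (p ∘ suc) (r ∘ suc) (λ x → f (true Vector.∷ x)) <? 𝔼 (p ∘ suc) (r ∘ suc) (λ x → g (true Vector.∷ x))
... | yes h = let x , q = 𝔼-< (p ∘ suc) (r ∘ suc) _ _ h in true Vector.∷ x , q
... | no ¬h = let x , q = 𝔼-< (p ∘ suc) (r ∘ suc) _ _ h′ in false Vector.∷ x , q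
  where
  h′ : 𝔼 (p ∘ suc) (r ∘ suc) (λ x → f (false Vector.∷ x)) < 𝔼 (p ∘ suc) (r ∘ suc) (λ x → g (false Vector.∷ x))
  h′ = *-cancelˡ-< (r zero) _ _ (+-cancelˡ-< (p zero * 𝔼 (p ∘ suc) (r ∘ suc) (λ x → f (true Vector.∷ x))) _ _
         (<-≤-trans lt (+-monoˡ-≤ _ (*-monoʳ-≤ (p zero) (≮⇒≥ ¬h)))))

-- The indicator of `U` being a subset of `x`, as a product so that its expectation factors over the
-- coordinates.
contains : ∀ {n} → (Fin n → Bool) → (Fin n → Bool) → ℕ
contains x U = product (λ i → if U i then ⟦ x i ⟧ else 1)

-- The probability that all coordinates in `U` are true, in the scaling of `𝔼`; `weight p r ∅` is
-- thus the scaling factor itself.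
weight : ∀ {n} → (p r : Fin n → ℕ) → (Fin n → Bool) → ℕ
weight p r U = product (λ i → if U i then p i else p i + r i)

_∪_ _∩_ : ∀ {n} → (U U′ : Fin n → Bool) → Fin n → Bool
(U ∪ U′) i = U i ∨ U′ i
(U ∩ U′) i = U i ∧ U′ i

∅ : ∀ {n} → Fin n → Bool
∅ _ = false

⁅_⁆ : ∀ {n} → Fin n → Fin n → Bool
⁅ j ⁆ i = does (i ≟ j)

𝔼-contains : ∀ {n} (p r : Fin n → ℕ) U → 𝔼 p r (λ x → contains x U) ≡ weight p r U
𝔼-contains {zero} p r U = refl
𝔼-contains {suc n} p r U
  rewrite 𝔼-* (p ∘ suc) (r ∘ suc) (if U zero then 1 else 1) (λ x → contains x (U ∘ suc))
        | 𝔼-* (p ∘ suc) (r ∘ suc) (if U zero then 0 else 1) (λ x → contains x (U ∘ suc))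
        | 𝔼-contains (p ∘ suc) (r ∘ suc) (U ∘ suc) with U zero
... | true = ring (p zero) (r zero) _
  where
  ring : ∀ a b x → a * (1 * x) + b * (0 * x) ≡ a * x
  ring = solve-∀
... | false = ring (p zero) (r zero) _
  where
  ring : ∀ a b x → a * (1 * x) + b * (1 * x) ≡ (a + b) * x
  ring = solve-∀

contains-∪ : ∀ {n} (x U U′ : Fin n → Bool) → contains x U * contains x U′ ≡ contains x (U ∪ U′)
contains-∪ {n} x U U′ = trans (sym (product-* {n} _ _)) (product-cong pt)
  where
  pt : ∀ i → (if U i then ⟦ x i ⟧ else 1) * (if U′ i then ⟦ x i ⟧ else 1) ≡ (if U i ∨ U′ i then ⟦ x i ⟧ else 1)
  pt i with U i | U′ i | x i
  ... | true  | true  | true  = refl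
  ... | true  | true  | false = refl
  ... | true  | false | true  = refl
  ... | true  | false | false = refl
  ... | false | true  | true  = refl
  ... | false | true  | false = refl
  ... | false | false | _     = refl

contains≤1 : ∀ {n} (x U : Fin n → Bool) → contains x U ≤ 1
contains≤1 {zero} x U = ≤-refl
contains≤1 {suc n} x U with U zero | x zero
... | true  | true  = ≤-trans (≤-reflexive (+-identityʳ _)) (contains≤1 (x ∘ suc) (U ∘ suc))
... | true  | false = z≤n
... | false | _     = ≤-trans (≤-reflexive (+-identityʳ _)) (contains≤1 (x ∘ suc) (U ∘ suc))

*-pos⇒posʳ : ∀ a b → 0 < a * b → 0 < b
*-pos⇒posʳ a zero pos = contradiction (subst (0 <_) (*-zeroʳ a) pos) λ ()
*-pos⇒posʳ a (suc b) pos = z<s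

contains>0 : ∀ {n} (x U : Fin n → Bool) → 0 < contains x U → ∀ i → U i ≡ true → x i ≡ true
contains>0 x U pos zero Ui with U zero | x zero
... | true  | true  = refl
contains>0 x U pos (suc i) Ui = contains>0 (x ∘ suc) (U ∘ suc)
  (*-pos⇒posʳ (if U zero then ⟦ x zero ⟧ else 1) _ pos) i Ui

contains-∅ : ∀ {n} (x : Fin n → Bool) → contains x ∅ ≡ 1
contains-∅ {zero} x = refl
contains-∅ {suc n} x = trans (*-identityˡ _) (contains-∅ (x ∘ suc))

contains-⁅⁆ : ∀ {n} (x : Fin n → Bool) j → contains x ⁅ j ⁆ ≡ ⟦ x j ⟧
contains-⁅⁆ x zero = trans (cong (⟦ x zero ⟧ *_) (contains-∅ (x ∘ suc))) (*-identityʳ _)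
contains-⁅⁆ x (suc j) = trans (*-identityˡ _) (contains-⁅⁆ (x ∘ suc) j)

module _ {n} (p r : Fin n → ℕ) where

  weight-cong : ∀ {U U′ : Fin n → Bool} → (∀ i → U i ≡ U′ i) → weight p r U ≡ weight p r U′
  weight-cong h = product-cong (λ i → cong (λ u → if u then p i else p i + r i) (h i))

  -- By independence this holds coordinate by coordinate. It stands in for conditioning on the
  -- common part, which would need division.
  weight-modular : ∀ U U′ → weight p r (U ∪ U′) * weight p r (U ∩ U′) ≡ weight p r U * weight p r U′
  weight-modular U U′ = trans (sym (product-* {n} _ _)) (trans (product-cong pt) (product-* {n} _ _))
    where
    pt : ∀ i → (if U i ∨ U′ i then p i else p i + r i) * (if U i ∧ U′ i then p i else p i + r i)
             ≡ (if U i then p i else p i + r i) * (if U′ i then p i else p i + r i)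
    pt i with U i | U′ i
    ... | true  | true  = refl
    ... | true  | false = refl
    ... | false | true  = *-comm (p i) _
    ... | false | false = refl

weight-⁅⁆ : ∀ {n} (p r : Fin n → ℕ) j → weight p r ⁅ j ⁆ * (p j + r j) ≡ p j * weight p r ∅
weight-⁅⁆ {suc n} p r zero = ring (p zero) (p zero + r zero) _
  where
  ring : ∀ a d x → a * x * d ≡ a * (d * x)
  ring = solve-∀
weight-⁅⁆ {suc n} p r (suc j) = begin
  (p zero + r zero) * weight (p ∘ suc) (r ∘ suc) ⁅ j ⁆ * (p (suc j) + r (suc j)) ≡⟨ *-assoc (p zero + r zero) _ _ ⟩
  (p zero + r zero) * (weight (p ∘ suc) (r ∘ suc) ⁅ j ⁆ * (p (suc j) + r (suc j))) ≡⟨ cong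
      ((p zero + r zero) *_) (weight-⁅⁆ (p ∘ suc) (r ∘ suc) j) ⟩
  (p zero + r zero) * (p (suc j) * weight (p ∘ suc) (r ∘ suc) ∅) ≡⟨ ring (p zero + r zero) (p (suc j))
      (weight (p ∘ suc) (r ∘ suc) ∅) ⟩
  p (suc j) * weight p r ∅ ∎
  where
  open ≡-Reasoning
  ring : ∀ a d x → a * (d * x) ≡ d * (a * x)
  ring = solve-∀

weight-∅>0 : ∀ {n} (p r : Fin n → ℕ) → (∀ i → 0 < p i + r i) → 0 < weight p r ∅
weight-∅>0 {zero} p r h = z<s
weight-∅>0 {suc n} p r h = *-mono-≤ (h zero) (weight-∅>0 (p ∘ suc) (r ∘ suc) (h ∘ suc))

weight-∅ : ∀ {n} (p r : Fin n → ℕ) T → (∀ i → p i + r i ≡ T) → weight p r ∅ ≡ T ^ n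
weight-∅ {zero} p r T h = refl
weight-∅ {suc n} p r T h = cong₂ _*_ (h zero) (weight-∅ (p ∘ suc) (r ∘ suc) T (h ∘ suc))

-- Every coordinate in `U` is true with probability at least `1 / R`.
weight-lower : ∀ {n} (p r : Fin n → ℕ) T R → (∀ i → p i + r i ≡ T) → (U : Fin n → Bool) →
  (∀ i → U i ≡ true → T ≤ R * p i) → T ^ n ≤ R ^ # U * weight p r U
weight-lower {zero} p r T R d U h = ≤-refl
weight-lower {suc n} p r T R d U h with U zero in eq
... | true = begin
  T * T ^ n ≤⟨ *-mono-≤ (h zero eq) (weight-lower (p ∘ suc) (r ∘ suc) T R (d ∘ suc) (U ∘ suc) (h ∘ suc)) ⟩
  R * p zero * (R ^ # (U ∘ suc) * weight (p ∘ suc) (r ∘ suc) (U ∘ suc)) ≡⟨ ring R (p zero) (R ^ # (U ∘ suc))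
      (weight (p ∘ suc) (r ∘ suc) (U ∘ suc)) ⟩
  R * R ^ # (U ∘ suc) * (p zero * weight (p ∘ suc) (r ∘ suc) (U ∘ suc)) ∎
  where
  open ≤-Reasoning
  ring : ∀ a b x y → a * b * (x * y) ≡ a * x * (b * y)
  ring = solve-∀
... | false = begin
  T * T ^ n ≤⟨ *-mono-≤ (≤-reflexive (sym (d zero))) (weight-lower (p ∘ suc) (r ∘ suc) T R (d ∘ suc) (U ∘ suc)
      (h ∘ suc)) ⟩
  (p zero + r zero) * (R ^ # (U ∘ suc) * weight (p ∘ suc) (r ∘ suc) (U ∘ suc)) ≡⟨ ring (p zero + r zero)
      (R ^ # (U ∘ suc)) (weight (p ∘ suc) (r ∘ suc) (U ∘ suc)) ⟩
  R ^ # (U ∘ suc) * ((p zero + r zero) * weight (p ∘ suc) (r ∘ suc) (U ∘ suc)) ∎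
  where
  open ≤-Reasoning
  ring : ∀ a x y → a * (x * y) ≡ x * (a * y)
  ring = solve-∀

-- From surviving stars to an almost-regular subgraph

sum-*-sum : ∀ {m n} (f : Fin m → ℕ) (g : Fin n → ℕ) → sum f * sum g ≡ sum (λ i → sum (λ j → f i * g j))
sum-*-sum f g = trans (sum-* (sum g) f) (sum-cong-≗ (λ i → *-sum (f i) g))

∨-true : ∀ a {b} → a ∨ b ≡ true → a ≡ true ⊎ b ≡ true
∨-true true _ = inj₁ refl
∨-true false p = inj₂ p

true-∨ˡ : ∀ {a b} → a ≡ true → a ∨ b ≡ true
true-∨ˡ refl = refl

true-∨ʳ : ∀ a {b} → b ≡ true → a ∨ b ≡ true
true-∨ʳ true _ = refl
true-∨ʳ false p = p

⟦⟧≤ : ∀ b {k} → (b ≡ true → 1 ≤ k) → ⟦ b ⟧ ≤ k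
⟦⟧≤ true h = h refl
⟦⟧≤ false h = z≤n

-- A single number serves both demands on the result: it anchors the ratio 64 and bounds the average
-- degree from below.
AlmostRegularSubgraph : ∀ {n} → ℕ → Rel n → Set
AlmostRegularSubgraph q E = ∃[ F ] F ⊑ E × MinDegree q F × (∀ v → deg F v ≤ 64 * q)

module Stars {n m} (h : ℕ) (ctr : Fin m → Fin n) (S : Fin m → Fin n → Bool) (#S : ∀ c → # (S c) ≡ h) where

  centre : Fin m → Fin n → ℕ
  centre c a = ⟦ does (a ≟ ctr c) ⟧

  shared : Fin m → Fin m → ℕ
  shared c c′ = sum (λ b → ⟦ S c b ⟧ * ⟦ S c′ b ⟧)

  -- Summed over all pairs of chosen stars this is the sum of squared degrees in their union. A
  -- centre has degree `h * at-centre`, hence the factor `h * h` for a common centre.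
  conflict : Fin m → Fin m → ℕ
  conflict c c′ = shared c c′ + h * h * centre c′ (ctr c)

  module _ (P : Fin m → ℕ) where

    at-leaf at-centre : Fin n → ℕ
    at-leaf b = sum (λ c → P c * ⟦ S c b ⟧)
    at-centre a = sum (λ c → P c * centre c a)

    edge : Fin n → Fin n → ℕ
    edge a b = sum (λ c → P c * (centre c a * ⟦ S c b ⟧))

    edge-column : ∀ b → sum (λ a → edge a b) ≡ at-leaf b
    edge-column b = trans (sum-comm λ a c → P c * (centre c a * ⟦ S c b ⟧)) (sum-cong-≗ λ c →
      trans (sym (*-sum (P c) (λ a → centre c a * ⟦ S c b ⟧))) (cong (P c *_) (sum-δ (ctr c) (λ _ → ⟦ S c b ⟧))))

    edge-row : ∀ a → sum (edge a) ≡ h * at-centre a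
    edge-row a = trans (sum-comm λ b c → P c * (centre c a * ⟦ S c b ⟧))
        (trans (sum-cong-≗ pt) (sym (*-sum h (λ c → P c * centre c a))))
      where
      open ≡-Reasoning
      pt : ∀ c → sum (λ b → P c * (centre c a * ⟦ S c b ⟧)) ≡ h * (P c * centre c a)
      pt c = begin
        sum (λ b → P c * (centre c a * ⟦ S c b ⟧)) ≡⟨ sym (*-sum (P c) (λ b → centre c a * ⟦ S c b ⟧)) ⟩
        P c * sum (λ b → centre c a * ⟦ S c b ⟧) ≡⟨ cong (P c *_) (sym (*-sum (centre c a) (λ b → ⟦ S c b ⟧))) ⟩
        P c * (centre c a * # (S c)) ≡⟨ cong (λ k → P c * (centre c a * k)) (#S c) ⟩
        P c * (centre c a * h) ≡⟨ ring (P c) (centre c a) h ⟩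
        h * (P c * centre c a) ∎
        where
        ring : ∀ p x y → p * (x * y) ≡ y * (p * x)
        ring = solve-∀

    sum-centre : sum at-centre ≡ sum P
    sum-centre = trans (sum-comm λ a c → P c * centre c a) (sum-cong-≗ λ c → begin
      sum (λ a → P c * centre c a) ≡⟨ sum-cong-≗ (λ a → *-comm (P c) (centre c a)) ⟩
      sum (λ a → centre c a * P c) ≡⟨ sum-δ (ctr c) (λ _ → P c) ⟩
      P c ∎)
      where open ≡-Reasoning

    squares : ∀ (I : Fin m → Fin n → ℕ) →
      sum (λ v → sum (λ c → P c * I c v) * sum (λ c → P c * I c v)) ≡
      sum (λ c → sum (λ c′ → sum (λ v → I c v * I c′ v) * (P c * P c′)))
    squares I = begin
      sum (λ v → sum (λ c → P c * I c v) * sum (λ c → P c * I c v))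
        ≡⟨ sum-cong-≗ (λ v → sum-*-sum (λ c → P c * I c v) (λ c → P c * I c v)) ⟩
      sum (λ v → sum (λ c → sum (λ c′ → P c * I c v * (P c′ * I c′ v))))
        ≡⟨ sum-comm (λ v c → sum (λ c′ → P c * I c v * (P c′ * I c′ v))) ⟩
      sum (λ c → sum (λ v → sum (λ c′ → P c * I c v * (P c′ * I c′ v))))
        ≡⟨ sum-cong-≗ (λ c → trans (sum-comm (λ v c′ → P c * I c v * (P c′ * I c′ v))) (sum-cong-≗ (λ c′ →
             trans (sum-cong-≗ (λ v → ring (P c) (I c v) (P c′) (I c′ v)))
                 (sym (sum-* (P c * P c′) (λ v → I c v * I c′ v)))))) ⟩
      sum (λ c → sum (λ c′ → sum (λ v → I c v * I c′ v) * (P c * P c′))) ∎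
      where
      open ≡-Reasoning
      ring : ∀ p x p′ x′ → p * x * (p′ * x′) ≡ x * x′ * (p * p′)
      ring = solve-∀

    conflicts : sum (λ c → sum (λ c′ → conflict c c′ * (P c * P c′))) ≡
      sum (λ b → at-leaf b * at-leaf b) + h * h * sum (λ a → at-centre a * at-centre a)
    conflicts = begin
      sum (λ c → sum (λ c′ → conflict c c′ * (P c * P c′)))
        ≡⟨ sum-cong-≗ (λ c → trans (sum-cong-≗ (λ c′ → ring (shared c c′) (h * h) (centre c′ (ctr c)) (P c * P c′)))
             (trans (sum-+ (λ c′ → shared c c′ * (P c * P c′)) _) (cong (sum (λ c′ → shared c c′ * (P c * P c′)) +_)
               (sym (*-sum (h * h) (λ c′ → centre c′ (ctr c) * (P c * P c′))))))) ⟩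
      sum (λ c → sum (λ c′ → shared c c′ * (P c * P c′)) + h * h * sum (λ c′ → centre c′ (ctr c) * (P c * P c′)))
        ≡⟨ trans (sum-+ (λ c → sum (λ c′ → shared c c′ * (P c * P c′))) _)
             (cong₂ _+_ (sym (squares (λ c b → ⟦ S c b ⟧)))
               (sym (*-sum (h * h) (λ c → sum (λ c′ → centre c′ (ctr c) * (P c * P c′)))))) ⟩
      sum (λ b → at-leaf b * at-leaf b) + h * h * sum (λ c → sum (λ c′ → centre c′ (ctr c) * (P c * P c′)))
        ≡⟨ cong (λ s → sum (λ b → at-leaf b * at-leaf b) + h * h * s)
             (trans (sum-cong-≗ (λ c → sum-cong-≗ (λ c′ → cong (_* (P c * P c′)) (sym (sum-δ (ctr c) (centre c′))))))
               (sym (squares centre))) ⟩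
      sum (λ b → at-leaf b * at-leaf b) + h * h * sum (λ a → at-centre a * at-centre a) ∎
      where
      open ≡-Reasoning
      ring : ∀ o k s p → (o + k * s) * p ≡ o * p + k * (s * p)
      ring = solve-∀

module Survivors {n m} (E : Rel n) (E-sym : Symmetric E) (q h : ℕ) (h≡8q : h ≡ 8 * q) (ctr : Fin m → Fin n)
    (S : Fin m → Fin n → Bool)
  (#S : ∀ c → # (S c) ≡ h)
  (packing : ∀ a b → sum (λ c → ⟦ does (a ≟ ctr c) ⟧ * ⟦ S c b ⟧) ≤ ⟦ E a b ⟧)
  (apart : ∀ c c′ → S c (ctr c′) ≡ true → ⊥) where

  open Stars h ctr S #S

  -- The stars have `h * sum P` edges, and capping degrees at `8 * h` loses at most 1 / (8h) of the
  -- sum of squared degrees. By the hypothesis more than h / 8 = q edges remain per element counted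
  -- in `# x + sum P`, which bounds the number of leaves and centres. Passing to minimum degree `q`
  -- finishes, since `8 * h` is `64 * q`.
  survivors-subgraph : (P : Fin m → ℕ) → (∀ c → P c ≤ 1) → (x : Fin n → Bool) →
    (∀ c → 0 < P c → ∀ b → S c b ≡ true → x b ≡ true) →
    h * h * # x + sum (λ c → sum (λ c′ → conflict c c′ * (P c * P c′))) < 7 * (h * h) * sum P →
    AlmostRegularSubgraph q E
  survivors-subgraph P P≤1 x Px few = result
    where
    A B : Fin n → ℕ
    A = at-centre P
    B = at-leaf P
    φ : Fin n → Fin n → ℕ
    φ = edge P
    φ≤E : ∀ a b → φ a b ≤ ⟦ E a b ⟧
    φ≤E a b = ≤-trans (sum-mono λ c → ≤-trans (*-monoˡ-≤ _ (P≤1 c)) (≤-reflexive (*-identityˡ _))) (packing a b)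
    φ≤1 : ∀ a b → φ a b ≤ 1
    φ≤1 a b = ≤-trans (φ≤E a b) (⟦⟧≤1 (E a b))
    -- The dropped vertices have degree above 8h, so the sum of squared degrees bounds the number of lost edges.
    keep : Rel n
    keep a b = does (1 ≤? φ a b) ∧ (does (B b ≤? 8 * h) ∧ does (A a ≤? 8))
    keep-edge : ∀ {a b} → keep a b ≡ true → 1 ≤ φ a b × B b ≤ 8 * h × A a ≤ 8
    keep-edge {a} {b} k = let k₁ , k₂₃ = ∧-true {does (1 ≤? φ a b)} k ; k₂ , k₃ = ∧-true {does (B b ≤? 8 * h)} k₂₃ in
      does-true (1 ≤? φ a b) k₁ , does-true (B b ≤? 8 * h) k₂ , does-true (A a ≤? 8) k₃
    edge-star : ∀ {a b} → 1 ≤ φ a b → ∃[ c ] 0 < P c × a ≡ ctr c × S c b ≡ true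
    edge-star {a} {b} pos = let c , lt = sum>0 _ pos in c , factors c lt
      where
      factors : ∀ c → 0 < P c * (centre c a * ⟦ S c b ⟧) → 0 < P c × a ≡ ctr c × S c b ≡ true
      factors c lt with P c | a ≟ ctr c | S c b
      ... | suc p | yes e | true = z<s , e , refl
      ... | suc p | yes e | false = contradiction (subst (0 <_) (*-zeroʳ p) lt) λ ()
      ... | suc p | no _ | _ = contradiction (subst (0 <_) (*-zeroʳ p) lt) λ ()
    -- No centre is a leaf. So symmetrising `keep` doubles the edge count exactly, and the degree of
    -- a vertex is its out-degree or its in-degree, never a sum of both.
    keep-one-way : ∀ {a b b′} → keep a b ≡ true → keep b′ a ≡ true → ⊥
    keep-one-way {a} {b} {b′} k k′ with edge-star {a} {b} (proj₁ (keep-edge {a} {b} k)) | edge-star {b′} {a}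
        (proj₁ (keep-edge {b′} {a} k′))
    ... | c , _ , refl , _ | c′ , _ , _ , s = apart c′ c s
    G : Rel n
    G u v = keep u v ∨ keep v u
    G-sym : Symmetric G
    G-sym u v g with keep u v | keep v u
    ... | true | true = refl
    ... | true | false = refl
    ... | false | true = refl
    keep⊑E : keep ⊑ E
    keep⊑E a b k = ⟦⟧>0 (≤-trans (proj₁ (keep-edge {a} {b} k)) (φ≤E a b))
    G⊑E : G ⊑ E
    G⊑E u v g = case ∨-true (keep u v) g of λ where
      (inj₁ k) → keep⊑E u v k
      (inj₂ k) → E-sym v u (keep⊑E v u k)
    kept : ℕ
    kept = sum (λ a → sum (λ b → ⟦ keep a b ⟧))
    sum-deg-G : 2 * kept ≤ sum (deg G)
    sum-deg-G = begin
      2 * kept ≡⟨ cong (kept +_) (+-identityʳ kept) ⟩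
      kept + kept ≡⟨ cong (kept +_) (sum-comm (λ a b → ⟦ keep a b ⟧)) ⟩
      kept + sum (λ u → sum (λ v → ⟦ keep v u ⟧)) ≡⟨ sym (sum-+ (λ u → sum (λ v → ⟦ keep u v ⟧)) _) ⟩
      sum (λ u → sum (λ v → ⟦ keep u v ⟧) + sum (λ v → ⟦ keep v u ⟧)) ≡⟨ sum-cong-≗
          (λ u → sym (sum-+ (λ v → ⟦ keep u v ⟧) _)) ⟩
      sum (λ u → sum (λ v → ⟦ keep u v ⟧ + ⟦ keep v u ⟧)) ≤⟨ sum-mono (λ u → sum-mono (pt u)) ⟩
      sum (deg G) ∎
      where
      open ≤-Reasoning
      pt : ∀ u v → ⟦ keep u v ⟧ + ⟦ keep v u ⟧ ≤ ⟦ G u v ⟧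
      pt u v with keep u v in e | keep v u in e′
      ... | true | true = ⊥-elim (keep-one-way {u} {v} {v} e e′)
      ... | true | false = ≤-refl
      ... | false | true = ≤-refl
      ... | false | false = z≤n
    edges-lost : 8 * h * (h * sum P) ≤ 8 * h * kept + sum (λ c → sum (λ c′ → conflict c c′ * (P c * P c′)))
    edges-lost = begin
      8 * h * (h * sum P) ≡⟨ cong (λ s → 8 * h * (h * s)) (sym (sum-centre P)) ⟩
      8 * h * (h * sum A) ≡⟨ cong (8 * h *_) (trans (*-sum h A) (sum-cong-≗ (λ a → sym (edge-row P a)))) ⟩
      8 * h * sum (λ a → sum (φ a)) ≡⟨ trans (*-sum (8 * h) (λ a → sum (φ a)))
          (sum-cong-≗ (λ a → *-sum (8 * h) (φ a))) ⟩
      sum (λ a → sum (λ b → 8 * h * φ a b)) ≤⟨ sum-mono (λ a → sum-mono (pt a)) ⟩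
      sum (λ a → sum (λ b → 8 * h * ⟦ keep a b ⟧ + (B b * φ a b + h * A a * φ a b)))
        ≡⟨ trans (sum-cong-≗ (λ a → split (λ b → 8 * h * ⟦ keep a b ⟧) (λ b → B b * φ a b) (λ b → h * A a * φ a b)))
                 (split (λ a → sum (λ b → 8 * h * ⟦ keep a b ⟧)) (λ a → sum (λ b → B b * φ a b))
                     (λ a → sum (λ b → h * A a * φ a b))) ⟩
      sum (λ a → sum (λ b → 8 * h * ⟦ keep a b ⟧)) + (sum (λ a → sum (λ b → B b * φ a b)) + sum (λ a → sum
          (λ b → h * A a * φ a b)))
        ≡⟨ cong₂ _+_ (sym (trans (*-sum (8 * h) (deg keep))
            (sum-cong-≗ (λ a → *-sum (8 * h) (λ b → ⟦ keep a b ⟧))))) (cong₂ _+_ leaves centres) ⟩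
      8 * h * kept + (sum (λ b → B b * B b) + h * h * sum (λ a → A a * A a)) ≡⟨ cong (8 * h * kept +_)
          (sym (conflicts P)) ⟩
      8 * h * kept + sum (λ c → sum (λ c′ → conflict c c′ * (P c * P c′))) ∎
      where
      open ≤-Reasoning
      split : ∀ {k} (f g g′ : Fin k → ℕ) → sum (λ i → f i + (g i + g′ i)) ≡ sum f + (sum g + sum g′)
      split f g g′ = trans (sum-+ f _) (cong (sum f +_) (sum-+ g g′))
      leaves : sum (λ a → sum (λ b → B b * φ a b)) ≡ sum (λ b → B b * B b)
      leaves = trans (sum-comm (λ a b → B b * φ a b)) (sum-cong-≗ (λ b →
        trans (sym (*-sum (B b) (λ a → φ a b))) (cong (B b *_) (edge-column P b))))
      centres : sum (λ a → sum (λ b → h * A a * φ a b)) ≡ h * h * sum (λ a → A a * A a)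
      centres = trans (sum-cong-≗ (λ a → trans (sym (*-sum (h * A a) (φ a)))
          (trans (cong (h * A a *_) (edge-row P a)) (ring h (A a)))))
        (sym (*-sum (h * h) (λ a → A a * A a)))
        where
        ring : ∀ h a → h * a * (h * a) ≡ h * h * (a * a)
        ring = solve-∀
      pt : ∀ a b → 8 * h * φ a b ≤ 8 * h * ⟦ keep a b ⟧ + (B b * φ a b + h * A a * φ a b)
      pt a b with 1 ≤? φ a b | B b ≤? 8 * h | A a ≤? 8
      ... | no p | _ | _ = ≤-trans (*-monoʳ-≤ (8 * h) (s≤s⁻¹ (≰⇒> p))) (≤-trans (≤-reflexive (*-zeroʳ (8 * h))) z≤n)
      ... | yes p | yes p′ | yes p″ = ≤-trans (*-monoʳ-≤ (8 * h) (≤-trans (φ≤1 a b) (≤-reflexive (sym (⟦⟧≡1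
        (true-∧ (dec-true (1 ≤? φ a b) p) (true-∧ (dec-true (B b ≤? 8 * h) p′) (dec-true (A a ≤? 8) p″))))))))
            (m≤m+n _ _)
      ... | yes p | no B> | _ = ≤-trans (*-monoˡ-≤ (φ a b) (<⇒≤ (≰⇒> B>)))
          (≤-trans (m≤m+n (B b * φ a b) (h * A a * φ a b)) (m≤n+m _ (8 * h * ⟦ keep a b ⟧)))
      ... | yes p | yes _ | no A> = ≤-trans (*-monoˡ-≤ (φ a b) (subst (_≤ h * A a) (*-comm h 8)
          (*-monoʳ-≤ h (<⇒≤ (≰⇒> A>)))))
                                     (≤-trans (m≤n+m (h * A a * φ a b) (B b * φ a b))
                                         (m≤n+m _ (8 * h * ⟦ keep a b ⟧)))
    X : Fin n → Bool
    X v = x v ∨ does (1 ≤? A v)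
    X-size : # X ≤ # x + sum P
    X-size = begin
      # X ≤⟨ sum-mono pt ⟩
      sum (λ v → ⟦ x v ⟧ + A v) ≡⟨ sum-+ (λ v → ⟦ x v ⟧) A ⟩
      # x + sum A ≡⟨ cong (# x +_) (sum-centre P) ⟩
      # x + sum P ∎
      where
      open ≤-Reasoning
      pt : ∀ v → ⟦ X v ⟧ ≤ ⟦ x v ⟧ + A v
      pt v = ⟦⟧≤ (X v) λ X∋v → case ∨-true (x v) X∋v of λ where
        (inj₁ p) → ≤-trans (≤-reflexive (sym (⟦⟧≡1 p))) (m≤m+n _ _)
        (inj₂ p) → ≤-trans (does-true (1 ≤? A v) p) (m≤n+m _ _)
    X-supp : ∀ u v → G u v ≡ true → X u ≡ true
    X-supp u v g = case ∨-true (keep u v) g of λ where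
      (inj₁ k) → case edge-star {u} {v} (proj₁ (keep-edge {u} {v} k)) of λ where
        (c , Pc , refl , _) → true-∨ʳ (x u) (dec-true (1 ≤? A u) (≤-trans (subst (1 ≤_) (sym
            (trans (cong (P c *_) (⟦⟧≡1 (dec-true (u ≟ u) refl))) (*-identityʳ _))) Pc)
            (term≤sum (λ c → P c * centre c u) c)))
      (inj₂ k) → case edge-star {v} {u} (proj₁ (keep-edge {v} {u} k)) of λ where
        (c , Pc , _ , s) → true-∨ˡ (Px c Pc u s)
    out≤ : ∀ u → deg keep u ≤ 8 * h
    out≤ u with A u ≤? 8
    ... | yes p = begin
      deg keep u ≤⟨ sum-mono (λ b → pt b) ⟩
      sum (φ u) ≡⟨ edge-row P u ⟩
      h * A u ≤⟨ *-monoʳ-≤ h p ⟩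
      h * 8 ≡⟨ *-comm h 8 ⟩
      8 * h ∎
      where
      open ≤-Reasoning
      pt : ∀ b → ⟦ keep u b ⟧ ≤ φ u b
      pt b with keep u b in e
      ... | true = proj₁ (keep-edge {u} {b} e)
      ... | false = z≤n
    ... | no p = ≤-trans (≤-reflexive (sum-0 (λ b → pt b))) z≤n
      where
      pt : ∀ b → ⟦ keep u b ⟧ ≡ 0
      pt b with keep u b in e
      ... | true = contradiction (proj₂ (proj₂ (keep-edge {u} {b} e))) p
      ... | false = refl
    in≤ : ∀ u → sum (λ v → ⟦ keep v u ⟧) ≤ 8 * h
    in≤ u with B u ≤? 8 * h
    ... | yes p = begin
      sum (λ v → ⟦ keep v u ⟧) ≤⟨ sum-mono (λ b → pt b) ⟩
      sum (λ v → φ v u) ≡⟨ edge-column P u ⟩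
      B u ≤⟨ p ⟩
      8 * h ∎
      where
      open ≤-Reasoning
      pt : ∀ b → ⟦ keep b u ⟧ ≤ φ b u
      pt b with keep b u in e
      ... | true = proj₁ (keep-edge {b} {u} e)
      ... | false = z≤n
    ... | no p = ≤-trans (≤-reflexive (sum-0 (λ b → pt b))) z≤n
      where
      pt : ∀ b → ⟦ keep b u ⟧ ≡ 0
      pt b with keep b u in e
      ... | true = contradiction (proj₁ (proj₂ (keep-edge {b} {u} e))) p
      ... | false = refl
    deg-G≤ : ∀ u → deg G u ≤ 64 * q
    deg-G≤ u = subst (deg G u ≤_) (trans (cong (8 *_) h≡8q) (ring q)) (case any? (λ v → keep u v 𝔹.≟ true) of λ where
        (yes (v , k)) → ≤-trans (sum-mono λ w → ⟦⟧-mono λ g → case ∨-true (keep u w) g of λ where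
            (inj₁ p) → p
            (inj₂ p) → ⊥-elim (keep-one-way {u} {v} {w} k p)) (out≤ u)
        (no none) → ≤-trans (sum-mono λ w → ⟦⟧-mono λ g → case ∨-true (keep u w) g of λ where
            (inj₁ p) → ⊥-elim (none (w , p))
            (inj₂ p) → p) (in≤ u))
      where
      ring : ∀ q → 8 * (8 * q) ≡ 64 * q
      ring = solve-∀
    dense : 2 * q * # X < sum (deg G)
    dense = <-≤-trans (arith h h≡8q (# X) (# x) (sum P) kept _ X-size edges-lost few) sum-deg-G
      where
      arith : ∀ h → h ≡ 8 * q → ∀ X x p k Q → X ≤ x + p → 8 * h * (h * p) ≤ 8 * h * k + Q → h * h * x + Q < 7 *
          (h * h) * p → 2 * q * X < 2 * k
      arith h refl X x p k Q h₁ h₂ h₃ = ≤-<-trans (*-monoʳ-≤ (2 * q) h₁) (*-cancelˡ-< (4 * h) _ _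
        (≤-from 0 (+-mono-≤ h₂ h₃) (ring q x p k Q)))
        where
        ring : ∀ q x p k Q → suc (4 * (8 * q) * (2 * q * (x + p))) +
            (8 * (8 * q) * k + Q + 7 * (8 * q * (8 * q)) * p) + 0 ≡
          4 * (8 * q) * (2 * k) + (8 * (8 * q) * (8 * q * p) + suc (8 * q * (8 * q) * x + Q))
        ring = solve-∀
    result : AlmostRegularSubgraph q E
    result = let F , F⊑G , md = minDegree-subgraph q (# X) G X ≤-refl G-sym X-supp dense in
      F , ⊑-trans {E = F} {G} {E} F⊑G G⊑E , md , λ v → ≤-trans (deg-mono {E = G} {F} F⊑G v) (deg-G≤ v)

-- The random sample

module Pairs {n m} (p r : Fin n → ℕ) (p′ r′ : Fin m → ℕ) where

  𝔼₂ : ((Fin n → Bool) → (Fin m → Bool) → ℕ) → ℕ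
  𝔼₂ f = 𝔼 p r (λ x → 𝔼 p′ r′ (f x))

  𝔼₂-cong : ∀ {f g} → (∀ x w → f x w ≡ g x w) → 𝔼₂ f ≡ 𝔼₂ g
  𝔼₂-cong h = 𝔼-cong p r (λ x → 𝔼-cong p′ r′ (h x))

  𝔼₂-+ : ∀ f g → 𝔼₂ (λ x w → f x w + g x w) ≡ 𝔼₂ f + 𝔼₂ g
  𝔼₂-+ f g = trans (𝔼-cong p r (λ x → 𝔼-+ p′ r′ (f x) (g x))) (𝔼-+ p r _ _)

  𝔼₂-* : ∀ c f → 𝔼₂ (λ x w → c * f x w) ≡ c * 𝔼₂ f
  𝔼₂-* c f = trans (𝔼-cong p r (λ x → 𝔼-* p′ r′ c (f x))) (𝔼-* p r c _)

  𝔼₂-sum : ∀ {k} (f : Fin k → (Fin n → Bool) → (Fin m → Bool) → ℕ) →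
    𝔼₂ (λ x w → sum (λ i → f i x w)) ≡ sum (λ i → 𝔼₂ (f i))
  𝔼₂-sum f = trans (𝔼-cong p r (λ x → 𝔼-sum p′ r′ (λ i → f i x))) (𝔼-sum p r (λ i x → 𝔼 p′ r′ (f i x)))

  𝔼₂-< : ∀ f g → 𝔼₂ f < 𝔼₂ g → ∃[ x ] ∃[ w ] f x w < g x w
  𝔼₂-< f g lt = let x , lt′ = 𝔼-< p r _ _ lt in x , 𝔼-< p′ r′ _ _ lt′

  𝔼₂-contains : ∀ U U′ → 𝔼₂ (λ x w → contains x U * contains w U′) ≡ weight p r U * weight p′ r′ U′
  𝔼₂-contains U U′ = begin
    𝔼₂ (λ x w → contains x U * contains w U′) ≡⟨ 𝔼-cong p r (λ x → trans (𝔼-* p′ r′ (contains x U) (λ w →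
        contains w U′)) (trans (cong (contains x U *_) (𝔼-contains p′ r′ U′)) (*-comm (contains x U) _))) ⟩
    𝔼 p r (λ x → weight p′ r′ U′ * contains x U) ≡⟨ 𝔼-* p r (weight p′ r′ U′) (λ x → contains x U) ⟩
    weight p′ r′ U′ * 𝔼 p r (λ x → contains x U) ≡⟨ cong (weight p′ r′ U′ *_) (𝔼-contains p r U) ⟩
    weight p′ r′ U′ * weight p r U ≡⟨ *-comm (weight p′ r′ U′) _ ⟩
    weight p r U * weight p′ r′ U′ ∎
    where open ≡-Reasoning

also-meets : ∀ {n m} (S : Fin m → Fin n → Bool) → Fin m → Fin n → Fin m → Bool
also-meets S c b c′ = does (any? (λ b′ → ¬? (b′ ≟ b) ×-dec ((S c b′ 𝔹.≟ true) ×-dec (S c′ b′ 𝔹.≟ true))))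

-- Leaf `b` is kept with probability `y b / T`, which is at least `1 / R` if a star uses it. `d≤y`
-- pays for stars meeting a given one only at `b`, `heavy` for those meeting it elsewhere too, and
-- `siblings` for those with the same centre. `∑y` says that at most 5/2 leaves are kept per
-- surviving star, in expectation.
module Sampling {n m} (E : Rel n) (E-sym : Symmetric E) (q h : ℕ) (q≥1 : 1 ≤ q) (h≡8q : h ≡ 8 * q)
    (ctr : Fin m → Fin n) (S : Fin m → Fin n → Bool)
  (#S : ∀ c → # (S c) ≡ h)
  (packing : ∀ a b → sum (λ c → ⟦ does (a ≟ ctr c) ⟧ * ⟦ S c b ⟧) ≤ ⟦ E a b ⟧)
  (apart : ∀ c c′ → S c (ctr c′) ≡ true → ⊥)
  (T R : ℕ) (y : Fin n → ℕ)
  (m≥1 : 1 ≤ m) (R≥1 : 1 ≤ R)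
  (y≤T : ∀ b → y b ≤ T)
  (T≤Ry : ∀ c b → S c b ≡ true → T ≤ R * y b)
  (d≤y : ∀ b → sum (λ c → ⟦ S c b ⟧) ≤ y b)
  (hRʰ≤T : h * R ^ h ≤ T)
  (siblings : ∀ a → h * sum (λ c → ⟦ does (a ≟ ctr c) ⟧) ≤ T)
  (heavy : ∀ c b → S c b ≡ true → sum (λ c′ → ⟦ S c′ b ∧ (also-meets S c b c′ ∧ not (does (c′ ≟ c))) ⟧) * R ^ h ≤ T)
  (∑y : 2 * sum y ≤ 5 * (h * m))
  where

  open Stars h ctr S #S

  private
    T>0 : 0 < T
    T>0 = ≤-trans (subst (λ k → 0 < k * R ^ h) (sym h≡8q)
        (*-mono-≤ (*-mono-≤ {1} {8} (s≤s z≤n) q≥1) (m^n>0 R h))) hRʰ≤T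
      where instance _ = >-nonZero R≥1
    instance
      T-nonZero : NonZero T
      T-nonZero = >-nonZero T>0
      Tⁿ-nonZero : NonZero (T ^ n)
      Tⁿ-nonZero = m^n≢0 T n

    r : Fin n → ℕ
    r b = T ∸ y b
    y+r : ∀ b → y b + r b ≡ T
    y+r b = m+[n∸m]≡n (y≤T b)

    -- With weight y r (S c) / T ^ n the probability that all leaves of c are kept, the star c itself is
    -- kept with probability p′ c / (p′ c + r′ c), so that it survives with probability h / T.
    p′ r′ : Fin m → ℕ
    p′ c = h * T ^ n
    r′ c = T * weight y r (S c) ∸ p′ c
    -- The leaves of a star are all kept with probability at least 1 / R^h, which `hRʰ≤T` makes at
    -- least h / T. So thinning can only lower it to h / T, and the subtraction in `r′` is not
    -- truncated.
    p′≤ : ∀ c → h * T ^ n ≤ T * weight y r (S c)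
    p′≤ c = begin
      h * T ^ n ≤⟨ *-monoʳ-≤ h (weight-lower y r T R y+r (S c) (T≤Ry c)) ⟩
      h * (R ^ # (S c) * weight y r (S c)) ≡⟨ cong (λ k → h * (R ^ k * weight y r (S c))) (#S c) ⟩
      h * (R ^ h * weight y r (S c)) ≡⟨ sym (*-assoc h _ _) ⟩
      h * R ^ h * weight y r (S c) ≤⟨ *-monoˡ-≤ _ hRʰ≤T ⟩
      T * weight y r (S c) ∎
      where open ≤-Reasoning
    p′+r′ : ∀ c → p′ c + r′ c ≡ T * weight y r (S c)
    p′+r′ c = m+[n∸m]≡n (p′≤ c)

    open Pairs y r p′ r′

    Π N : ℕ
    Π = weight p′ r′ ∅
    N = h * T ^ n * Π

    h>0 : 0 < h
    h>0 = subst (0 <_) (sym h≡8q) (*-mono-≤ {1} {8} (s≤s z≤n) q≥1)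

    Π>0 : 0 < Π
    Π>0 = weight-∅>0 p′ r′ (λ c → <-≤-trans (*-mono-≤ h>0 (m^n>0 T n)) (m≤m+n _ _))

    instance
      Π-nonZero : NonZero Π
      Π-nonZero = >-nonZero Π>0

    N>0 : 0 < N
    N>0 = *-mono-≤ (*-mono-≤ h>0 (m^n>0 T n)) Π>0

    survive : Fin m → ℕ
    survive c = weight y r (S c) * weight p′ r′ ⁅ c ⁆

    -- With total mass `T ^ n * Π`, this is the survival probability h / T. Accordingly
    -- `T * both c c′` compared with `N` is the probability of `c′` given `c`.
    survive-T : ∀ c → survive c * T ≡ N
    survive-T c = begin
      weight y r (S c) * weight p′ r′ ⁅ c ⁆ * T ≡⟨ ring (weight y r (S c)) (weight p′ r′ ⁅ c ⁆) T ⟩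
      weight p′ r′ ⁅ c ⁆ * (T * weight y r (S c)) ≡⟨ cong (weight p′ r′ ⁅ c ⁆ *_) (sym (p′+r′ c)) ⟩
      weight p′ r′ ⁅ c ⁆ * (p′ c + r′ c) ≡⟨ weight-⁅⁆ p′ r′ c ⟩
      N ∎
      where
      open ≡-Reasoning
      ring : ∀ a b t → a * b * t ≡ b * (t * a)
      ring = solve-∀

    both : Fin m → Fin m → ℕ
    both c c′ = weight y r (S c ∪ S c′) * weight p′ r′ (⁅ c ⁆ ∪ ⁅ c′ ⁆)

    both-diag : ∀ c → both c c ≡ survive c
    both-diag c = cong₂ _*_ (weight-cong y r (λ i → ∨-idem (S c i))) (weight-cong p′ r′ (λ i → ∨-idem (⁅ c ⁆ i)))

    -- In probabilities: P(both survive) times P(common leaves kept) is (h / T)². Modularity handles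
    -- the leaves, and the private coins of distinct stars are independent.
    both-T² : ∀ {c c′} → c′ ≢ c → both c c′ * weight y r (S c ∩ S c′) * T * T ≡ h * T ^ n * N
    both-T² {c} {c′} c′≢c = *-cancelʳ-≡ _ _ Π (begin
      W∪ * W₂ * W∩ * T * T * Π ≡⟨ ring₁ W∪ W₂ W∩ T Π ⟩
      (W∪ * W∩) * (W₂ * Π) * (T * T) ≡⟨ cong₂ (λ a b → a * b * (T * T)) (weight-modular y r (S c) (S c′)) W₂Π ⟩
      (weight y r (S c) * weight y r (S c′)) * (weight p′ r′ ⁅ c ⁆ * weight p′ r′ ⁅ c′ ⁆) * (T * T) ≡⟨ ring₂
          (weight y r (S c)) (weight y r (S c′)) (weight p′ r′ ⁅ c ⁆) (weight p′ r′ ⁅ c′ ⁆) T ⟩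
      survive c * T * (survive c′ * T) ≡⟨ cong₂ _*_ (survive-T c) (survive-T c′) ⟩
      N * N ≡⟨ ring₃ h (T ^ n) Π N ⟩
      h * T ^ n * N * Π ∎)
      where
      open ≡-Reasoning
      W∪ = weight y r (S c ∪ S c′)
      W∩ = weight y r (S c ∩ S c′)
      W₂ = weight p′ r′ (⁅ c ⁆ ∪ ⁅ c′ ⁆)
      disjoint : ∀ i → false ≡ (⁅ c ⁆ ∩ ⁅ c′ ⁆) i
      disjoint i with i ≟ c | i ≟ c′
      ... | yes refl | yes refl = contradiction refl c′≢c
      ... | yes _ | no _ = refl
      ... | no _ | _ = refl
      W₂Π : W₂ * Π ≡ weight p′ r′ ⁅ c ⁆ * weight p′ r′ ⁅ c′ ⁆
      W₂Π = trans (cong (W₂ *_) (weight-cong p′ r′ disjoint)) (weight-modular p′ r′ ⁅ c ⁆ ⁅ c′ ⁆)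
      ring₁ : ∀ a b c t d → a * b * c * t * t * d ≡ (a * c) * (b * d) * (t * t)
      ring₁ = solve-∀
      ring₂ : ∀ a a′ b b′ t → (a * a′) * (b * b′) * (t * t) ≡ a * b * t * (a′ * b′ * t)
      ring₂ = solve-∀
      ring₃ : ∀ h t p n → h * t * p * n ≡ h * t * n * p
      ring₃ = solve-∀

    both-disjoint : ∀ {c c′} → c′ ≢ c → (∀ b → S c b ≡ true → S c′ b ≡ true → ⊥) → both c c′ * T * T ≡ h * N
    both-disjoint {c} {c′} c′≢c disj = *-cancelʳ-≡ _ _ (T ^ n) (begin
      both c c′ * T * T * T ^ n ≡⟨ ring₁ (both c c′) T (T ^ n) ⟩
      both c c′ * T ^ n * T * T ≡⟨ cong (λ k → both c c′ * k * T * T)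
          (trans (sym (weight-∅ y r T y+r)) (weight-cong y r empty)) ⟩
      both c c′ * weight y r (S c ∩ S c′) * T * T ≡⟨ both-T² c′≢c ⟩
      h * T ^ n * N ≡⟨ ring₂ h (T ^ n) N ⟩
      h * N * T ^ n ∎)
      where
      open ≡-Reasoning
      empty : ∀ i → false ≡ (S c ∩ S c′) i
      empty i with S c i in e | S c′ i in e′
      ... | true | true = ⊥-elim (disj i e e′)
      ... | true | false = refl
      ... | false | _ = refl
      ring₁ : ∀ a t k → a * t * t * k ≡ a * k * t * t
      ring₁ = solve-∀
      ring₂ : ∀ a t k → a * t * k ≡ a * k * t
      ring₂ = solve-∀

    -- The single common leaf is kept with probability `y b / T`, so given `c` the star `c′`
    -- survives with probability `h / y b`.
    both-light : ∀ {c c′ b} → c′ ≢ c → S c b ≡ true → S c′ b ≡ true →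
        (∀ b′ → b′ ≢ b → S c b′ ≡ true → S c′ b′ ≡ true → ⊥) →
      y b * (T * both c c′) ≡ h * N
    both-light {c} {c′} {b} c′≢c Scb Sc′b only = *-cancelʳ-≡ _ _ (T ^ n) (begin
      y b * (T * both c c′) * T ^ n ≡⟨ ring₁ (y b) (both c c′) T (T ^ n) ⟩
      both c c′ * (y b * T ^ n) * T ≡⟨ cong (λ k → both c c′ * k * T) one ⟩
      both c c′ * (weight y r (S c ∩ S c′) * T) * T ≡⟨ cong (_* T) (sym (*-assoc (both c c′) _ T)) ⟩
      both c c′ * weight y r (S c ∩ S c′) * T * T ≡⟨ both-T² c′≢c ⟩
      h * T ^ n * N ≡⟨ ring₂ h (T ^ n) N ⟩
      h * N * T ^ n ∎)
      where
      open ≡-Reasoning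
      single : ∀ i → ⁅ b ⁆ i ≡ (S c ∩ S c′) i
      single i with i ≟ b
      ... | yes refl = sym (true-∧ Scb Sc′b)
      ... | no i≢b with S c i in e | S c′ i in e′
      ...   | true | true = ⊥-elim (only i i≢b e e′)
      ...   | true | false = refl
      ...   | false | _ = refl
      one : y b * T ^ n ≡ weight y r (S c ∩ S c′) * T
      one = begin
        y b * T ^ n ≡⟨ cong (y b *_) (sym (weight-∅ y r T y+r)) ⟩
        y b * weight y r ∅ ≡⟨ sym (weight-⁅⁆ y r b) ⟩
        weight y r ⁅ b ⁆ * (y b + r b) ≡⟨ cong₂ _*_ (weight-cong y r single) (y+r b) ⟩
        weight y r (S c ∩ S c′) * T ∎
      ring₁ : ∀ y a t k → y * (t * a) * k ≡ a * (y * k) * t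
      ring₁ = solve-∀
      ring₂ : ∀ a t k → a * t * k ≡ a * k * t
      ring₂ = solve-∀

    -- At most `h` leaves are common, each kept with probability at least `1 / R`, so knowing that
    -- `c` survives helps `c′` by a factor of at most `R ^ h`.
    both-any : ∀ {c c′} → c′ ≢ c → T * (T * both c c′) ≤ R ^ h * (h * N)
    both-any {c} {c′} c′≢c = *-cancelʳ-≤ _ _ (T ^ n) (begin
      T * (T * both c c′) * T ^ n ≤⟨ *-monoʳ-≤ (T * (T * both c c′)) lower ⟩
      T * (T * both c c′) * (R ^ h * weight y r (S c ∩ S c′)) ≡⟨ ring₁ T (both c c′) (R ^ h)
          (weight y r (S c ∩ S c′)) ⟩
      R ^ h * (both c c′ * weight y r (S c ∩ S c′) * T * T) ≡⟨ cong (R ^ h *_) (both-T² c′≢c) ⟩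
      R ^ h * (h * T ^ n * N) ≡⟨ ring₂ (R ^ h) h (T ^ n) N ⟩
      R ^ h * (h * N) * T ^ n ∎)
      where
      open ≤-Reasoning
      instance _ = >-nonZero R≥1
      lower : T ^ n ≤ R ^ h * weight y r (S c ∩ S c′)
      lower = ≤-trans (weight-lower y r T R y+r (S c ∩ S c′) (λ i p → T≤Ry c i (proj₁ (∧-true p))))
        (*-monoˡ-≤ _ (^-monoʳ-≤ R (subst (# (S c ∩ S c′) ≤_) (#S c)
            (#-mono {_} {S c ∩ S c′} {S c} (λ i p → proj₁ (∧-true p))))))
      ring₁ : ∀ t a k w → t * (t * a) * (k * w) ≡ k * (a * w * t * t)
      ring₁ = solve-∀
      ring₂ : ∀ r h t n → r * (h * t * n) ≡ r * (h * n) * t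
      ring₂ = solve-∀

    -- A common leaf would put its edge to the common centre into two stars of the packing.
    same-centre-disjoint : ∀ {c c′} → c′ ≢ c → ctr c ≡ ctr c′ → ∀ b → S c b ≡ true → S c′ b ≡ true → ⊥
    same-centre-disjoint {c} {c′} c′≢c e b s s′ = contradiction
      (≤-trans (two-terms≤sum (λ k → centre k (ctr c) * ⟦ S k b ⟧) c′≢c)
          (≤-trans (packing (ctr c) b) (⟦⟧≤1 (E (ctr c) b))))
      (subst₂ (λ u v → ¬ (u + v ≤ 1)) (sym (one c′ e s′)) (sym (one c refl s)) λ { (s≤s ()) })
      where
      one : ∀ k → ctr c ≡ ctr k → S k b ≡ true → centre k (ctr c) * ⟦ S k b ⟧ ≡ 1
      one k e s = cong₂ _*_ (⟦⟧≡1 (dec-true (ctr c ≟ ctr k) e)) (⟦⟧≡1 s)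

    -- Given that star c survives, the expected number of surviving stars through one of its leaves is at most 1 + 2h.
    through-leaf : ∀ c b → S c b ≡ true → sum (λ c′ → ⟦ S c′ b ⟧ * (T * both c c′)) ≤ N + 2 * (h * N)
    through-leaf c b Scb = begin
      sum (λ c′ → ⟦ S c′ b ⟧ * (T * both c c′)) ≤⟨ sum-mono pt ⟩
      sum (λ c′ → ⟦ does (c′ ≟ c) ⟧ * (T * both c c′) + (⟦ light c′ ⟧ * (T * both c c′) + ⟦ hvy c′ ⟧ *
          (T * both c c′)))
        ≡⟨ trans (sum-+ (λ c′ → ⟦ does (c′ ≟ c) ⟧ * (T * both c c′)) _)
            (cong₂ _+_ (sum-δ c (λ c′ → T * both c c′)) (sum-+ (λ c′ → ⟦ light c′ ⟧ * (T * both c c′)) _)) ⟩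
      T * both c c + (sum (λ c′ → ⟦ light c′ ⟧ * (T * both c c′)) + sum (λ c′ → ⟦ hvy c′ ⟧ * (T * both c c′)))
        ≤⟨ +-mono-≤ (≤-reflexive (trans (*-comm T _) (trans (cong (_* T) (both-diag c)) (survive-T c))))
            (+-mono-≤ light-sum heavy-sum) ⟩
      N + (h * N + h * N) ≡⟨ cong (λ k → N + (h * N + k)) (sym (+-identityʳ _)) ⟩
      N + 2 * (h * N) ∎
      where
      open ≤-Reasoning
      meets : Fin m → Bool
      meets = also-meets S c b
      light hvy : Fin m → Bool
      light c′ = S c′ b ∧ (not (meets c′) ∧ not (does (c′ ≟ c)))
      hvy c′ = S c′ b ∧ (meets c′ ∧ not (does (c′ ≟ c)))
      pt : ∀ c′ → ⟦ S c′ b ⟧ * (T * both c c′) ≤ ⟦ does (c′ ≟ c) ⟧ * (T * both c c′) +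
          (⟦ light c′ ⟧ * (T * both c c′) + ⟦ hvy c′ ⟧ * (T * both c c′))
      pt c′ with S c′ b | meets c′ | does (c′ ≟ c)
      ... | false | _ | _ = z≤n
      ... | true | _ | true = m≤m+n _ _
      ... | true | true | false = ≤-refl
      ... | true | false | false = m≤m+n _ 0
      ≢-from : ∀ {c′} → not (does (c′ ≟ c)) ≡ true → c′ ≢ c
      ≢-from {c′} p with c′ ≟ c
      ... | no ¬e = ¬e
      instance
        y-nonZero : NonZero (y b)
        y-nonZero = >-nonZero (*-pos⇒posʳ R (y b) (<-≤-trans T>0 (T≤Ry c b Scb)))
      -- At most `y b` stars contain `b`, and each contributes `h / y b`: this is why leaves are
      -- kept in proportion to their degree.
      light-sum : sum (λ c′ → ⟦ light c′ ⟧ * (T * both c c′)) ≤ h * N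
      light-sum = *-cancelˡ-≤ (y b) (begin
        y b * sum (λ c′ → ⟦ light c′ ⟧ * (T * both c c′)) ≡⟨ *-sum (y b) (λ c′ → ⟦ light c′ ⟧ * (T * both c c′)) ⟩
        sum (λ c′ → y b * (⟦ light c′ ⟧ * (T * both c c′))) ≤⟨ sum-mono pt₁ ⟩
        sum (λ c′ → ⟦ S c′ b ⟧ * (h * N)) ≡⟨ sym (sum-* (h * N) (λ c′ → ⟦ S c′ b ⟧)) ⟩
        sum (λ c′ → ⟦ S c′ b ⟧) * (h * N) ≤⟨ *-monoˡ-≤ (h * N) (d≤y b) ⟩
        y b * (h * N) ∎)
        where
        pt₁ : ∀ c′ → y b * (⟦ light c′ ⟧ * (T * both c c′)) ≤ ⟦ S c′ b ⟧ * (h * N)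
        pt₁ c′ with light c′ in e
        ... | false = ≤-trans (≤-reflexive (*-zeroʳ (y b))) z≤n
        ... | true = let s , e₁ = ∧-true {S c′ b} e ; e₂ , e₃ = ∧-true {not (meets c′)} e₁ in ≤-reflexive (trans (cong (y b *_) (+-identityʳ _))
            (trans (both-light (≢-from {c′} e₃) Scb s
              (λ b′ b′≢b t t′ → contradiction (trans (sym e₂) (cong not (dec-true (any? (λ b′ → ¬?
                  (b′ ≟ b) ×-dec ((S c b′ 𝔹.≟ true) ×-dec (S c′ b′ 𝔹.≟ true)))) (b′ , b′≢b , t , t′)))) λ ()))
            (trans (sym (+-identityʳ _)) (cong (_* (h * N)) (sym (⟦⟧≡1 s))))))
      -- Each of these survives with conditional probability at most `R ^ h * h / T`, and `heavy`
      -- allows at most `T / R ^ h` of them.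
      heavy-sum : sum (λ c′ → ⟦ hvy c′ ⟧ * (T * both c c′)) ≤ h * N
      heavy-sum = *-cancelˡ-≤ T (begin
        T * sum (λ c′ → ⟦ hvy c′ ⟧ * (T * both c c′)) ≡⟨ *-sum T (λ c′ → ⟦ hvy c′ ⟧ * (T * both c c′)) ⟩
        sum (λ c′ → T * (⟦ hvy c′ ⟧ * (T * both c c′))) ≤⟨ sum-mono pt₂ ⟩
        sum (λ c′ → ⟦ hvy c′ ⟧ * (R ^ h * (h * N))) ≡⟨ sym (sum-* (R ^ h * (h * N)) (λ c′ → ⟦ hvy c′ ⟧)) ⟩
        # hvy * (R ^ h * (h * N)) ≡⟨ sym (*-assoc (# hvy) _ _) ⟩
        # hvy * R ^ h * (h * N) ≤⟨ *-monoˡ-≤ (h * N) (heavy c b Scb) ⟩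
        T * (h * N) ∎)
        where
        pt₂ : ∀ c′ → T * (⟦ hvy c′ ⟧ * (T * both c c′)) ≤ ⟦ hvy c′ ⟧ * (R ^ h * (h * N))
        pt₂ c′ with hvy c′ in e
        ... | false = ≤-trans (≤-reflexive (*-zeroʳ T)) z≤n
        ... | true = let _ , e₁ = ∧-true {S c′ b} e ; _ , e₃ = ∧-true {meets c′} e₁ in
          subst₂ _≤_ (cong (T *_) (sym (+-identityʳ _))) (sym (+-identityʳ _)) (both-any (≢-from {c′} e₃))

    -- The star itself counts 1. The others at its centre share no leaf with it, so they survive
    -- independently with probability h / T, and there are at most T / h of them.
    through-centre : ∀ c → sum (λ c′ → centre c′ (ctr c) * (T * both c c′)) ≤ N + N
    through-centre c = begin
      sum (λ c′ → centre c′ (ctr c) * (T * both c c′)) ≤⟨ sum-mono pt ⟩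
      sum (λ c′ → ⟦ does (c′ ≟ c) ⟧ * (T * both c c′) + other c′ * (T * both c c′))
        ≡⟨ trans (sum-+ (λ c′ → ⟦ does (c′ ≟ c) ⟧ * (T * both c c′)) _)
            (cong (_+ sum (λ c′ → other c′ * (T * both c c′))) (sum-δ c (λ c′ → T * both c c′))) ⟩
      T * both c c + sum (λ c′ → other c′ * (T * both c c′))
        ≤⟨ +-mono-≤ (≤-reflexive (trans (*-comm T _) (trans (cong (_* T) (both-diag c)) (survive-T c)))) other-sum ⟩
      N + N ∎
      where
      open ≤-Reasoning
      other : Fin m → ℕ
      other c′ = ⟦ not (does (c′ ≟ c)) ⟧ * centre c′ (ctr c)
      pt : ∀ c′ → centre c′ (ctr c) * (T * both c c′) ≤ ⟦ does (c′ ≟ c) ⟧ * (T * both c c′) + other c′ *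
          (T * both c c′)
      pt c′ with does (c′ ≟ c) | does (ctr c ≟ ctr c′)
      ... | true | true = m≤m+n _ _
      ... | true | false = z≤n
      ... | false | true = ≤-refl
      ... | false | false = z≤n
      other-sum : sum (λ c′ → other c′ * (T * both c c′)) ≤ N
      other-sum = *-cancelˡ-≤ T (begin
        T * sum (λ c′ → other c′ * (T * both c c′)) ≡⟨ *-sum T (λ c′ → other c′ * (T * both c c′)) ⟩
        sum (λ c′ → T * (other c′ * (T * both c c′))) ≤⟨ sum-mono pt₁ ⟩
        sum (λ c′ → centre c′ (ctr c) * (h * N)) ≡⟨ sym (sum-* (h * N) (λ c′ → centre c′ (ctr c))) ⟩
        sum (λ c′ → centre c′ (ctr c)) * (h * N) ≡⟨ ring (sum (λ c′ → centre c′ (ctr c))) h N ⟩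
        h * sum (λ c′ → centre c′ (ctr c)) * N ≤⟨ *-monoˡ-≤ N (siblings (ctr c)) ⟩
        T * N ∎)
        where
        ring : ∀ s h n → s * (h * n) ≡ h * s * n
        ring = solve-∀
        pt₁ : ∀ c′ → T * (other c′ * (T * both c c′)) ≤ centre c′ (ctr c) * (h * N)
        pt₁ c′ with c′ ≟ c | ctr c ≟ ctr c′
        ... | yes _ | _ = ≤-trans (≤-reflexive (*-zeroʳ T)) z≤n
        ... | no _ | no _ = ≤-trans (≤-reflexive (*-zeroʳ T)) z≤n
        ... | no c′≢c | yes e = ≤-reflexive (trans (ring₂ T (both c c′)) (trans (both-disjoint c′≢c
            (same-centre-disjoint c′≢c e)) (sym (+-identityʳ _))))
          where
          ring₂ : ∀ t a → t * (1 * (t * a)) ≡ a * t * t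
          ring₂ = solve-∀

    -- Given that `c` survives, each of its `h` leaves contributes at most 1 + 2h, and the centre at
    -- most 2 with weight `h * h`.
    conflicts-of : ∀ c → T * sum (λ c′ → conflict c c′ * both c c′) ≤ (h + 4 * (h * h)) * N
    conflicts-of c = begin
      T * sum (λ c′ → conflict c c′ * both c c′)
        ≡⟨ trans (*-sum T (λ c′ → conflict c c′ * both c c′)) (sum-cong-≗ (λ c′ → ring₁ T (shared c c′) (h * h)
            (centre c′ (ctr c)) (both c c′))) ⟩
      sum (λ c′ → shared c c′ * (T * both c c′) + h * h * (centre c′ (ctr c) * (T * both c c′)))
        ≡⟨ trans (sum-+ (λ c′ → shared c c′ * (T * both c c′)) _) (cong₂ _+_ leaves (sym (*-sum (h * h) (λ c′ →
            centre c′ (ctr c) * (T * both c c′))))) ⟩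
      sum (λ b → ⟦ S c b ⟧ * sum (λ c′ → ⟦ S c′ b ⟧ * (T * both c c′))) + h * h * sum
          (λ c′ → centre c′ (ctr c) * (T * both c c′))
        ≤⟨ +-mono-≤ (sum-mono (λ b → ⟦⟧*-≤ (S c b) (through-leaf c b))) (*-monoʳ-≤ (h * h) (through-centre c)) ⟩
      sum (λ b → ⟦ S c b ⟧ * (N + 2 * (h * N))) + h * h * (N + N)
        ≡⟨ cong (_+ h * h * (N + N)) (trans (sym (sum-* (N + 2 * (h * N)) (λ b → ⟦ S c b ⟧)))
            (cong (_* (N + 2 * (h * N))) (#S c))) ⟩
      h * (N + 2 * (h * N)) + h * h * (N + N) ≡⟨ ring₂ h N ⟩
      (h + 4 * (h * h)) * N ∎
      where
      open ≤-Reasoning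
      ring₁ : ∀ t o k s v → t * ((o + k * s) * v) ≡ o * (t * v) + k * (s * (t * v))
      ring₁ = solve-∀
      ring₂ : ∀ h n → h * (n + 2 * (h * n)) + h * h * (n + n) ≡ (h + 4 * (h * h)) * n
      ring₂ = solve-∀
      leaves : sum (λ c′ → shared c c′ * (T * both c c′)) ≡ sum
          (λ b → ⟦ S c b ⟧ * sum (λ c′ → ⟦ S c′ b ⟧ * (T * both c c′)))
      leaves = trans (sum-cong-≗ (λ c′ → sum-* (T * both c c′) (λ b → ⟦ S c b ⟧ * ⟦ S c′ b ⟧)))
        (trans (sum-comm (λ c′ b → ⟦ S c b ⟧ * ⟦ S c′ b ⟧ * (T * both c c′)))
          (sum-cong-≗ (λ b → trans (sum-cong-≗ (λ c′ → *-assoc ⟦ S c b ⟧ ⟦ S c′ b ⟧ (T * both c c′)))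
              (sym (*-sum ⟦ S c b ⟧ (λ c′ → ⟦ S c′ b ⟧ * (T * both c c′)))))))

    P : (Fin n → Bool) → (Fin m → Bool) → Fin m → ℕ
    P x w c = contains x (S c) * contains w ⁅ c ⁆

    lhs rhs : (Fin n → Bool) → (Fin m → Bool) → ℕ
    lhs x w = h * h * # x + sum (λ c → sum (λ c′ → conflict c c′ * (P x w c * P x w c′)))
    rhs x w = 7 * (h * h) * sum (P x w)

    𝔼-lhs : 𝔼₂ lhs ≡ h * h * sum (λ b → weight y r ⁅ b ⁆ * Π) + sum (λ c → sum (λ c′ → conflict c c′ * both c c′))
    𝔼-lhs = trans (𝔼₂-+ (λ x w → h * h * # x) _) (cong₂ _+_
      (trans (𝔼₂-* (h * h) (λ x w → # x)) (cong (h * h *_) (trans (𝔼₂-sum (λ b x w → ⟦ x b ⟧)) (sum-cong-≗ (λ b →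
        trans (𝔼₂-cong (λ x w → sym (trans (cong₂ _*_ (contains-⁅⁆ x b) (contains-∅ w)) (*-identityʳ _))))
            (𝔼₂-contains ⁅ b ⁆ ∅))))))
      (trans (𝔼₂-sum (λ c x w → sum (λ c′ → conflict c c′ * (P x w c * P x w c′)))) (sum-cong-≗ (λ c →
        trans (𝔼₂-sum (λ c′ x w → conflict c c′ * (P x w c * P x w c′))) (sum-cong-≗ (λ c′ →
          trans (𝔼₂-* (conflict c c′) (λ x w → P x w c * P x w c′)) (cong (conflict c c′ *_)
            (trans (𝔼₂-cong (λ x w → trans (ring (contains x (S c)) (contains w ⁅ c ⁆) (contains x (S c′))
                (contains w ⁅ c′ ⁆)) (cong₂ _*_ (contains-∪ x (S c) (S c′)) (contains-∪ w ⁅ c ⁆ ⁅ c′ ⁆))))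
                (𝔼₂-contains (S c ∪ S c′) (⁅ c ⁆ ∪ ⁅ c′ ⁆))))))))))
      where
      ring : ∀ a b c d → a * b * (c * d) ≡ a * c * (b * d)
      ring = solve-∀

    𝔼-rhs : 𝔼₂ rhs ≡ 7 * (h * h) * sum survive
    𝔼-rhs = trans (𝔼₂-* (7 * (h * h)) (λ x w → sum (P x w))) (cong (7 * (h * h) *_) (trans (𝔼₂-sum (λ c x w →
        P x w c)) (sum-cong-≗ (λ c → 𝔼₂-contains (S c) ⁅ c ⁆))))

    -- Per expected surviving star, the kept leaves cost at most 5/2 h² and the conflicts at most
    -- 4h² + h. The total is below 7h² as soon as h > 2.
    𝔼-lhs<rhs : 𝔼₂ lhs < 𝔼₂ rhs
    𝔼-lhs<rhs = subst₂ _<_ (sym 𝔼-lhs) (sym 𝔼-rhs) (arith h (h>2 h≡8q) (sum (λ b → weight y r ⁅ b ⁆ * Π))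
        (sum (λ c → sum (λ c′ → conflict c c′ * both c c′))) (sum survive) (sum y) ∑y vertices all-conflicts stars)
      where
      h>2 : ∀ {h} → h ≡ 8 * q → 3 ≤ h
      h>2 refl = ≤-trans (m≤m+n 3 5) (*-monoʳ-≤ 8 q≥1)
      vertices : h * T * sum (λ b → weight y r ⁅ b ⁆ * Π) ≡ N * sum y
      vertices = begin
        h * T * sum (λ b → weight y r ⁅ b ⁆ * Π) ≡⟨ *-sum (h * T) (λ b → weight y r ⁅ b ⁆ * Π) ⟩
        sum (λ b → h * T * (weight y r ⁅ b ⁆ * Π)) ≡⟨ sum-cong-≗ (λ b → begin
          h * T * (weight y r ⁅ b ⁆ * Π) ≡⟨ ring₁ h T (weight y r ⁅ b ⁆) Π ⟩
          h * Π * (weight y r ⁅ b ⁆ * T) ≡⟨ cong (λ t → h * Π * (weight y r ⁅ b ⁆ * t)) (sym (y+r b)) ⟩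
          h * Π * (weight y r ⁅ b ⁆ * (y b + r b)) ≡⟨ cong (h * Π *_) (weight-⁅⁆ y r b) ⟩
          h * Π * (y b * weight y r ∅) ≡⟨ cong (λ k → h * Π * (y b * k)) (weight-∅ y r T y+r) ⟩
          h * Π * (y b * T ^ n) ≡⟨ ring₂ h Π (y b) (T ^ n) ⟩
          N * y b ∎) ⟩
        sum (λ b → N * y b) ≡⟨ sym (*-sum N y) ⟩
        N * sum y ∎
        where
        open ≡-Reasoning
        ring₁ : ∀ h t w p → h * t * (w * p) ≡ h * p * (w * t)
        ring₁ = solve-∀
        ring₂ : ∀ h p y t → h * p * (y * t) ≡ h * t * p * y
        ring₂ = solve-∀
      all-conflicts : T * sum (λ c → sum (λ c′ → conflict c c′ * both c c′)) ≤ m * ((h + 4 * (h * h)) * N)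
      all-conflicts = ≤-trans (≤-reflexive (*-sum T (λ c → sum (λ c′ → conflict c c′ * both c c′)))) (≤-trans (sum-mono conflicts-of) (≤-reflexive (sum-const m _)))
      stars : sum survive * T ≡ m * N
      stars = trans (sum-* T survive) (trans (sum-cong-≗ survive-T) (sum-const m N))
      arith : ∀ h → 3 ≤ h → ∀ v k s Y → 2 * Y ≤ 5 * (h * m) → h * T * v ≡ N * Y → T * k ≤ m *
          ((h + 4 * (h * h)) * N) → s * T ≡ m * N →
        h * h * v + k < 7 * (h * h) * s
      arith h h≥3 v k s Y ∑Y h₁ h₂ h₃ = *-cancelʳ-< (2 * h * T) _ _ (begin-strict
        (h * h * v + k) * (2 * h * T) ≡⟨ ring₁ h v k T ⟩
        2 * (h * h) * (h * T * v) + 2 * h * (T * k) ≤⟨ +-mono-≤ (≤-reflexive (cong (2 * (h * h) *_) h₁))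
            (*-monoʳ-≤ (2 * h) h₂) ⟩
        2 * (h * h) * (N * Y) + 2 * h * (m * ((h + 4 * (h * h)) * N)) ≡⟨ ring₂ h N Y m ⟩
        h * h * N * (2 * Y) + 2 * h * (m * ((h + 4 * (h * h)) * N)) ≤⟨ +-monoˡ-≤ _ (*-monoʳ-≤ (h * h * N) ∑Y) ⟩
        h * h * N * (5 * (h * m)) + 2 * h * (m * ((h + 4 * (h * h)) * N)) ≡⟨ ring₃ h N m ⟩
        2 * (h * h * (m * N)) + 13 * (h * (h * h * (m * N))) <⟨ +-monoˡ-< _ (*-monoˡ-< (h * h * (m * N)) h≥3) ⟩
        h * (h * h * (m * N)) + 13 * (h * (h * h * (m * N))) ≡⟨ ring₄ h (m * N) ⟩
        7 * (h * h) * (m * N) * (2 * h) ≡⟨ cong (λ z → 7 * (h * h) * z * (2 * h)) (sym h₃) ⟩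
        7 * (h * h) * (s * T) * (2 * h) ≡⟨ ring₅ h s T ⟩
        7 * (h * h) * s * (2 * h * T) ∎)
        where
        open ≤-Reasoning
        h>0′ : 0 < h
        h>0′ = ≤-trans (s≤s z≤n) h≥3
        instance
          _ = >-nonZero (*-mono-≤ (*-mono-≤ h>0′ h>0′) (*-mono-≤ m≥1 N>0))
        ring₁ : ∀ h v k T → (h * h * v + k) * (2 * h * T) ≡ 2 * (h * h) * (h * T * v) + 2 * h * (T * k)
        ring₁ = solve-∀
        ring₂ : ∀ h N Y m → 2 * (h * h) * (N * Y) + 2 * h * (m * ((h + 4 * (h * h)) * N)) ≡ h * h * N *
            (2 * Y) + 2 * h * (m * ((h + 4 * (h * h)) * N))
        ring₂ = solve-∀
        ring₃ : ∀ h N m → h * h * N * (5 * (h * m)) + 2 * h * (m * ((h + 4 * (h * h)) * N)) ≡ 2 *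
            (h * h * (m * N)) + 13 * (h * (h * h * (m * N)))
        ring₃ = solve-∀
        ring₄ : ∀ h M → h * (h * h * M) + 13 * (h * (h * h * M)) ≡ 7 * (h * h) * M * (2 * h)
        ring₄ = solve-∀
        ring₅ : ∀ h s T → 7 * (h * h) * (s * T) * (2 * h) ≡ 7 * (h * h) * s * (2 * h * T)
        ring₅ = solve-∀

  almostRegular : AlmostRegularSubgraph q E
  almostRegular = let x , w , lt = 𝔼₂-< lhs rhs 𝔼-lhs<rhs in
    Survivors.survivors-subgraph E E-sym q h h≡8q ctr S #S packing apart
      (P x w)
      (λ c → *-mono-≤ (contains≤1 x (S c)) (contains≤1 w ⁅ c ⁆))
      x
      (λ c pos b → contains>0 x (S c) (*-pos⇒posʳ (contains w ⁅ c ⁆) (contains x (S c))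
          (subst (0 <_) (*-comm (contains x (S c)) (contains w ⁅ c ⁆)) pos)) b)
      lt

-- Packing stars

not-true : ∀ {p} {P : Set p} (d : Dec P) → not (does d) ≡ true → ¬ P
not-true (no ¬p) _ = ¬p

true-not : ∀ {p} {P : Set p} (d : Dec P) → ¬ P → not (does d) ≡ true
true-not d ¬p = cong not (dec-false d ¬p)

-- Since a star with centre a and leaf b contributes 1 to the left-hand side, the inequality says
-- both that the stars are contained in F and that they are edge-disjoint.
StarPacking : ∀ {n m} → Rel n → (Fin m → Fin n) → (Fin m → Fin n → Bool) → Set
StarPacking F ctr S = ∀ a b → sum (λ c → ⟦ does (a ≟ ctr c) ⟧ * ⟦ S c b ⟧) ≤ ⟦ F a b ⟧

star-packing : ∀ {n} σ → 1 ≤ σ → ∀ N (F : Rel n) → sum (deg F) ≤ N → (A : Fin n → Bool) →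
    (∀ a b → F a b ≡ true → A a ≡ true) →
  ∃[ m ] Σ (Fin m → Fin n) λ ctr → Σ (Fin m → Fin n → Bool) λ S →
    (∀ c → # (S c) ≡ σ) × StarPacking F ctr S × sum (deg F) ≤ σ * m + σ * # A
star-packing {n} σ σ≥1 N F F≤N A supp with any? (λ a → σ ≤? deg F a)
... | no none = 0 , (λ ()) , (λ ()) , (λ ()) , (λ _ _ → z≤n) , (begin
  sum (deg F) ≤⟨ sum-mono pt ⟩
  sum (λ a → σ * ⟦ A a ⟧) ≡⟨ sym (*-sum σ (λ a → ⟦ A a ⟧)) ⟩
  σ * # A ≤⟨ m≤n+m _ (σ * 0) ⟩
  σ * 0 + σ * # A ∎)
  where
  open ≤-Reasoning
  pt : ∀ a → deg F a ≤ σ * ⟦ A a ⟧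
  pt a with A a in e
  ... | true = ≤-trans (<⇒≤ (≰⇒> (λ p → none (a , p)))) (≤-reflexive (sym (*-identityʳ σ)))
  ... | false = ≤-trans (≤-reflexive (sum-0 (λ b → empty b))) z≤n
    where
    empty : ∀ b → ⟦ F a b ⟧ ≡ 0
    empty b with F a b in f
    ... | true = contradiction (trans (sym e) (supp a b f)) λ ()
    ... | false = refl
star-packing {n} σ σ≥1 zero F F≤N A supp | yes (a , big) = contradiction
    (≤-trans (≤-trans (≤-trans σ≥1 big) (term≤sum (deg F) a)) F≤N) λ ()
star-packing {n} σ σ≥1 (suc N) F F≤N A supp | yes (a , big) with subset-of-size (F a) σ big
... | Q , Q⊆F , #Q = let m , ctr , S , #S , packing , count = star-packing σ σ≥1 N F′ F′≤N A (λ x b p → supp x b (proj₁ (∧-true p))) in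
  suc m , a Vector.∷ ctr , Q Vector.∷ S , (λ { zero → #Q ; (suc c) → #S c }) ,
  (λ x b → ≤-trans (+-monoʳ-≤ (⟦ does (x ≟ a) ⟧ * ⟦ Q b ⟧) (packing x b))
      (≤-reflexive (trans (+-comm _ ⟦ F′ x b ⟧) (sym (split x b))))) ,
  arith m (# A) count
  where
  F′ : Rel n
  F′ x b = F x b ∧ not (does (x ≟ a) ∧ Q b)
  split : ∀ x b → ⟦ F x b ⟧ ≡ ⟦ F′ x b ⟧ + ⟦ does (x ≟ a) ⟧ * ⟦ Q b ⟧
  split x b with x ≟ a | Q b in e
  ... | yes refl | true rewrite Q⊆F b e = refl
  ... | yes refl | false with F a b
  ...   | true = refl
  ...   | false = refl
  split x b | no _ | _ with F x b
  ...   | true = refl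
  ...   | false = refl
  total : sum (deg F) ≡ sum (deg F′) + σ
  total = begin
    sum (deg F) ≡⟨ sum-cong-≗ (λ x → trans (sum-cong-≗ (split x))
        (trans (sum-+ (λ b → ⟦ F′ x b ⟧) _) (cong (deg F′ x +_) (sym (*-sum ⟦ does (x ≟ a) ⟧ (λ b → ⟦ Q b ⟧)))))) ⟩
    sum (λ x → deg F′ x + ⟦ does (x ≟ a) ⟧ * # Q) ≡⟨ sum-+ (deg F′) _ ⟩
    sum (deg F′) + sum (λ x → ⟦ does (x ≟ a) ⟧ * # Q) ≡⟨ cong (sum (deg F′) +_) (trans (sum-δ a (λ _ → # Q)) #Q) ⟩
    sum (deg F′) + σ ∎
    where open ≡-Reasoning
  F′≤N : sum (deg F′) ≤ N
  F′≤N = s≤s⁻¹ (≤-trans (subst (_≤ sum (deg F′) + σ) (+-comm (sum (deg F′)) 1) (+-monoʳ-≤ (sum (deg F′)) σ≥1))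
      (subst (_≤ suc N) total F≤N))
  arith : ∀ m x → sum (deg F′) ≤ σ * m + σ * x → sum (deg F) ≤ σ * suc m + σ * x
  arith m x h = ≤-trans (≤-reflexive total) (≤-trans (+-monoˡ-≤ σ h) (≤-reflexive (ring σ m x)))
    where
    ring : ∀ s m x → s * m + s * x + s ≡ s * suc m + s * x
    ring = solve-∀

-- Pigeonhole from the top: either the mass below `θ W` already exceeds `W * X`, or the last window
-- carries more than `X`.
window : ∀ {n} (θ : ℕ → ℕ) (D f : Fin n → ℕ) X → (∀ b → θ 0 ≤ D b ⊎ f b ≡ 0) → ∀ W →
  W * X < sum (λ b → ⟦ does (D b <? θ W) ⟧ * f b) →
  ∃[ t ] X < sum (λ b → ⟦ does (θ t ≤? D b) ∧ does (D b <? θ (suc t)) ⟧ * f b)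
window θ D f X low zero lt = contradiction (<-≤-trans lt (≤-reflexive (sum-0 empty))) λ ()
  where
  empty : ∀ b → ⟦ does (D b <? θ 0) ⟧ * f b ≡ 0
  empty b = case low b of λ where
    (inj₁ p) → cong (λ z → ⟦ z ⟧ * f b) (dec-false (D b <? θ 0) (≤⇒≯ p))
    (inj₂ p) → trans (cong (⟦ does (D b <? θ 0) ⟧ *_) p) (*-zeroʳ ⟦ does (D b <? θ 0) ⟧)
window θ D f X low (suc W) lt with W * X <? sum (λ b → ⟦ does (D b <? θ W) ⟧ * f b)
... | yes p = window θ D f X low W p
... | no p = W , +-cancelʳ-< (W * X) _ _ (begin-strict
  X + W * X <⟨ lt ⟩
  sum (λ b → ⟦ does (D b <? θ (suc W)) ⟧ * f b) ≤⟨ sum-mono pt ⟩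
  sum (λ b → ⟦ does (θ W ≤? D b) ∧ does (D b <? θ (suc W)) ⟧ * f b + ⟦ does (D b <? θ W) ⟧ * f b)
    ≡⟨ sum-+ (λ b → ⟦ does (θ W ≤? D b) ∧ does (D b <? θ (suc W)) ⟧ * f b) _ ⟩
  sum (λ b → ⟦ does (θ W ≤? D b) ∧ does (D b <? θ (suc W)) ⟧ * f b) + sum (λ b → ⟦ does (D b <? θ W) ⟧ * f b)
    ≤⟨ +-monoʳ-≤ (sum (λ b → ⟦ does (θ W ≤? D b) ∧ does (D b <? θ (suc W)) ⟧ * f b)) (≮⇒≥ p) ⟩
  sum (λ b → ⟦ does (θ W ≤? D b) ∧ does (D b <? θ (suc W)) ⟧ * f b) + W * X ∎)
  where
  open ≤-Reasoning
  cover : ∀ x y z → (x ≡ false → y ≡ true) → ⟦ z ⟧ ≤ ⟦ x ∧ z ⟧ + ⟦ y ⟧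
  cover true y z h = m≤m+n _ _
  cover false y z h rewrite h refl = ⟦⟧≤1 z
  pt : ∀ b → ⟦ does (D b <? θ (suc W)) ⟧ * f b ≤ ⟦ does (θ W ≤? D b) ∧ does (D b <? θ (suc W)) ⟧ * f b + ⟦ does
      (D b <? θ W) ⟧ * f b
  pt b = ≤-trans (*-monoˡ-≤ (f b) (cover (does (θ W ≤? D b)) (does (D b <? θ W)) (does (D b <? θ (suc W)))
      (λ e → dec-true (D b <? θ W) (≰⇒> (does-false (θ W ≤? D b) e)))))
    (≤-reflexive (*-distribʳ-+ (f b) ⟦ does (θ W ≤? D b) ∧ does (D b <? θ (suc W)) ⟧ _))

removing : ∀ {n} (p : Fin n → Bool) j → # p ≤ suc (# (λ i → p i ∧ not (does (i ≟ j))))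
removing p j = begin
  # p ≤⟨ sum-mono pt ⟩
  sum (λ i → ⟦ does (i ≟ j) ⟧ * 1 + ⟦ p i ∧ not (does (i ≟ j)) ⟧) ≡⟨ sum-+ (λ i → ⟦ does (i ≟ j) ⟧ * 1) _ ⟩
  sum (λ i → ⟦ does (i ≟ j) ⟧ * 1) + # (λ i → p i ∧ not (does (i ≟ j))) ≡⟨ cong
      (_+ # (λ i → p i ∧ not (does (i ≟ j)))) (sum-δ j (λ _ → 1)) ⟩
  suc (# (λ i → p i ∧ not (does (i ≟ j)))) ∎
  where
  open ≤-Reasoning
  pt : ∀ i → ⟦ p i ⟧ ≤ ⟦ does (i ≟ j) ⟧ * 1 + ⟦ p i ∧ not (does (i ≟ j)) ⟧
  pt i with p i | does (i ≟ j)
  ... | true | true = s≤s z≤n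
  ... | true | false = s≤s z≤n
  ... | false | _ = z≤n

adding : ∀ {n} (p : Fin n → Bool) j → p j ≡ false → # (λ i → p i ∨ does (i ≟ j)) ≡ suc (# p)
adding p j pj = begin
  # (λ i → p i ∨ does (i ≟ j)) ≡⟨ sum-cong-≗ pt ⟩
  sum (λ i → ⟦ does (i ≟ j) ⟧ * 1 + ⟦ p i ⟧) ≡⟨ sum-+ (λ i → ⟦ does (i ≟ j) ⟧ * 1) _ ⟩
  sum (λ i → ⟦ does (i ≟ j) ⟧ * 1) + # p ≡⟨ cong (_+ # p) (sum-δ j (λ _ → 1)) ⟩
  suc (# p) ∎
  where
  open ≡-Reasoning
  pt : ∀ i → ⟦ p i ∨ does (i ≟ j) ⟧ ≡ ⟦ does (i ≟ j) ⟧ * 1 + ⟦ p i ⟧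
  pt i with i ≟ j
  ... | yes refl rewrite pj = refl
  ... | no _ with p i
  ...   | true = refl
  ...   | false = refl

false-from : ∀ {b} → (b ≡ true → ⊥) → b ≡ false
false-from {true} h = ⊥-elim (h refl)
false-from {false} h = refl

-- The Kővári-Sós-Turán pigeonhole, one leaf at a time: some leaf of `P` lies in at least a `1 / p`
-- fraction of the stars of `Q`; fix it, keep those stars and continue in the rest of `P`.
common-leaves : ∀ {n m} (S : Fin m → Fin n → Bool) K p j (Q : Fin m → Bool) (P : Fin n → Bool) → # P ≤ p →
  (∀ c → Q c ≡ true → j ≤ # (λ b → S c b ∧ P b)) → K * p ^ j < # Q →
  ∃[ J ] Σ (Fin m → Bool) λ Q′ → (∀ b → J b ≡ true → P b ≡ true) × # J ≡ j ×
      (∀ c → Q′ c ≡ true → Q c ≡ true) × K < # Q′ ×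
    (∀ c b → Q′ c ≡ true → J b ≡ true → S c b ≡ true)
common-leaves {n} S K p zero Q P P≤p many big = (λ _ → false) , Q , (λ _ ()) , sum-0 {n} {λ _ → 0}
    (λ _ → refl) , (λ _ q → q) ,
  subst (_< # Q) (*-identityʳ K) big , (λ _ _ _ ())
common-leaves {n} {m} S K p (suc j) Q P P≤p many big with sum-< (λ b → ⟦ P b ⟧ * (K * p ^ j))
    (λ b → ⟦ P b ⟧ * # (λ c → Q c ∧ S c b)) (begin-strict
    sum (λ b → ⟦ P b ⟧ * (K * p ^ j)) ≡⟨ sym (sum-* (K * p ^ j) (λ b → ⟦ P b ⟧)) ⟩
    # P * (K * p ^ j) ≤⟨ *-monoˡ-≤ (K * p ^ j) P≤p ⟩
    p * (K * p ^ j) ≡⟨ ring p K (p ^ j) ⟩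
    K * (p * p ^ j) <⟨ big ⟩
    # Q ≤⟨ sum-mono (λ c → at c) ⟩
    sum (λ c → sum (λ b → ⟦ P b ⟧ * ⟦ Q c ∧ S c b ⟧)) ≡⟨ sum-comm (λ c b → ⟦ P b ⟧ * ⟦ Q c ∧ S c b ⟧) ⟩
    sum (λ b → sum (λ c → ⟦ P b ⟧ * ⟦ Q c ∧ S c b ⟧)) ≡⟨ sum-cong-≗
        (λ b → sym (*-sum ⟦ P b ⟧ (λ c → ⟦ Q c ∧ S c b ⟧))) ⟩
    sum (λ b → ⟦ P b ⟧ * # (λ c → Q c ∧ S c b)) ∎)
  where
  open ≤-Reasoning
  ring : ∀ p k x → p * (k * x) ≡ k * (p * x)
  ring = solve-∀
  pt : ∀ x y → ⟦ y ∧ x ⟧ ≤ ⟦ x ⟧ * ⟦ y ⟧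
  pt true true = s≤s z≤n
  pt false true = z≤n
  pt _ false = z≤n
  at : ∀ c → ⟦ Q c ⟧ ≤ sum (λ b → ⟦ P b ⟧ * ⟦ Q c ∧ S c b ⟧)
  at c with Q c in e
  ... | false = z≤n
  ... | true = ≤-trans (s≤s z≤n) (≤-trans (many c e) (sum-mono (λ b → pt (P b) (S c b))))
... | b , lt with P b in Pb
...   | false = contradiction lt λ ()
...   | true = let J , Q′ , J⊆ , #J , Q′⊆ , K< , all = rec in
  (λ i → J i ∨ does (i ≟ b)) , Q′ ,
  (λ i p → case ∨-true (J i) p of λ where
    (inj₁ q) → proj₁ (∧-true (J⊆ i q))
    (inj₂ q) → subst (λ z → P z ≡ true) (sym (does-true (i ≟ b) q)) Pb) ,
  trans (adding J b (false-from λ q → not-true (b ≟ b) (proj₂ (∧-true {P b} (J⊆ b q))) refl)) (cong suc #J) ,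
  (λ c q → proj₁ (∧-true (Q′⊆ c q))) , K< ,
  (λ c i q p → case ∨-true (J i) p of λ where
    (inj₁ r) → all c i q r
    (inj₂ r) → subst (λ z → S c z ≡ true) (sym (does-true (i ≟ b) r)) (proj₂ (∧-true {Q c} (Q′⊆ c q))))
  where
  P₁ : Fin n → Bool
  P₁ i = P i ∧ not (does (i ≟ b))
  Q₁ : Fin m → Bool
  Q₁ c = Q c ∧ S c b
  many₁ : ∀ c → Q₁ c ≡ true → j ≤ # (λ i → S c i ∧ P₁ i)
  many₁ c q = s≤s⁻¹ (≤-trans (many c (proj₁ (∧-true q))) (≤-trans (removing (λ i → S c i ∧ P i) b)
    (s≤s (#-mono {p = λ i → (S c i ∧ P i) ∧ not (does (i ≟ b))} {λ i → S c i ∧ P₁ i} (λ i p → let l , r = ∧-true {S c i ∧ P i} p ; l₁ , l₂ = ∧-true {S c i} l in true-∧ l₁ (true-∧ l₂ r))))))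
  rec = common-leaves S K p j Q₁ P₁ (≤-trans (#-mono {p = P₁} {P} (λ i → proj₁ ∘ ∧-true)) P≤p) many₁
      (subst₂ _<_ (+-identityʳ _) (+-identityʳ _) lt)

-- Greedy: each chosen vertex rules out itself and at most `k` neighbours.
independent : ∀ {n} (H : Rel n) → Symmetric H → ∀ k h (G : Fin n → Bool) → suc k * h ≤ # G →
  (∀ b → G b ≡ true → # (λ b′ → G b′ ∧ H b b′) ≤ k) →
  ∃[ I ] (∀ b → I b ≡ true → G b ≡ true) × # I ≡ h × (∀ b b′ → I b ≡ true → I b′ ≡ true → b ≢ b′ → H b b′ ≡ true → ⊥)
independent {n} H H-sym k zero G big few = (λ _ → false) , (λ _ ()) , sum-0 {n} {λ _ → 0} (λ _ → refl) , (λ _ _ ())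
independent {n} H H-sym k (suc h) G big few with sum>0 (λ b → ⟦ G b ⟧) (≤-trans (s≤s z≤n) big)
... | v , pos = let I , I⊆ , #I , free = independent H H-sym k h G′ big′ few′ in
  (λ i → I i ∨ does (i ≟ v)) ,
  (λ b p → case ∨-true (I b) p of λ where
    (inj₁ q) → proj₁ (∧-true (I⊆ b q))
    (inj₂ q) → subst (λ z → G z ≡ true) (sym (does-true (b ≟ v) q)) Gv) ,
  trans (adding I v (false-from λ q → not-true (v ≟ v) (proj₁ (parts (I⊆ v q))) refl)) (cong suc #I) ,
  λ b b′ p p′ b≢b′ hb → case ∨-true (I b) p , ∨-true (I b′) p′ of λ where
    (inj₁ q , inj₁ q′) → free b b′ q q′ b≢b′ hb
    (inj₁ q , inj₂ q′) → proj₂ (parts (I⊆ b q)) (subst (λ z → H z b ≡ true) (does-true (b′ ≟ v) q′) (H-sym b b′ hb))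
    (inj₂ q , inj₁ q′) → proj₂ (parts (I⊆ b′ q′)) (subst (λ z → H z b′ ≡ true) (does-true (b ≟ v) q) hb)
    (inj₂ q , inj₂ q′) → b≢b′ (trans (does-true (b ≟ v) q) (sym (does-true (b′ ≟ v) q′)))
  where
  Gv : G v ≡ true
  Gv = ⟦⟧>0 pos
  G′ : Fin n → Bool
  G′ i = G i ∧ (not (does (i ≟ v)) ∧ not (H v i))
  parts : ∀ {b} → G′ b ≡ true → not (does (b ≟ v)) ≡ true × (H v b ≡ true → ⊥)
  parts {b} g = let _ , r = ∧-true {G b} g ; r₁ , r₂ = ∧-true {not (does (b ≟ v))} r in r₁ , λ hv → contradiction (trans (sym r₂) (cong not hv)) λ ()
  loss : # G ≤ # G′ + suc k
  loss = begin
    # G ≤⟨ sum-mono pt ⟩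
    sum (λ i → ⟦ G′ i ⟧ + (⟦ does (i ≟ v) ⟧ * 1 + ⟦ G i ∧ H v i ⟧)) ≡⟨ trans (sum-+ (λ i → ⟦ G′ i ⟧) _)
        (cong (# G′ +_) (trans (sum-+ (λ i → ⟦ does (i ≟ v) ⟧ * 1) _)
        (cong (_+ # (λ i → G i ∧ H v i)) (sum-δ v (λ _ → 1))))) ⟩
    # G′ + suc (# (λ i → G i ∧ H v i)) ≤⟨ +-monoʳ-≤ (# G′) (s≤s (few v Gv)) ⟩
    # G′ + suc k ∎
    where
    open ≤-Reasoning
    pt : ∀ i → ⟦ G i ⟧ ≤ ⟦ G′ i ⟧ + (⟦ does (i ≟ v) ⟧ * 1 + ⟦ G i ∧ H v i ⟧)
    pt i with G i | does (i ≟ v) | H v i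
    ... | false | _ | _ = z≤n
    ... | true | true | _ = s≤s z≤n
    ... | true | false | true = s≤s z≤n
    ... | true | false | false = s≤s z≤n
  big′ : suc k * h ≤ # G′
  big′ = +-cancelʳ-≤ (suc k) _ _ (≤-trans (≤-reflexive (trans (+-comm _ (suc k)) (sym (*-suc (suc k) h))))
      (≤-trans big loss))
  few′ : ∀ b → G′ b ≡ true → # (λ b′ → G′ b′ ∧ H b b′) ≤ k
  few′ b g = ≤-trans (#-mono {p = λ b′ → G′ b′ ∧ H b b′} {λ b′ → G b′ ∧ H b b′} (λ i p → let l , r = ∧-true {G′ i} p in true-∧ (proj₁ (∧-true l)) r)) (few b (proj₁ (∧-true g)))

-- The sum formula is all that is required of the numbering: it transfers packing and counting
-- bounds to the selected stars.
enumerate : ∀ {m} (p : Fin m → Bool) → ∃[ k ] Σ (Fin k → Fin m) λ ι →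
  (∀ i → p (ι i) ≡ true) × (∀ (f : Fin m → ℕ) → sum (λ i → f (ι i)) ≡ sum (λ c → ⟦ p c ⟧ * f c))
enumerate {zero} p = 0 , (λ ()) , (λ ()) , (λ _ → refl)
enumerate {suc m} p with enumerate (p ∘ suc) | p zero in e
... | k , ι , all , sums | true = suc k , zero Vector.∷ (suc ∘ ι) , (λ { zero → e ; (suc i) → all i }) , λ f →
    cong₂ _+_ (sym (+-identityʳ _)) (sums (f ∘ suc))
... | k , ι , all , sums | false = k , suc ∘ ι , all , λ f → sums (f ∘ suc)

-- One window of degrees

module Packed {n m σ} (F : Rel n) (ctr : Fin m → Fin n) (S : Fin m → Fin n → Bool) (#S : ∀ c → # (S c) ≡ σ) (packing : StarPacking F ctr S) where

  star-edge : ∀ c b → S c b ≡ true → F (ctr c) b ≡ true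
  star-edge c b s = ⟦⟧>0 (≤-trans (≤-reflexive (sym (cong₂ _*_ (⟦⟧≡1 (dec-true (ctr c ≟ ctr c) refl)) (⟦⟧≡1 s))))
    (≤-trans (term≤sum (λ k → ⟦ does (ctr c ≟ ctr k) ⟧ * ⟦ S k b ⟧) c) (packing (ctr c) b)))

  stars-at-leaf : ∀ b → sum (λ c → ⟦ S c b ⟧) ≤ sum (λ a → ⟦ F a b ⟧)
  stars-at-leaf b = begin
    sum (λ c → ⟦ S c b ⟧) ≡⟨ sum-cong-≗ (λ c → sym (sum-δ (ctr c) (λ _ → ⟦ S c b ⟧))) ⟩
    sum (λ c → sum (λ a → ⟦ does (a ≟ ctr c) ⟧ * ⟦ S c b ⟧)) ≡⟨ sum-comm (λ c a → ⟦ does (a ≟ ctr c) ⟧ * ⟦ S c b ⟧) ⟩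
    sum (λ a → sum (λ c → ⟦ does (a ≟ ctr c) ⟧ * ⟦ S c b ⟧)) ≤⟨ sum-mono (λ a → packing a b) ⟩
    sum (λ a → ⟦ F a b ⟧) ∎
    where open ≤-Reasoning

  stars-at-centre : ∀ a → σ * sum (λ c → ⟦ does (a ≟ ctr c) ⟧) ≤ deg F a
  stars-at-centre a = begin
    σ * sum (λ c → ⟦ does (a ≟ ctr c) ⟧) ≡⟨ *-sum σ (λ c → ⟦ does (a ≟ ctr c) ⟧) ⟩
    sum (λ c → σ * ⟦ does (a ≟ ctr c) ⟧) ≡⟨ sum-cong-≗ (λ c → trans (*-comm σ _) (trans (cong (⟦ does
        (a ≟ ctr c) ⟧ *_) (sym (#S c))) (*-sum ⟦ does (a ≟ ctr c) ⟧ (λ b → ⟦ S c b ⟧)))) ⟩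
    sum (λ c → sum (λ b → ⟦ does (a ≟ ctr c) ⟧ * ⟦ S c b ⟧)) ≡⟨ sum-comm (λ c b → ⟦ does (a ≟ ctr c) ⟧ * ⟦ S c b ⟧) ⟩
    sum (λ b → sum (λ c → ⟦ does (a ≟ ctr c) ⟧ * ⟦ S c b ⟧)) ≤⟨ sum-mono (packing a) ⟩
    deg F a ∎
    where open ≤-Reasoning

  total-size : sum (λ b → sum (λ c → ⟦ S c b ⟧)) ≡ σ * m
  total-size = trans (sum-comm (λ b c → ⟦ S c b ⟧)) (trans (sum-cong-≗ #S) (trans (sum-const m σ) (*-comm m σ)))

-- `F` is oriented from centres to leaves, and `apart` keeps the two roles on different vertices.
-- `deg≤D` brings centre degrees under the bound for leaf degrees, from which the sampling condition
-- `siblings` follows.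
module Bipartite {n} (E : Rel n) (E-sym : Symmetric E) (F : Rel n) (F⊑E : F ⊑ E) (A : Fin n → Bool)
  (supp : ∀ a b → F a b ≡ true → A a ≡ true) (apart : ∀ a b b′ → F a b ≡ true → F b′ a ≡ true → ⊥)
  (q h : ℕ) (q≥1 : 1 ≤ q) (h≡8q : h ≡ 8 * q) (lo ρ : ℕ)
  (D-low : ∀ b → 0 < sum (λ a → ⟦ F a b ⟧) → 2 ^ lo ≤ sum (λ a → ⟦ F a b ⟧))
  (D-high : ∀ b → sum (λ a → ⟦ F a b ⟧) < 2 ^ (lo + suc ρ))
  (deg≤D : ∀ a b → 0 < sum (λ a → ⟦ F a b ⟧) → deg F a ≤ sum (λ a → ⟦ F a b ⟧)) where

  private
    D : Fin n → ℕ
    D b = sum (λ a → ⟦ F a b ⟧)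

    B : Fin n → Bool
    B b = does (1 ≤? D b)

    h>0 : 0 < h
    h>0 = subst (0 <_) (sym h≡8q) (*-mono-≤ {1} {8} (s≤s z≤n) q≥1)

    D>0 : ∀ {a b} → F a b ≡ true → 0 < D b
    D>0 {a} {b} f = ≤-trans (≤-reflexive (sym (⟦⟧≡1 f))) (term≤sum (λ a → ⟦ F a b ⟧) a)

    F-count : sum (deg F) ≡ sum D
    F-count = sum-comm (λ a b → ⟦ F a b ⟧)

    low*B : 2 ^ lo * # B ≤ sum D
    low*B = ≤-trans (≤-reflexive (*-sum (2 ^ lo) (λ b → ⟦ B b ⟧))) (sum-mono pt)
      where
      pt : ∀ b → 2 ^ lo * ⟦ B b ⟧ ≤ D b
      pt b with B b in e
      ... | true = ≤-trans (≤-reflexive (*-identityʳ _)) (D-low b (does-true (1 ≤? D b) e))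
      ... | false = ≤-trans (≤-reflexive (*-zeroʳ (2 ^ lo))) z≤n

    deg-F≤ : ∀ a → deg F a ≤ 2 ^ (lo + suc ρ)
    deg-F≤ a with deg F a in e
    ... | zero = z≤n
    ... | suc d = let b , pos = sum>0 (λ b → ⟦ F a b ⟧) (subst (0 <_) (sym e) z<s) in
      subst (_≤ 2 ^ (lo + suc ρ)) e (≤-trans (deg≤D a b (D>0 {a} (⟦⟧>0 pos))) (<⇒≤ (D-high b)))

    B-from : ∀ {a b} → F a b ≡ true → B b ≡ true
    B-from {a} {b} f = dec-true (1 ≤? D b) (D>0 {a} f)

    -- The packing misses at most `σ * # A` edges, less than a fifth of all.
    packed-edges : ∀ σ m → 5 * (σ * # A) < sum (deg F) → sum (deg F) ≤ σ * m + σ * # A → 4 * sum D ≤ 5 * (σ * m)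
    packed-edges σ m big count = arith {σ * # A} {σ * m} (subst (5 * (σ * # A) <_) F-count big)
        (subst (_≤ σ * m + σ * # A) F-count count)
      where
      arith : ∀ {x y s} → 5 * x < s → s ≤ y + x → 4 * s ≤ 5 * y
      arith {x} {y} {s} h₁ h₂ = ≤-from 1 (+-mono-≤ h₁ (*-monoʳ-≤ 5 h₂)) (ring x y s)
        where
        ring : ∀ x y s → 4 * s + (s + 5 * (y + x)) + 1 ≡ 5 * y + (suc (5 * x) + 5 * s)
        ring = solve-∀

    stars-exist : ∀ σ m → 5 * (σ * # A) < sum (deg F) → sum (deg F) ≤ σ * m + σ * # A → 1 ≤ m
    stars-exist σ zero big count = contradiction (<-≤-trans big (≤-trans count (≤-trans (≤-reflexive
        (cong (_+ σ * # A) (*-zeroʳ σ))) (m≤m+n _ _)))) (<-irrefl refl)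
    stars-exist σ (suc m) big count = s≤s z≤n

  -- Leaf degrees agree up to a factor 2, so every leaf is kept with certainty: `y = T` on leaves
  -- and `R = 1`. Repeated meetings then cause no correlation, and only the private coins of the
  -- stars are random.
  dyadic-window : ρ ≡ 0 → 5 * (h * # A) < sum (deg F) → AlmostRegularSubgraph q E
  dyadic-window ρ≡0 big with star-packing h h>0 (sum (deg F)) F ≤-refl A supp
  ... | m , ctr , S , #S , packing , count =
    Sampling.almostRegular E E-sym q h q≥1 h≡8q ctr S #S
      (λ a b → ≤-trans (packing a b) (⟦⟧-mono (F⊑E a b)))
      (λ c c′ s → let b , pos = sum>0 (λ b → ⟦ S c′ b ⟧) (subst (0 <_) (sym (#S c′)) h>0) in
        apart (ctr c′) b (ctr c) (star-edge c′ b (⟦⟧>0 pos)) (star-edge c (ctr c′) s))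
      T 1 y (stars-exist h m big count) ≤-refl
      (λ b → ⟦⟧*≤ (B b) T)
      (λ c b s → ≤-reflexive (sym (trans (+-identityʳ _) (trans (cong (_* T) (⟦⟧≡1 (B-from (star-edge c b s))))
          (*-identityˡ T)))))
      d≤y
      (≤-trans (≤-reflexive (trans (cong (h *_) (^-zeroˡ h)) (*-identityʳ h))) h≤T)
      (λ a → ≤-trans (stars-at-centre a) (deg-F≤ a))
      (λ c b s → ≤-trans (≤-reflexive (trans (cong (sum (λ c′ → ⟦ S c′ b ∧ (also-meets S c b c′ ∧ not
          (does (c′ ≟ c))) ⟧) *_) (^-zeroˡ h)) (*-identityʳ _)))
        (≤-trans (sum-mono (λ c′ → ⟦⟧-mono {S c′ b ∧ _} {S c′ b} (proj₁ ∘ ∧-true)))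
        (≤-trans (d≤y b) (⟦⟧*≤ (B b) T))))
      (arith (packed-edges h m big count))
    where
    open Packed F ctr S #S packing
    T : ℕ
    T = 2 ^ (lo + suc ρ)
    y : Fin n → ℕ
    y b = ⟦ B b ⟧ * T
    d≤y : ∀ b → sum (λ c → ⟦ S c b ⟧) ≤ y b
    d≤y b with B b in e
    ... | true = ≤-trans (stars-at-leaf b) (≤-trans (<⇒≤ (D-high b)) (≤-reflexive (sym (*-identityˡ T))))
    ... | false = ≤-trans (stars-at-leaf b) (s≤s⁻¹ (≰⇒> (does-false (1 ≤? D b) e)))
    h≤T : h ≤ T
    h≤T = let c = fromℕ< (stars-exist h m big count) in
      ≤-trans (≤-reflexive (sym (#S c))) (≤-trans (#-mono {p = S c} {F (ctr c)} (star-edge c)) (deg-F≤ (ctr c)))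
    arith : 4 * sum D ≤ 5 * (h * m) → 2 * sum y ≤ 5 * (h * m)
    arith bound = begin
      2 * sum y ≡⟨ cong (2 *_) (sym (sum-* T (λ b → ⟦ B b ⟧))) ⟩
      2 * (# B * T) ≡⟨ cong (λ t → 2 * (# B * t)) (trans (cong (λ r → 2 ^ (lo + suc r)) ρ≡0) (cong (2 ^_)
          (+-comm lo 1))) ⟩
      2 * (# B * (2 * 2 ^ lo)) ≡⟨ ring (# B) (2 ^ lo) ⟩
      4 * (2 ^ lo * # B) ≤⟨ *-monoʳ-≤ 4 low*B ⟩
      4 * sum D ≤⟨ bound ⟩
      5 * (h * m) ∎
      where
      open ≤-Reasoning
      ring : ∀ b t → 2 * (b * (2 * t)) ≡ 4 * (t * b)
      ring = solve-∀

  module _ (k L : ℕ) (k≥1 : 1 ≤ k) (k≤ : k ≤ 2 ^ L) (h≤ : h ≤ 2 ^ (L + 3))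
    (expo : 3 + (L + ((L + 3 + (ρ + L + 4) * h) + (1 + L + (L + 3))) * k) ≤ lo)
    (free : ∀ C J → # C ≡ k → # J ≡ k → (∀ a b → C a ≡ true → J b ≡ true → F a b ≡ true) → ⊥) where

    private
      -- `T` is twice the upper end of the window, leaving room for the summand `M′` in `y`. `M′` is
      -- `2 ^ lo / (4 * 2 ^ L)` and `R` is `T / M′`. `Γ` dominates `h * R ^ h`, and `e₀ = T / Γ` is
      -- the codegree that the sampling condition tolerates. In `s`, the factor 2 allows for bad
      -- leaves and `k` for the passage to an independent set.
      η ϱ τ s Γ e₀ T R M′ : ℕ
      η = L + 3
      ϱ = ρ + L + 4
      τ = lo + ρ + 2
      s = 2 * k * h
      Γ = 2 ^ (η + ϱ * h)
      e₀ = 2 ^ (τ ∸ (η + ϱ * h))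
      T = 2 ^ τ
      R = 2 ^ ϱ
      M′ = 2 ^ (lo ∸ (L + 2))

      s>0 : 1 ≤ s
      s>0 = *-mono-≤ (*-mono-≤ {1} {2} (s≤s z≤n) k≥1) h>0

      hRʰ≤Γ : h * R ^ h ≤ Γ
      hRʰ≤Γ = begin
        h * R ^ h ≤⟨ *-monoˡ-≤ (R ^ h) h≤ ⟩
        2 ^ η * R ^ h ≡⟨ cong (2 ^ η *_) (^-*-assoc 2 ϱ h) ⟩
        2 ^ η * 2 ^ (ϱ * h) ≡⟨ sym (^-distribˡ-+-* 2 η (ϱ * h)) ⟩
        Γ ∎
        where open ≤-Reasoning

      Γ-exponent : η + ϱ * h ≤ lo
      Γ-exponent = ≤-trans (≤-trans (≤-trans (m≤m+n _ (1 + L + (L + 3)))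
          (≤-trans (≤-reflexive (sym (*-identityʳ _))) (*-monoʳ-≤ (η + ϱ * h + (1 + L + (L + 3))) k≥1)))
          (≤-trans (m≤n+m _ L) (m≤n+m _ 3))) expo

      T≡ : e₀ * Γ ≡ T
      T≡ = trans (sym (^-distribˡ-+-* 2 (τ ∸ (η + ϱ * h)) (η + ϱ * h)))
          (cong (2 ^_) (m∸n+n≡m (≤-trans Γ-exponent (≤-trans (m≤m+n lo ρ) (m≤m+n _ 2)))))

      half-T : 2 ^ (lo + suc ρ) ≤ T
      half-T = ^-monoʳ-≤ 2 (≤-trans (≤-reflexive (trans (+-suc lo ρ) (+-comm 1 (lo + ρ))))
          (+-monoʳ-≤ (lo + ρ) (s≤s z≤n)))

      L+2≤lo : L + 2 ≤ lo
      L+2≤lo = ≤-trans (≤-trans (+-monoʳ-≤ L (s≤s (s≤s (z≤n {1})))) (m≤m+n η _)) Γ-exponent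

      RM′≡T : R * M′ ≡ T
      RM′≡T = trans (sym (^-distribˡ-+-* 2 ϱ (lo ∸ (L + 2)))) (cong (2 ^_) (trans (ring ρ L (lo ∸ (L + 2)))
          (cong (λ x → x + ρ + 2) (m+[n∸m]≡n L+2≤lo))))
        where
        ring : ∀ r l x → r + l + 4 + x ≡ (l + 2 + x) + r + 2
        ring = solve-∀

      M′-scale : 4 * (2 ^ L * M′) ≡ 2 ^ lo
      M′-scale = trans (ring (2 ^ L) M′) (trans (cong (_* M′) (sym (^-distribˡ-+-* 2 L 2)))
          (trans (sym (^-distribˡ-+-* 2 (L + 2) (lo ∸ (L + 2)))) (cong (2 ^_) (m+[n∸m]≡n L+2≤lo))))
        where
        ring : ∀ x y → 4 * (x * y) ≡ x * 4 * y
        ring = solve-∀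

      -- The hypothesis `expo` is the binary logarithm of this bound, with 5 rounded up to 8, `k` to
      -- `2 ^ L` and `h` to `2 ^ η`.
      bad-bound : 5 * (k * (Γ * s) ^ k) ≤ 2 ^ lo
      bad-bound = begin
        5 * (k * (Γ * s) ^ k) ≤⟨ *-mono-≤ {5} {2 ^ 3} (s≤s (s≤s (s≤s (s≤s (s≤s z≤n)))))
            (*-mono-≤ k≤ (^-monoˡ-≤ k (*-monoʳ-≤ Γ s≤))) ⟩
        2 ^ 3 * (2 ^ L * (Γ * 2 ^ (1 + L + η)) ^ k) ≡⟨ cong (λ x → 2 ^ 3 * (2 ^ L * x ^ k))
            (sym (^-distribˡ-+-* 2 (η + ϱ * h) (1 + L + η))) ⟩
        2 ^ 3 * (2 ^ L * (2 ^ (η + ϱ * h + (1 + L + η))) ^ k) ≡⟨ cong (λ x → 2 ^ 3 * (2 ^ L * x))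
            (^-*-assoc 2 (η + ϱ * h + (1 + L + η)) k) ⟩
        2 ^ 3 * (2 ^ L * 2 ^ ((η + ϱ * h + (1 + L + η)) * k)) ≡⟨ cong (2 ^ 3 *_) (sym (^-distribˡ-+-* 2 L _)) ⟩
        2 ^ 3 * 2 ^ (L + (η + ϱ * h + (1 + L + η)) * k) ≡⟨ sym
            (^-distribˡ-+-* 2 3 (L + (η + ϱ * h + (1 + L + η)) * k)) ⟩
        2 ^ (3 + (L + (η + ϱ * h + (1 + L + η)) * k)) ≤⟨ ^-monoʳ-≤ 2 expo ⟩
        2 ^ lo ∎
        where
        open ≤-Reasoning
        s≤ : s ≤ 2 ^ (1 + L + η)
        s≤ = ≤-trans (*-mono-≤ (*-monoʳ-≤ 2 k≤) h≤) (≤-reflexive (sym (^-distribˡ-+-* 2 (1 + L) η)))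

    power-window : 5 * (s * # A) < sum (deg F) → AlmostRegularSubgraph q E
    power-window big with star-packing s s>0 (sum (deg F)) F ≤-refl A supp
    ... | m , ctr , S , #S , packing , count = result
      where
      module Original = Packed F ctr S #S packing

      codeg : Fin n → Fin n → ℕ
      codeg b b′ = sum (λ c → ⟦ S c b ⟧ * ⟦ S c b′ ⟧)

      heavy : Rel n
      heavy b b′ = does (e₀ <? codeg b b′) ∧ not (does (b′ ≟ b))

      heavy-sym : Symmetric heavy
      heavy-sym b b′ p = let p₁ , p₂ = ∧-true {does (e₀ <? codeg b b′)} p in
        true-∧ (dec-true (e₀ <? codeg b′ b) (subst (e₀ <_) (sum-cong-≗ (λ c → *-comm ⟦ S c b ⟧ ⟦ S c b′ ⟧))
            (does-true (e₀ <? codeg b b′) p₁)))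
          (true-not (b ≟ b′) (λ e → not-true (b′ ≟ b) p₂ (sym e)))

      -- At most `T = e₀ * Γ` stars contain `b`; together they have at most `T * s` leaf incidences,
      -- and a heavy partner takes more than `e₀` of these.
      few-heavy : ∀ b → # (heavy b) ≤ Γ * s
      few-heavy b = *-cancelʳ-≤ _ _ e₀ {{m^n≢0 2 (τ ∸ (η + ϱ * h))}} (begin
        # (heavy b) * e₀ ≡⟨ sum-* e₀ (λ b′ → ⟦ heavy b b′ ⟧) ⟩
        sum (λ b′ → ⟦ heavy b b′ ⟧ * e₀) ≤⟨ sum-mono pt ⟩
        sum (codeg b) ≡⟨ trans (sum-comm (λ b′ c → ⟦ S c b ⟧ * ⟦ S c b′ ⟧))
            (sum-cong-≗ (λ c → trans (sym (*-sum ⟦ S c b ⟧ (λ b′ → ⟦ S c b′ ⟧))) (cong (⟦ S c b ⟧ *_) (#S c)))) ⟩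
        sum (λ c → ⟦ S c b ⟧ * s) ≡⟨ sym (sum-* s (λ c → ⟦ S c b ⟧)) ⟩
        sum (λ c → ⟦ S c b ⟧) * s ≤⟨ *-monoˡ-≤ s (≤-trans (Original.stars-at-leaf b) (≤-trans (<⇒≤
            (D-high b)) half-T)) ⟩
        T * s ≡⟨ cong (_* s) (sym T≡) ⟩
        e₀ * Γ * s ≡⟨ ring e₀ Γ s ⟩
        Γ * s * e₀ ∎)
        where
        open ≤-Reasoning
        ring : ∀ e g s → e * g * s ≡ g * s * e
        ring = solve-∀
        pt : ∀ b′ → ⟦ heavy b b′ ⟧ * e₀ ≤ codeg b b′
        pt b′ with heavy b b′ in e
        ... | true = ≤-trans (≤-reflexive (*-identityˡ e₀)) (<⇒≤ (does-true (e₀ <? codeg b b′) (proj₁ (∧-true e))))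
        ... | false = z≤n

      bad : Fin m → Fin n → Bool
      bad c b = S c b ∧ does (k ≤? # (λ b′ → S c b′ ∧ heavy b b′))

      -- More than k (Γ s) ^ k stars that are bad at b would give k of them sharing k heavy partners of b.
      few-bad : ∀ b → # (λ c → bad c b) ≤ k * (Γ * s) ^ k
      few-bad b = ≮⇒≥ λ many → contra (common-leaves S k (Γ * s) k (λ c → bad c b) (heavy b) (few-heavy b)
          (λ c p → does-true (k ≤? _) (proj₂ (∧-true {S c b} p))) many)
        where
        contra : ¬ (∃[ J ] Σ (Fin m → Bool) λ Q′ → (∀ b′ → J b′ ≡ true → heavy b b′ ≡ true) × # J ≡ k ×
            (∀ c → Q′ c ≡ true → bad c b ≡ true) × k < # Q′ ×
          (∀ c b′ → Q′ c ≡ true → J b′ ≡ true → S c b′ ≡ true))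
        contra (J , Q′ , J⊆ , #J , Q′⊆ , many , all) =
          let C , C⊆ , #C = subset-of-size C₀ k (≤-trans (<⇒≤ many) Q′≤C₀) in
          free C J #C #J λ a b′ Ca Jb′ → edge a b′ (C⊆ a Ca) Jb′
          where
          ψ : Fin n → ℕ
          ψ a = sum (λ c → ⟦ does (a ≟ ctr c) ⟧ * ⟦ Q′ c ⟧)
          C₀ : Fin n → Bool
          C₀ a = does (1 ≤? ψ a)
          ψ≤1 : ∀ a → ψ a ≤ 1
          ψ≤1 a = ≤-trans (sum-mono (λ c → *-monoʳ-≤ ⟦ does (a ≟ ctr c) ⟧
              (⟦⟧-mono (λ q → proj₁ (∧-true (Q′⊆ c q)))))) (≤-trans (packing a b) (⟦⟧≤1 (F a b)))
          ψ≤C₀ : ∀ a → ψ a ≤ ⟦ C₀ a ⟧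
          ψ≤C₀ a = case 1 ≤? ψ a of λ where
            (yes p) → ≤-trans (ψ≤1 a) (≤-reflexive (sym (⟦⟧≡1 (dec-true (1 ≤? ψ a) p))))
            (no p) → ≤-trans (s≤s⁻¹ (≰⇒> p)) z≤n
          Q′≤C₀ : # Q′ ≤ # C₀
          Q′≤C₀ = ≤-trans (≤-reflexive (trans (sum-cong-≗ (λ c → sym (sum-δ (ctr c) (λ _ → ⟦ Q′ c ⟧))))
              (sum-comm (λ c a → ⟦ does (a ≟ ctr c) ⟧ * ⟦ Q′ c ⟧)))) (sum-mono ψ≤C₀)
          edge : ∀ a b′ → C₀ a ≡ true → J b′ ≡ true → F a b′ ≡ true
          edge a b′ Ca Jb′ = let c , pos = sum>0 (λ c → ⟦ does (a ≟ ctr c) ⟧ * ⟦ Q′ c ⟧) (does-true (1 ≤? ψ a) Ca)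
                                 is-ctr = does-true (a ≟ ctr c) (⟦⟧>0
                                     (*-pos⇒posʳ ⟦ Q′ c ⟧ _ (subst (0 <_)
                                     (*-comm ⟦ does (a ≟ ctr c) ⟧ ⟦ Q′ c ⟧) pos)))
                                 in-Q′ = ⟦⟧>0 (*-pos⇒posʳ ⟦ does (a ≟ ctr c) ⟧ ⟦ Q′ c ⟧ pos)
                             in subst (λ z → F z b′ ≡ true) (sym is-ctr)
                                 (Original.star-edge c b′ (all c b′ in-Q′ Jb′))

      #bad : Fin m → ℕ
      #bad c = # (bad c)

      -- By `bad-bound` the bad incidences at a leaf are at most a fifth of the least leaf degree.
      -- As four fifths of the edges are packed, they make up at most a quarter of the packed edges.
      total-bad : 4 * sum #bad ≤ s * m
      total-bad = *-cancelˡ-≤ 5 (begin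
        5 * (4 * sum #bad) ≡⟨ cong (λ z → 5 * (4 * z)) (sum-comm (λ c b → ⟦ bad c b ⟧)) ⟩
        5 * (4 * sum (λ b → # (λ c → bad c b))) ≤⟨ *-monoʳ-≤ 5 (*-monoʳ-≤ 4 (sum-mono pt)) ⟩
        5 * (4 * sum (λ b → ⟦ B b ⟧ * (k * (Γ * s) ^ k))) ≡⟨ cong (λ z → 5 * (4 * z))
            (sym (sum-* (k * (Γ * s) ^ k) (λ b → ⟦ B b ⟧))) ⟩
        5 * (4 * (# B * (k * (Γ * s) ^ k))) ≡⟨ ring (# B) (k * (Γ * s) ^ k) ⟩
        4 * (5 * (k * (Γ * s) ^ k) * # B) ≤⟨ *-monoʳ-≤ 4 (*-monoˡ-≤ (# B) bad-bound) ⟩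
        4 * (2 ^ lo * # B) ≤⟨ *-monoʳ-≤ 4 low*B ⟩
        4 * sum D ≤⟨ packed-edges s m big count ⟩
        5 * (s * m) ∎)
        where
        open ≤-Reasoning
        ring : ∀ b x → 5 * (4 * (b * x)) ≡ 4 * (5 * x * b)
        ring = solve-∀
        pt : ∀ b → # (λ c → bad c b) ≤ ⟦ B b ⟧ * (k * (Γ * s) ^ k)
        pt b with B b in e
        ... | true = ≤-trans (few-bad b) (≤-reflexive (sym (*-identityˡ _)))
        ... | false = ≤-trans (sum-mono (λ c → ⟦⟧-mono {bad c b} {S c b} (proj₁ ∘ ∧-true)))
            (≤-trans (Original.stars-at-leaf b) (s≤s⁻¹ (≰⇒> (does-false (1 ≤? D b) e))))

      good : Fin m → Bool
      good c = does (2 * #bad c ≤? s)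

      -- Markov: a star that is not good has more than `s / 2` bad leaves, while the average is at
      -- most `s / 4`.
      half-good : m ≤ 2 * # good
      half-good = *-cancelˡ-≤ s {{>-nonZero s>0}}
          (subst (s * m ≤_) (ring₀ s (# good)) (arith {s * m} {s * # good} {sum #bad} (begin
        s * m ≡⟨ trans (*-comm s m) (sym (sum-const m s)) ⟩
        sum {m} (λ _ → s) ≤⟨ sum-mono pt ⟩
        sum (λ c → s * ⟦ good c ⟧ + 2 * #bad c) ≡⟨ trans (sum-+ (λ c → s * ⟦ good c ⟧) _)
            (cong₂ _+_ (sym (*-sum s (λ c → ⟦ good c ⟧))) (sym (*-sum 2 #bad))) ⟩
        s * # good + 2 * sum #bad ∎) total-bad))
        where
        open ≤-Reasoning
        pt : ∀ c → s ≤ s * ⟦ good c ⟧ + 2 * #bad c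
        pt c with good c in e
        ... | true = ≤-trans (≤-reflexive (sym (*-identityʳ s))) (m≤m+n _ _)
        ... | false = ≤-trans (<⇒≤ (≰⇒> (does-false (2 * #bad c ≤? s) e))) (m≤n+m (2 * #bad c) (s * 0))
        ring₀ : ∀ s g → 2 * (s * g) ≡ s * (2 * g)
        ring₀ = solve-∀
        arith : ∀ {sm sg b} → sm ≤ sg + 2 * b → 4 * b ≤ sm → sm ≤ 2 * sg
        arith {sm} {sg} {b} h₁ h₂ = ≤-from 0 (+-mono-≤ h₁ (+-mono-≤ h₁ h₂)) (ring sm sg b)
          where
          ring : ∀ sm sg b → sm + (sg + 2 * b + (sg + 2 * b + sm)) + 0 ≡ 2 * sg + (sm + (sm + 4 * b))
          ring = solve-∀

      IndependentStar : Fin m → Set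
      IndependentStar c = ∃[ I ] (∀ b → I b ≡ true → S c b ∧ not (bad c b) ≡ true) × # I ≡ h ×
        (∀ b b′ → I b ≡ true → I b′ ≡ true → b ≢ b′ → heavy b b′ ≡ true → ⊥)

      -- At least half of the `2 * k * h` leaves are not bad, and each of those has at most `k - 1`
      -- heavy partners in the star, so the greedy choice reaches `h`.
      independent-star : ∀ c → good c ≡ true → IndependentStar c
      independent-star c c-good = independent heavy heavy-sym (pred k) h G
          (subst (λ z → z * h ≤ # G) (sym k≡) size) few
        where
        k≡ : suc (pred k) ≡ k
        k≡ = suc-pred k {{>-nonZero k≥1}}
        G : Fin n → Bool
        G b = S c b ∧ not (bad c b)
        size : k * h ≤ # G
        size = *-cancelˡ-≤ 2 (arith {# G} {#bad c} (begin
          2 * k * h ≡⟨ sym (#S c) ⟩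
          # (S c) ≤⟨ sum-mono (λ b → split (S c b) (bad c b)) ⟩
          sum (λ b → ⟦ G b ⟧ + ⟦ bad c b ⟧) ≡⟨ sum-+ (λ b → ⟦ G b ⟧) _ ⟩
          # G + #bad c ∎) (does-true (2 * #bad c ≤? s) c-good))
          where
          open ≤-Reasoning
          split : ∀ x y → ⟦ x ⟧ ≤ ⟦ x ∧ not y ⟧ + ⟦ y ⟧
          split true true = s≤s z≤n
          split true false = s≤s z≤n
          split false y = z≤n
          arith : ∀ {g b} → 2 * k * h ≤ g + b → 2 * b ≤ 2 * k * h → 2 * (k * h) ≤ 2 * g
          arith {g} {b} h₁ h₂ = ≤-from 0 (+-mono-≤ h₁ (+-mono-≤ h₁ h₂)) (ring k h g b)
            where
            ring : ∀ k h g b → 2 * (k * h) + (g + b + (g + b + 2 * k * h)) + 0 ≡ 2 * g +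
                (2 * k * h + (2 * k * h + 2 * b))
            ring = solve-∀
        few : ∀ b → G b ≡ true → # (λ b′ → G b′ ∧ heavy b b′) ≤ pred k
        few b g = s≤s⁻¹ (subst (suc (# (λ b′ → G b′ ∧ heavy b b′)) ≤_) (sym k≡) (≤-<-trans
          (#-mono {p = λ b′ → G b′ ∧ heavy b b′} {λ b′ → S c b′ ∧ heavy b b′} (λ i p → let l , r = ∧-true {G i} p in true-∧ (proj₁ (∧-true {S c i} l)) r))
          (≰⇒> (λ le → let s , nb = ∧-true {S c b} g in
            contradiction (trans (sym nb) (cong not
                (true-∧ s (dec-true (k ≤? # (λ b′ → S c b′ ∧ heavy b b′)) le)))) λ ()))))

      result : AlmostRegularSubgraph q E
      result with enumerate good
      ... | m₁ , ι , ι-good , sums =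
        Sampling.almostRegular E E-sym q h q≥1 h≡8q (λ c → ctr (ι c)) S₁ #S₁
          (λ a b → ≤-trans (packing₁ a b) (⟦⟧-mono (F⊑E a b)))
          (λ c c′ e → let b , pos = sum>0 (λ b → ⟦ S₁ c′ b ⟧) (subst (0 <_) (sym (#S₁ c′)) h>0) in
            apart (ctr (ι c′)) b (ctr (ι c)) (New.star-edge c′ b (⟦⟧>0 pos)) (New.star-edge c (ctr (ι c′)) e))
          T R y m₁≥1 (m^n>0 2 ϱ) y≤T T≤Ry (λ b → m≤m+n _ _)
          (≤-trans hRʰ≤Γ (≤-trans (m≤n*m Γ e₀ {{m^n≢0 2 (τ ∸ (η + ϱ * h))}}) (≤-reflexive T≡)))
          (λ a → ≤-trans (New.stars-at-centre a) (≤-trans (deg-F≤ a) half-T))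
          (λ c b e → ≤-trans (*-monoˡ-≤ (R ^ h) (few-meeting c b e)) (begin
            h * e₀ * R ^ h ≡⟨ ring₁ h e₀ (R ^ h) ⟩
            e₀ * (h * R ^ h) ≤⟨ *-monoʳ-≤ e₀ hRʰ≤Γ ⟩
            e₀ * Γ ≡⟨ T≡ ⟩
            T ∎))
          ∑y
        where
        open ≤-Reasoning
        ring₁ : ∀ h e r → h * e * r ≡ e * (h * r)
        ring₁ = solve-∀
        star : ∀ c → IndependentStar (ι c)
        star c = independent-star (ι c) (ι-good c)
        S₁ : Fin m₁ → Fin n → Bool
        S₁ c = proj₁ (star c)
        S₁⊆S : ∀ c b → S₁ c b ≡ true → S (ι c) b ≡ true
        S₁⊆S c b e = proj₁ (∧-true (proj₁ (proj₂ (star c)) b e))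
        #S₁ : ∀ c → # (S₁ c) ≡ h
        #S₁ c = proj₁ (proj₂ (proj₂ (star c)))
        from-S : ∀ (f : Fin m → ℕ) → sum (λ c → f (ι c)) ≤ sum f
        from-S f = ≤-trans (≤-reflexive (sums f)) (sum-mono (λ c → ⟦⟧*≤ (good c) (f c)))
        packing₁ : StarPacking F (λ c → ctr (ι c)) S₁
        packing₁ a b = ≤-trans (sum-mono (λ c → *-monoʳ-≤ ⟦ does (a ≟ ctr (ι c)) ⟧ (⟦⟧-mono (S₁⊆S c b))))
          (≤-trans (from-S (λ c → ⟦ does (a ≟ ctr c) ⟧ * ⟦ S c b ⟧)) (packing a b))
        module New = Packed F (λ c → ctr (ι c)) S₁ #S₁ packing₁
        m₁≡ : m₁ ≡ # good
        m₁≡ = trans (sym (*-identityʳ m₁)) (trans (sym (sum-const m₁ 1)) (trans (sums (λ _ → 1))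
            (sum-cong-≗ (λ c → *-identityʳ ⟦ good c ⟧))))
        m≤2m₁ : m ≤ 2 * m₁
        m≤2m₁ = subst (λ z → m ≤ 2 * z) (sym m₁≡) half-good
        m₁≥1 : 1 ≤ m₁
        m₁≥1 = *-pos⇒posʳ 2 m₁ (≤-trans (stars-exist s m big count) m≤2m₁)
        -- The summand M′ keeps T / y b at most R, also at leaves that have lost most of their stars.
        y : Fin n → ℕ
        y b = sum (λ c → ⟦ S₁ c b ⟧) + ⟦ B b ⟧ * M′
        y≤T : ∀ b → y b ≤ T
        y≤T b = begin
          y b ≤⟨ +-mono-≤ (≤-trans (New.stars-at-leaf b) (<⇒≤ (D-high b)))
              (≤-trans (⟦⟧*≤ (B b) M′) (^-monoʳ-≤ 2 (≤-trans (m∸n≤m lo (L + 2)) (m≤m+n lo (suc ρ))))) ⟩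
          2 ^ (lo + suc ρ) + 2 ^ (lo + suc ρ) ≡⟨ cong (2 ^ (lo + suc ρ) +_) (sym (+-identityʳ _)) ⟩
          2 ^ suc (lo + suc ρ) ≡⟨ cong (2 ^_) (ring lo ρ) ⟩
          T ∎
          where
          ring : ∀ l r → suc (l + suc r) ≡ l + r + 2
          ring = solve-∀
        T≤Ry : ∀ c b → S₁ c b ≡ true → T ≤ R * y b
        T≤Ry c b e = begin
          T ≡⟨ sym RM′≡T ⟩
          R * M′ ≡⟨ cong (R *_) (trans (sym (*-identityˡ M′))
              (cong (_* M′) (sym (⟦⟧≡1 (B-from (New.star-edge c b e)))))) ⟩
          R * (⟦ B b ⟧ * M′) ≤⟨ *-monoʳ-≤ R (m≤n+m _ _) ⟩
          R * y b ∎
        -- A star meeting `c` at `b` and at another leaf contains both. The leaves of `c` are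
        -- pairwise not heavy, so each of the `h` choices of the second leaf accounts for at most
        -- `e₀` stars.
        few-meeting : ∀ c b → S₁ c b ≡ true → sum (λ c′ → ⟦ S₁ c′ b ∧ (also-meets S₁ c b c′ ∧ not
            (does (c′ ≟ c))) ⟧) ≤ h * e₀
        few-meeting c b e = begin
          sum (λ c′ → ⟦ S₁ c′ b ∧ (also-meets S₁ c b c′ ∧ not (does (c′ ≟ c))) ⟧) ≤⟨ sum-mono pt ⟩
          sum (λ c′ → sum (λ b′ → term c′ b′)) ≡⟨ sum-comm term ⟩
          sum (λ b′ → sum (λ c′ → term c′ b′)) ≤⟨ sum-mono pt₂ ⟩
          sum (λ b′ → ⟦ S₁ c b′ ⟧ * e₀) ≡⟨ sym (sum-* e₀ (λ b′ → ⟦ S₁ c b′ ⟧)) ⟩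
          # (S₁ c) * e₀ ≡⟨ cong (_* e₀) (#S₁ c) ⟩
          h * e₀ ∎
          where
          term : Fin m₁ → Fin n → ℕ
          term c′ b′ = ⟦ S₁ c b′ ∧ not (does (b′ ≟ b)) ⟧ * (⟦ S₁ c′ b ⟧ * ⟦ S₁ c′ b′ ⟧)
          pt : ∀ c′ → ⟦ S₁ c′ b ∧ (also-meets S₁ c b c′ ∧ not (does (c′ ≟ c))) ⟧ ≤ sum (term c′)
          pt c′ = ⟦⟧≤ (S₁ c′ b ∧ (also-meets S₁ c b c′ ∧ not (does (c′ ≟ c)))) λ p →
            let p₁ , p₂ = ∧-true {S₁ c′ b} p
                b′ , b′≢b , u , v = does-true (any? (λ b′ → ¬? (b′ ≟ b) ×-dec ((S₁ c b′ 𝔹.≟ true) ×-dec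
                    (S₁ c′ b′ 𝔹.≟ true)))) (proj₁ (∧-true {also-meets S₁ c b c′} p₂))
            in ≤-trans (≤-reflexive (sym (cong₂ _*_ (⟦⟧≡1 (true-∧ u (true-not (b′ ≟ b) b′≢b)))
                (cong₂ _*_ (⟦⟧≡1 p₁) (⟦⟧≡1 v))))) (term≤sum (term c′) b′)
          pt₂ : ∀ b′ → sum (λ c′ → term c′ b′) ≤ ⟦ S₁ c b′ ⟧ * e₀
          pt₂ b′ = ≤-trans (≤-reflexive (sym (*-sum ⟦ S₁ c b′ ∧ not (does (b′ ≟ b)) ⟧ (λ c′ →
              ⟦ S₁ c′ b ⟧ * ⟦ S₁ c′ b′ ⟧))))
            (≤-trans (⟦⟧*-≤ (S₁ c b′ ∧ not (does (b′ ≟ b))) (λ p → let u , v = ∧-true {S₁ c b′} p in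
              ≤-trans (sum-mono (λ c′ → *-mono-≤ (⟦⟧-mono (S₁⊆S c′ b)) (⟦⟧-mono (S₁⊆S c′ b′))))
              (≤-trans (from-S (λ c′ → ⟦ S c′ b ⟧ * ⟦ S c′ b′ ⟧))
              (≮⇒≥ λ lt → proj₂ (proj₂ (proj₂ (star c))) b b′ e u (λ b≡b′ → not-true (b′ ≟ b) v (sym b≡b′))
                  (true-∧ (dec-true (e₀ <? codeg b b′) lt) v)))))
            (*-monoˡ-≤ e₀ (⟦⟧-mono {S₁ c b′ ∧ not (does (b′ ≟ b))} {S₁ c b′} (proj₁ ∘ ∧-true))))
        -- The stars contribute `h * m₁`. The summands `M′` add at most 5/4 of that: the divisor
        -- `4 * 2 ^ L` in `M′` makes up for stars shrinking from `2 * k * h` to `h` leaves and for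
        -- up to half of them being dropped.
        ∑y : 2 * sum y ≤ 5 * (h * m₁)
        ∑y = ≤-trans (≤-reflexive (cong (2 *_) (trans (sum-+ (λ b → sum (λ c → ⟦ S₁ c b ⟧)) _)
            (cong₂ _+_ New.total-size (sym (sum-* M′ (λ b → ⟦ B b ⟧)))))))
          (arith {# B * M′} {h * m₁} (*-cancelˡ-≤ (2 ^ L) {{m^n≢0 2 L}} (begin
            2 ^ L * (16 * (# B * M′)) ≡⟨ ring₂ (2 ^ L) (# B) M′ ⟩
            4 * (4 * (2 ^ L * M′) * # B) ≡⟨ cong (λ z → 4 * (z * # B)) M′-scale ⟩
            4 * (2 ^ lo * # B) ≤⟨ *-monoʳ-≤ 4 low*B ⟩
            4 * sum D ≤⟨ packed-edges s m big count ⟩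
            5 * (2 * k * h * m) ≤⟨ *-monoʳ-≤ 5 (*-mono-≤ (*-monoˡ-≤ h (*-monoʳ-≤ 2 k≤)) m≤2m₁) ⟩
            5 * (2 * 2 ^ L * h * (2 * m₁)) ≡⟨ ring₃ (2 ^ L) h m₁ ⟩
            2 ^ L * (20 * (h * m₁)) ∎)))
          where
          ring₂ : ∀ l b m → l * (16 * (b * m)) ≡ 4 * (4 * (l * m) * b)
          ring₂ = solve-∀
          ring₃ : ∀ l h m → 5 * (2 * l * h * (2 * m)) ≡ l * (20 * (h * m))
          ring₃ = solve-∀
          arith : ∀ {x y} → 16 * x ≤ 20 * y → 2 * (y + x) ≤ 5 * y
          arith {x} {y} h₁ = *-cancelˡ-≤ 8 (≤-from (4 * y) h₁ (ring x y))
            where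
            ring : ∀ x y → 8 * (2 * (y + x)) + 20 * y + 4 * y ≡ 8 * (5 * y) + 16 * x
            ring = solve-∀

-- Choosing the window

module _ (g : ℕ) .{{_ : NonZero g}} where

  -- The windows are [2 ^ scale t , 2 ^ scale (suc t)): dyadic while scale t < g.
  scale : ℕ → ℕ
  scale zero = 0
  scale (suc t) = scale t + suc (scale t / g)

  scale-steps : ∀ t i → scale t + i * suc (scale t / g) ≤ scale (i + t)
  scale-steps t zero = ≤-reflexive (+-identityʳ _)
  scale-steps t (suc i) = begin
    scale t + (suc (scale t / g) + i * suc (scale t / g)) ≡⟨ ring (scale t) (suc (scale t / g))
        (i * suc (scale t / g)) ⟩
    scale t + i * suc (scale t / g) + suc (scale t / g) ≤⟨ +-mono-≤ ih (s≤s (/-monoˡ-≤ g (≤-trans (m≤m+n _ _) ih))) ⟩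
    scale (i + t) + suc (scale (i + t) / g) ∎
    where
    open ≤-Reasoning
    ih = scale-steps t i
    ring : ∀ x y z → x + (y + z) ≡ x + z + y
    ring = solve-∀

  -- From exponent `x`, the next `g` steps add at least `g * suc (x / g)`, which is at least `x`. So
  -- `g` windows reach exponent `g`, and every further `g` windows double the exponent.
  scale-doubles : ∀ j → g * 2 ^ j ≤ scale (suc j * g)
  scale-doubles zero = ≤-trans (*-monoʳ-≤ g (s≤s (z≤n {0 / g}))) (scale-steps 0 g)
  scale-doubles (suc j) = begin
    g * (2 * 2 ^ j) ≡⟨ ring g (2 ^ j) ⟩
    g * 2 ^ j + g * 2 ^ j ≤⟨ +-mono-≤ ih ih ⟩
    x + x ≤⟨ +-monoʳ-≤ x (≤-trans (≤-reflexive (m≡m%n+[m/n]*n x g))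
        (≤-trans (+-monoˡ-≤ _ (<⇒≤ (m%n<n x g))) (≤-reflexive (ring₂ g (x / g))))) ⟩
    x + g * suc (x / g) ≤⟨ scale-steps (suc j * g) g ⟩
    scale (suc (suc j) * g) ∎
    where
    open ≤-Reasoning
    x = scale (suc j * g)
    ih = scale-doubles j
    ring : ∀ g x → g * (2 * x) ≡ g * x + g * x
    ring = solve-∀
    ring₂ : ∀ g x → g + x * g ≡ g * suc x
    ring₂ = solve-∀

-- For an irreflexive relation a complete pair is automatically disjoint, so this agrees with the
-- absence of K_{k,k}.
Free : ∀ {n} → ℕ → Rel n → Set
Free k E = ∀ C J → # C ≡ k → # J ≡ k → (∀ a b → C a ≡ true → J b ≡ true → E a b ≡ true) → ⊥

module Split {n} (k q L J q′ δ h g : ℕ) .{{g-nz : NonZero g}} (k≥1 : 1 ≤ k) (k≤ : k ≤ 2 ^ L) (q≥1 : 1 ≤ q)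
    (h≡8q : h ≡ 8 * q)
  (q≤q′ : q ≤ q′) (δ≡64q′ : δ ≡ 64 * q′) (g≥2 : 2 ≤ g) (h≤ : h ≤ 2 ^ (L + 3))
  (window-exponent : ∀ ρ lo → 1 ≤ ρ → ρ * g ≤ lo → 3 + (L + ((L + 3 + (ρ + L + 4) * h) + (1 + L + (L + 3))) * k) ≤ lo)
  (window-density : ∀ x d → 1 ≤ x → δ * x ≤ 2 * q′ * x + d → suc J * g * (5 * (2 * k * h * x)) < d)
  (E : Rel n) (irr : Irreflexive E) (deg≤ : ∀ v → deg E v ≤ 2 ^ (2 ^ J)) (free : Free k E)
  (sy : Symmetric E) (ne : ∃[ v ] 0 < deg E v) (md : ∀ v → deg E v ≡ 0 ⊎ δ ≤ deg E v)
  (low-end : ∀ u v → E u v ≡ true → deg E u ≤ δ ⊎ deg E v ≤ δ) where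

  private
    s : ℕ
    s = 2 * k * h
    A B : Fin n → Bool
    A v = does (deg E v ℕ.≟ δ)
    B v = does (δ <? deg E v)

    deg≥δ : ∀ {u v} → E u v ≡ true → δ ≤ deg E u
    deg≥δ {u} {v} e = case md u of λ where
      (inj₁ z) → contradiction (subst₂ _≤_ (⟦⟧≡1 e) z (term≤sum (λ w → ⟦ E u w ⟧) v)) λ ()
      (inj₂ p) → p

    A⇒ : ∀ {v} → A v ≡ true → deg E v ≡ δ
    A⇒ {v} = does-true (deg E v ℕ.≟ δ)

    B⇒ : ∀ {v} → B v ≡ true → δ < deg E v
    B⇒ {v} = does-true (δ <? deg E v)

    A-or-B : ∀ {u v} → E u v ≡ true → A u ≡ true ⊎ B u ≡ true
    A-or-B {u} {v} e = case δ <? deg E u of λ where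
      (yes p) → inj₂ (dec-true (δ <? deg E u) p)
      (no p) → inj₁ (dec-true (deg E u ℕ.≟ δ) (≤-antisym (≮⇒≥ p) (deg≥δ {u} {v} e)))

    B-neighbour : ∀ {b a} → B b ≡ true → E b a ≡ true → A a ≡ true
    B-neighbour {b} {a} Bb e = case low-end b a e of λ where
      (inj₁ p) → contradiction (B⇒ {b} Bb) (≤⇒≯ p)
      (inj₂ p) → dec-true (deg E a ℕ.≟ δ) (≤-antisym p (deg≥δ {a} {b} (sy b a e)))

    A≥1 : 1 ≤ # A
    A≥1 = let v , pos = ne ; u , pos′ = sum>0 (λ u → ⟦ E v u ⟧) pos in case A-or-B {v} {u} (⟦⟧>0 pos′) of λ where
      (inj₁ p) → ≤-trans (≤-reflexive (sym (⟦⟧≡1 p))) (term≤sum (λ v → ⟦ A v ⟧) v)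
      (inj₂ p) → ≤-trans (≤-reflexive (sym (⟦⟧≡1 (B-neighbour {v} {u} p (⟦⟧>0 pos′))))) (term≤sum (λ v → ⟦ A v ⟧) u)

    Eᴬ F : Rel n
    Eᴬ u v = A u ∧ (A v ∧ E u v)
    F a b = A a ∧ (B b ∧ E a b)

    ∧∧ : ∀ {x y z} → x ∧ (y ∧ z) ≡ true → x ≡ true × y ≡ true × z ≡ true
    ∧∧ {x} {y} {z} p = let p₁ , p₂ = ∧-true {x} {y ∧ z} p in p₁ , ∧-true {y} {z} p₂

    Eᴬ⇒ : ∀ {u v} → Eᴬ u v ≡ true → A u ≡ true × A v ≡ true × E u v ≡ true
    Eᴬ⇒ {u} {v} = ∧∧ {A u} {A v} {E u v}

    F⇒ : ∀ {a b} → F a b ≡ true → A a ≡ true × B b ≡ true × E a b ≡ true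
    F⇒ {a} {b} = ∧∧ {A a} {B b} {E a b}

    D : Fin n → ℕ
    D b = sum (λ a → ⟦ F a b ⟧)

    deg-at-A : ∀ (H : Rel n) → H ⊑ E → (∀ u v → H u v ≡ true → A u ≡ true) → ∀ v → deg H v ≤ δ
    deg-at-A H H⊑E H-A v with A v in e
    ... | true = ≤-trans (deg-mono {E = E} {H} H⊑E v) (≤-reflexive (A⇒ {v} e))
    ... | false = ≤-trans (≤-reflexive (sum-0 (λ u → empty u))) z≤n
      where
      empty : ∀ u → ⟦ H v u ⟧ ≡ 0
      empty u with H v u in f
      ... | true = contradiction (trans (sym e) (H-A v u f)) λ ()
      ... | false = refl

  inside : 2 * q′ * # A < sum (deg Eᴬ) → AlmostRegularSubgraph q′ E
  inside dense = let H , H⊑ , mdH = minDegree-subgraph q′ (# A) Eᴬ A ≤-refl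
                       (λ u v p → let a , b , e = Eᴬ⇒ {u} {v} p in true-∧ b (true-∧ a (sy u v e)))
                       (λ u v p → proj₁ (Eᴬ⇒ {u} {v} p)) dense
                 in H , ⊑-trans {E = H} {Eᴬ} {E} H⊑ Eᴬ⊑E , mdH ,
                    λ v → ≤-trans (deg-mono {E = Eᴬ} {H} H⊑ v)
                        (≤-trans (deg-at-A Eᴬ Eᴬ⊑E (λ u v p → proj₁ (Eᴬ⇒ {u} {v} p)) v) (≤-reflexive δ≡64q′))
    where
    Eᴬ⊑E : Eᴬ ⊑ E
    Eᴬ⊑E u v p = proj₂ (proj₂ (Eᴬ⇒ {u} {v} p))

  across : sum (deg Eᴬ) ≤ 2 * q′ * # A → AlmostRegularSubgraph q E
  across sparse with window (λ t → 2 ^ scale g t) D D (5 * (s * # A))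
                       (λ b → case 1 ≤? D b of λ { (yes p) → inj₁ p ; (no p) → inj₂ (n≤0⇒n≡0 (s≤s⁻¹ (≰⇒> p))) })
                       (suc J * g) many
    where
    -- After `suc J * g` windows the exponent is at least `g * 2 ^ J`, and `g≥2` makes this exceed
    -- the exponent `2 ^ J` of the degree bound.
    all-small : ∀ b → D b < 2 ^ scale g (suc J * g)
    all-small b = ≤-<-trans (≤-trans (sum-mono (λ a → ⟦⟧-mono {F a b} {E b a} (λ p → sy a b
        (proj₂ (proj₂ (F⇒ {a} {b} p)))))) (deg≤ b))
      (^-monoʳ-< 2 (s≤s (s≤s z≤n)) (<-≤-trans (<-≤-trans (m<n+m (2 ^ J) (m^n>0 2 J)) (≤-trans
          (≤-reflexive (cong (2 ^ J +_) (sym (+-identityʳ _)))) (*-monoˡ-≤ (2 ^ J) g≥2))) (scale-doubles g J)))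
    A-edges : δ * # A ≤ 2 * q′ * # A + sum D
    A-edges = begin
      δ * # A ≡⟨ *-sum δ (λ a → ⟦ A a ⟧) ⟩
      sum (λ a → δ * ⟦ A a ⟧) ≤⟨ sum-mono pt ⟩
      sum (λ a → deg Eᴬ a + deg F a) ≡⟨ sum-+ (deg Eᴬ) (deg F) ⟩
      sum (deg Eᴬ) + sum (deg F) ≤⟨ +-mono-≤ sparse (≤-reflexive (sum-comm (λ a b → ⟦ F a b ⟧))) ⟩
      2 * q′ * # A + sum D ∎
      where
      open ≤-Reasoning
      pt : ∀ a → δ * ⟦ A a ⟧ ≤ deg Eᴬ a + deg F a
      pt a with A a in e
      ... | false = ≤-trans (≤-reflexive (*-zeroʳ δ)) z≤n
      ... | true = ≤-trans (≤-reflexive (trans (*-identityʳ δ) (sym (A⇒ {a} e))))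
          (≤-trans (sum-mono pt′) (≤-reflexive (sum-+ (λ b → ⟦ A b ∧ E a b ⟧) (λ b → ⟦ B b ∧ E a b ⟧))))
        where
        pt′ : ∀ b → ⟦ E a b ⟧ ≤ ⟦ A b ∧ E a b ⟧ + ⟦ B b ∧ E a b ⟧
        pt′ b = ⟦⟧≤ (E a b) λ p → case A-or-B {b} {a} (sy a b p) of λ where
          (inj₁ x) → ≤-trans (≤-reflexive (sym (⟦⟧≡1 (true-∧ x p)))) (m≤m+n _ _)
          (inj₂ x) → ≤-trans (≤-reflexive (sym (⟦⟧≡1 (true-∧ x p)))) (m≤n+m _ _)
    many : suc J * g * (5 * (s * # A)) < sum (λ b → ⟦ does (D b <? 2 ^ scale g (suc J * g)) ⟧ * D b)
    many = <-≤-trans (window-density (# A) (sum D) A≥1 A-edges)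
      (≤-reflexive (sum-cong-≗ (λ b → sym (trans (cong (_* D b) (⟦⟧≡1 (dec-true (D b <? 2 ^ scale g (suc J * g))
          (all-small b)))) (+-identityʳ _)))))
  ... | t , big = case ρ ℕ.≟ 0 of λ where
      (yes z) → W.dyadic-window z (≤-<-trans
          (*-monoʳ-≤ 5 (*-monoˡ-≤ (# A) (m≤n*m h (2 * k) {{m*n≢0 2 k {{_}} {{>-nonZero k≥1}}}}))) big′)
      (no nz) → W.power-window k L k≥1 k≤ h≤
                  (window-exponent ρ lo (n≢0⇒n>0 nz) (m/n*n≤m lo g))
                  (λ C J′ c j sub → free C J′ c j λ a b p p′ → Fʷ⊑E a b (sub a b p p′))
                  big′
    where
    lo ρ : ℕ
    lo = scale g t
    ρ = lo / g
    in-window : Fin n → Bool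
    in-window b = does (2 ^ lo ≤? D b) ∧ does (D b <? 2 ^ (lo + suc ρ))
    Fʷ : Rel n
    Fʷ a b = F a b ∧ in-window b
    Fʷ⇒F : ∀ {a b} → Fʷ a b ≡ true → F a b ≡ true
    Fʷ⇒F {a} {b} p = proj₁ (∧-true {F a b} p)
    Fʷ⊑E : Fʷ ⊑ E
    Fʷ⊑E a b p = proj₂ (proj₂ (F⇒ {a} {b} (Fʷ⇒F {a} {b} p)))
    Dʷ : ∀ b → sum (λ a → ⟦ Fʷ a b ⟧) ≡ ⟦ in-window b ⟧ * D b
    Dʷ b = trans (sum-cong-≗ (λ a → trans (⟦∧⟧ (F a b) (in-window b)) (*-comm ⟦ F a b ⟧ _)))
        (sym (*-sum ⟦ in-window b ⟧ (λ a → ⟦ F a b ⟧)))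
    Dʷ-cases : ∀ b → (sum (λ a → ⟦ Fʷ a b ⟧) ≡ 0) ⊎ (in-window b ≡ true × sum (λ a → ⟦ Fʷ a b ⟧) ≡ D b)
    Dʷ-cases b with in-window b in e | Dʷ b
    ... | true | d = inj₂ (refl , trans d (+-identityʳ _))
    ... | false | d = inj₁ d
    big′ : 5 * (s * # A) < sum (deg Fʷ)
    big′ = <-≤-trans big (≤-reflexive (trans (sum-cong-≗ (λ b → sym (Dʷ b))) (sym (sum-comm (λ a b → ⟦ Fʷ a b ⟧)))))
    -- All neighbours of a vertex of `B` lie in `A`, so `D b` is at least its full degree in `E`,
    -- which is above `δ`.
    D≥δ : ∀ b → 0 < D b → δ ≤ D b
    D≥δ b pos = let a , p = sum>0 (λ a → ⟦ F a b ⟧) pos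
                    _ , Bb , _ = F⇒ {a} {b} (⟦⟧>0 p)
      in ≤-trans (<⇒≤ (B⇒ {b} Bb)) (sum-mono
          (λ x → ⟦⟧-mono {E b x} {F x b} (λ e → true-∧ (B-neighbour {b} {x} Bb e) (true-∧ Bb (sy b x e)))))
    D-low : ∀ b → 0 < sum (λ a → ⟦ Fʷ a b ⟧) → 2 ^ lo ≤ sum (λ a → ⟦ Fʷ a b ⟧)
    D-low b pos = case Dʷ-cases b of λ where
      (inj₁ z) → contradiction (subst (0 <_) z pos) λ ()
      (inj₂ (w , d)) → ≤-trans (does-true (2 ^ lo ≤? D b) (proj₁ (∧-true {does (2 ^ lo ≤? D b)} w)))
          (≤-reflexive (sym d))
    D-high : ∀ b → sum (λ a → ⟦ Fʷ a b ⟧) < 2 ^ (lo + suc ρ)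
    D-high b = case Dʷ-cases b of λ where
      (inj₁ z) → ≤-<-trans (≤-reflexive z) (m^n>0 2 (lo + suc ρ))
      (inj₂ (w , d)) → ≤-<-trans (≤-reflexive d) (does-true (D b <? 2 ^ (lo + suc ρ)) (proj₂ (∧-true {does
          (2 ^ lo ≤? D b)} w)))
    deg≤D : ∀ a b → 0 < sum (λ a → ⟦ Fʷ a b ⟧) → deg Fʷ a ≤ sum (λ a → ⟦ Fʷ a b ⟧)
    deg≤D a b pos = case Dʷ-cases b of λ where
      (inj₁ z) → contradiction (subst (0 <_) z pos) λ ()
      (inj₂ (w , d)) → ≤-trans (deg-at-A Fʷ Fʷ⊑E (λ u v p → proj₁ (F⇒ {u} {v} (Fʷ⇒F {u} {v} p))) a)
        (≤-trans (D≥δ b (subst (0 <_) d pos)) (≤-reflexive (sym d)))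
    apartʷ : ∀ a b b′ → Fʷ a b ≡ true → Fʷ b′ a ≡ true → ⊥
    apartʷ a b b′ p p′ = let Aa , _ , _ = F⇒ {a} {b} (Fʷ⇒F {a} {b} p) ; _ , Ba , _ = F⇒ {b′} {a} (Fʷ⇒F {b′} {a} p′) in
      <-irrefl (sym (A⇒ {a} Aa)) (B⇒ {a} Ba)
    module W = Bipartite E sy Fʷ Fʷ⊑E A
        (λ a b p → proj₁ (F⇒ {a} {b} (Fʷ⇒F {a} {b} p))) apartʷ q h q≥1 h≡8q lo ρ D-low D-high deg≤D

  split-result : ∃[ p ] q ≤ p × AlmostRegularSubgraph p E
  split-result = case 2 * q′ * # A <? sum (deg Eᴬ) of λ where
    (yes p) → q′ , q≤q′ , inside p
    (no p) → q , ≤-refl , across (≮⇒≥ p)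

module _ (k q L J q′ : ℕ) (k≥1 : 1 ≤ k) (q≥1 : 1 ≤ q) (L≥1 : 1 ≤ L) (J≥1 : 1 ≤ J) (k≤ : k ≤ 2 ^ L) (q≤ : q ≤ 2 ^ L)
  (q′≡ : q′ ≡ 200 * (k * k * (q * q) * (L * J))) where

  private
    δ h g : ℕ
    δ = 64 * q′
    h = 8 * q
    g = 8 * k * h * L

    instance
      k-nz : NonZero k
      k-nz = >-nonZero k≥1
      q-nz : NonZero q
      q-nz = >-nonZero q≥1
      L-nz : NonZero L
      L-nz = >-nonZero L≥1
      J-nz : NonZero J
      J-nz = >-nonZero J≥1

    h≥1 : 1 ≤ h
    h≥1 = *-mono-≤ {1} {8} (s≤s z≤n) q≥1

    g≥2 : 2 ≤ g
    g≥2 = *-mono-≤ {2} (*-mono-≤ {2} (*-mono-≤ {2} {8} {1} (s≤s (s≤s z≤n)) k≥1) h≥1) L≥1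

    instance
      g-nz : NonZero g
      g-nz = >-nonZero (≤-trans (s≤s z≤n) g≥2)

    q≤q′ : q ≤ q′
    q≤q′ = subst (q ≤_) (sym q′≡) (≤-trans (≤-trans (m≤m*n q q) (≤-trans (m≤n*m (q * q) (k * k))
        (m≤m*n (k * k * (q * q)) (L * J)))) (m≤n*m _ 200))
      where
      instance
        _ = m*n≢0 k k
        _ = m*n≢0 L J

    q′≥1 : 1 ≤ q′
    q′≥1 = ≤-trans q≥1 q≤q′

    δ≥1 : 1 ≤ δ
    δ≥1 = *-mono-≤ {1} {64} (s≤s z≤n) q′≥1

    -- Each monomial on the left is at most `P = k * q * (L * ρ)`, and the coefficients add up to 14
    -- + 48 = 62, while `ρ * g = 64 * P`.
    window-exponent : ∀ ρ lo → 1 ≤ ρ → ρ * g ≤ lo → 3 + (L + ((L + 3 + (ρ + L + 4) * h) + (1 + L + (L + 3))) * k) ≤ lo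
    window-exponent ρ lo ρ≥1 le = ≤-trans (begin
      3 + (L + ((L + 3 + (ρ + L + 4) * h) + (1 + L + (L + 3))) * k) ≡⟨ ring₁ k q L ρ ⟩
      (3 + L + (7 + 3 * L) * k) + 8 * (k * q * ρ + k * q * L + 4 * (k * q))
        ≤⟨ +-mono-≤ (+-mono-≤ (+-mono-≤ (*-monoʳ-≤ 3 P≥1) P≥L)
            (≤-trans (≤-reflexive (ring₂ k L)) (+-mono-≤ (*-monoʳ-≤ 7 P≥k) (*-monoʳ-≤ 3 P≥kL))))
             (*-monoʳ-≤ 8 (+-mono-≤ (+-mono-≤ P≥kqρ P≥kqL) (*-monoʳ-≤ 4 P≥kq))) ⟩
      (3 * P + P + (7 * P + 3 * P)) + 8 * (P + P + 4 * P) ≤⟨ m≤m+n _ (2 * P) ⟩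
      (3 * P + P + (7 * P + 3 * P)) + 8 * (P + P + 4 * P) + 2 * P ≡⟨ ring₃ k q L ρ ⟩
      ρ * g ∎) le
      where
      open ≤-Reasoning
      instance
        _ = >-nonZero ρ≥1
        kq-nz : NonZero (k * q)
        kq-nz = m*n≢0 k q
        Lρ-nz : NonZero (L * ρ)
        Lρ-nz = m*n≢0 L ρ
      P = k * q * (L * ρ)
      P≥kq : k * q ≤ P
      P≥kq = m≤m*n (k * q) (L * ρ)
      P≥k : k ≤ P
      P≥k = ≤-trans (m≤m*n k q) P≥kq
      P≥1 : 1 ≤ P
      P≥1 = ≤-trans k≥1 P≥k
      P≥kqL : k * q * L ≤ P
      P≥kqL = *-monoʳ-≤ (k * q) (m≤m*n L ρ)
      P≥kqρ : k * q * ρ ≤ P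
      P≥kqρ = *-monoʳ-≤ (k * q) (m≤n*m ρ L)
      P≥kL : k * L ≤ P
      P≥kL = ≤-trans (*-monoˡ-≤ L (m≤m*n k q)) P≥kqL
      P≥L : L ≤ P
      P≥L = ≤-trans (m≤n*m L k) P≥kL
      ring₁ : ∀ k q L ρ → 3 + (L + ((L + 3 + (ρ + L + 4) * (8 * q)) + (1 + L + (L + 3))) * k) ≡
          (3 + L + (7 + 3 * L) * k) + 8 * (k * q * ρ + k * q * L + 4 * (k * q))
      ring₁ = solve-∀
      ring₂ : ∀ k L → (7 + 3 * L) * k ≡ 7 * k + 3 * (k * L)
      ring₂ = solve-∀
      ring₃ : ∀ k q L ρ → (3 * (k * q * (L * ρ)) + (k * q * (L * ρ)) +
          (7 * (k * q * (L * ρ)) + 3 * (k * q * (L * ρ)))) + 8 *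
          ((k * q * (L * ρ)) + (k * q * (L * ρ)) + 4 * (k * q * (L * ρ))) + 2 * (k * q * (L * ρ)) ≡ ρ *
          (8 * k * (8 * q) * L)
      ring₃ = solve-∀

    -- Here the factor 200 in `q′` is settled: the windows cost 5120 · 2 = 10240 units of k² q² L J
    -- x, and `62 * q′ * x` supplies 62 · 200 = 12400.
    window-density : ∀ x d → 1 ≤ x → δ * x ≤ 2 * q′ * x + d → suc J * g * (5 * (2 * k * h * x)) < d
    window-density x d x≥1 h₁ = begin-strict
      suc J * g * (5 * (2 * k * h * x)) ≡⟨ ring₁ k q L J x ⟩
      5120 * (1 + J) * (k * k * (q * q) * L * x) ≤⟨ *-monoˡ-≤ _ (*-monoʳ-≤ 5120 (+-monoˡ-≤ J J≥1)) ⟩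
      5120 * (J + J) * (k * k * (q * q) * L * x) ≡⟨ ring₂ 5120 J (k * k * (q * q) * L * x) ⟩
      10240 * (J * (k * k * (q * q) * L * x)) <⟨ *-monoˡ-<
          (J * (k * k * (q * q) * L * x)) {{nz}} {10240} {12400} (<ᵇ⇒< 10240 12400 _) ⟩
      12400 * (J * (k * k * (q * q) * L * x)) ≡⟨ ring₃ 62 200 k q L J x ⟩
      62 * (200 * (k * k * (q * q) * (L * J))) * x ≡⟨ cong (λ z → 62 * z * x) (sym q′≡) ⟩
      62 * q′ * x ≤⟨ +-cancelˡ-≤ (2 * q′ * x) _ _ (≤-trans (≤-reflexive (ring₄ q′ x)) h₁) ⟩
      d ∎
      where
      open ≤-Reasoning
      nz : NonZero (J * (k * k * (q * q) * L * x))
      nz = >-nonZero (*-mono-≤ J≥1 (*-mono-≤ (*-mono-≤ (*-mono-≤ (*-mono-≤ k≥1 k≥1) (*-mono-≤ q≥1 q≥1)) L≥1) x≥1))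
      ring₁ : ∀ k q L J x → suc J * (8 * k * (8 * q) * L) * (5 * (2 * k * (8 * q) * x)) ≡ 5120 * (1 + J) *
          (k * k * (q * q) * L * x)
      ring₁ = solve-∀
      ring₂ : ∀ c J y → c * (J + J) * y ≡ (c + c) * (J * y)
      ring₂ = solve-∀
      ring₃ : ∀ a b k q L J x → a * b * (J * (k * k * (q * q) * L * x)) ≡ a * (b * (k * k * (q * q) * (L * J))) * x
      ring₃ = solve-∀
      ring₄ : ∀ q x → 2 * q * x + 62 * q * x ≡ 64 * q * x
      ring₄ = solve-∀

    h≤ : h ≤ 2 ^ (L + 3)
    h≤ = ≤-trans (*-monoʳ-≤ 8 q≤) (≤-reflexive (trans (*-comm 8 (2 ^ L)) (sym (^-distribˡ-+-* 2 L 3))))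

  almostRegular-subgraph : ∀ {n} (E : Rel n) → Symmetric E → Irreflexive E → (∀ v → deg E v ≤ 2 ^ (2 ^ J)) →
      Free k E →
    ∀ X → (∀ u v → E u v ≡ true → X u ≡ true) → 2 * (64 * q′) * # X < sum (deg E) →
    ∃[ p ] q ≤ p × AlmostRegularSubgraph p E
  almostRegular-subgraph E sy irr deg≤ free X supp dense =
    let E₁ , E₁⊑E , md₁ = minDegree-subgraph δ (# X) E X ≤-refl sy supp dense
        E₂ , E₂⊑E₁ , (sy₂ , ne₂ , md₂) , low-end = high-ends-split δ δ≥1 (sum (deg E₁)) E₁ ≤-refl
            (λ v → irr v ∘ E₁⊑E v v) md₁
        E₂⊑E = ⊑-trans {E = E₂} {E₁} {E} E₂⊑E₁ E₁⊑E
        p , q≤p , H , H⊑E₂ , rest = Split.split-result k q L J q′ δ h g k≥1 k≤ q≥1 refl q≤q′ refl g≥2 h≤ window-exponent window-density E₂ (λ v → irr v ∘ E₂⊑E v v) (λ v → ≤-trans (deg-mono {E = E} {E₂} E₂⊑E v) (deg≤ v))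
          (λ C J′ c j sub → free C J′ c j λ a b x y → E₂⊑E a b (sub a b x y)) sy₂ ne₂ md₂ low-end
    in p , q≤p , H , ⊑-trans {E = H} {E₂} {E} H⊑E₂ E₂⊑E , rest

-- Translation between Boolean relations and graphs

open import Data.Fin.Subset using (Subset; ∣_∣; _∈_)
open import Data.Fin.Subset.Properties using (_∈?_)
import Data.Integer as ℤ
import Data.Integer.Properties as ℤ
open import Data.List.Extrema.Nat using (max≤v⁺; v≤min⁺; xs≤max)
open import Data.List.Membership.Propositional.Properties using (∈-allFin; ∈-filter⁺; ∈-map⁺)
open import Data.List.Properties using (filter-++; length-++; map-tabulate)
open import Data.List.Relation.Unary.All as All using ()
import Data.List.Relation.Unary.All.Properties as All
open import Data.Nat using () renaming (_^_ to _^ℕ_)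
open import Data.Rational.Unnormalised using (ℚᵘ; mkℚᵘ; 0ℚᵘ; ↥_; ↧ₙ_; *<*)
import Data.Rational.Unnormalised as ℚ
import Data.Rational.Unnormalised.Properties as ℚ
open import Data.Vec using (lookup; []; _∷_)
import Data.Vec as Vec
open import Data.Vec.Properties using ([]=⇒lookup; lookup⇒[]=; lookup∘tabulate)
open import Defs renaming (_^_ to _^ℚ_)
open import Relation.Binary.Definitions using (tri<; tri≈; tri>)
open import Relation.Unary using (Decidable)

∣∣≡# : ∀ {n} (p : Subset n) → ∣ p ∣ ≡ # (lookup p)
∣∣≡# [] = refl
∣∣≡# (true ∷ p) = cong suc (∣∣≡# p)
∣∣≡# (false ∷ p) = ∣∣≡# p

∣tabulate∣ : ∀ {n} (f : Fin n → Bool) → ∣ Vec.tabulate f ∣ ≡ # f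
∣tabulate∣ f = trans (∣∣≡# (Vec.tabulate f)) (sum-cong-≗ (λ i → cong ⟦_⟧ (lookup∘tabulate f i)))

∈-tabulate : ∀ {n} {f : Fin n → Bool} {i} → f i ≡ true → i ∈ Vec.tabulate f
∈-tabulate {f = f} {i} p = lookup⇒[]= i _ (trans (lookup∘tabulate f i) p)

∈-tabulate⁻ : ∀ {n} {f : Fin n → Bool} {i} → i ∈ Vec.tabulate f → f i ≡ true
∈-tabulate⁻ {f = f} {i} p = trans (sym (lookup∘tabulate f i)) ([]=⇒lookup p)

∈-lookup : ∀ {n} {p : Subset n} {i} → lookup p i ≡ true → i ∈ p
∈-lookup {p = p} {i} = lookup⇒[]= i p

length-filter-tabulate : ∀ {A : Set} {P : A → Set} (P? : Decidable P) {n} (f : Fin n → A) →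
  length (filter P? (tabulate f)) ≡ sum (λ i → ⟦ does (P? (f i)) ⟧)
length-filter-tabulate P? {zero} f = refl
length-filter-tabulate P? {suc n} f with does (P? (f zero))
... | true = cong suc (length-filter-tabulate P? (f ∘ suc))
... | false = length-filter-tabulate P? (f ∘ suc)

length-filter-product : ∀ {m n} {P : Fin m × Fin n → Set} (P? : Decidable P) {k} (f : Fin k → Fin m) →
  length (filter P? (cartesianProduct (tabulate f) (allFin n))) ≡ sum (λ i → sum (λ j → ⟦ does (P? (f i , j)) ⟧))
length-filter-product P? {zero} f = refl
length-filter-product {n = n} P? {suc k} f = begin
  length (filter P? (map (f zero ,_) (allFin n) ++ rest)) ≡⟨ cong length
      (filter-++ P? (map (f zero ,_) (allFin n)) rest) ⟩
  length (filter P? (map (f zero ,_) (allFin n)) ++ filter P? rest) ≡⟨ length-++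
      (filter P? (map (f zero ,_) (allFin n))) ⟩
  length (filter P? (map (f zero ,_) (allFin n))) + length (filter P? rest)
    ≡⟨ cong₂ _+_ (trans (cong (λ l → length (filter P? l)) (map-tabulate (λ j → j) (f zero ,_)))
        (length-filter-tabulate P? (f zero ,_))) (length-filter-product P? (f ∘ suc)) ⟩
  sum (λ j → ⟦ does (P? (f zero , j)) ⟧) + sum (λ i → sum (λ j → ⟦ does (P? (f (suc i) , j)) ⟧)) ∎
  where
  open ≡-Reasoning
  rest = cartesianProduct (tabulate (f ∘ suc)) (allFin n)

module _ {n} (G : Graph n) where

  adjacency : Rel n
  adjacency u v = lookup (N G u) v

  adjacency-sym : Symmetric adjacency
  adjacency-sym u v p = []=⇒lookup (N-sym G (∈-lookup p))

  adjacency-irrefl : Irreflexive adjacency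
  adjacency-irrefl v p = N-irrefl G (∈-lookup p)

  adjacency-supp : ∀ u v → adjacency u v ≡ true → lookup (V G) u ≡ true
  adjacency-supp u v p = []=⇒lookup (N⊆V G (N-sym G (∈-lookup p)))

  degree≡ : ∀ v → degree G v ≡ deg adjacency v
  degree≡ v = ∣∣≡# (N G v)

  handshake : 2 * length (edges G) ≡ sum (deg adjacency)
  handshake = begin
    2 * length (edges G) ≡⟨ cong (2 *_) edge-count ⟩
    2 * sum (λ u → sum (forward u)) ≡⟨ cong (sum (λ u → sum (forward u)) +_)
        (trans (+-identityʳ _) (sum-comm forward)) ⟩
    sum (λ u → sum (forward u)) + sum (λ u → sum (λ v → forward v u)) ≡⟨ sym (sum-+ (λ u → sum (forward u)) _) ⟩
    sum (λ u → sum (forward u) + sum (λ v → forward v u)) ≡⟨ sum-cong-≗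
        (λ u → trans (sym (sum-+ (forward u) _)) (sum-cong-≗ (pt u))) ⟩
    sum (deg adjacency) ∎
    where
    open ≡-Reasoning
    forward : Fin n → Fin n → ℕ
    forward u v = ⟦ does (u Fin.<? v) ∧ does (v ∈? N G u) ⟧
    edge-count : length (edges G) ≡ sum (λ u → sum (forward u))
    edge-count = length-filter-product (λ e → (proj₁ e Fin.<? proj₂ e) ×-dec (proj₂ e ∈? N G (proj₁ e))) (λ i → i)
    ∈?≡ : ∀ u v → does (v ∈? N G u) ≡ adjacency u v
    ∈?≡ u v with adjacency u v in e
    ... | true = dec-true (v ∈? N G u) (∈-lookup e)
    ... | false = dec-false (v ∈? N G u) (λ p → contradiction (trans (sym e) ([]=⇒lookup p)) λ ())
    symmetric : ∀ u v → adjacency u v ≡ adjacency v u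
    symmetric u v with adjacency u v in e
    ... | true = sym (adjacency-sym u v e)
    ... | false = sym (false-from λ p → contradiction (trans (sym e) (adjacency-sym v u p)) λ ())
    pt : ∀ u v → forward u v + forward v u ≡ ⟦ adjacency u v ⟧
    pt u v with Fin.<-cmp u v
    ... | tri< u<v _ v≮u rewrite dec-true (u Fin.<? v) u<v | dec-false (v Fin.<? u) v≮u = trans (+-identityʳ _)
        (cong ⟦_⟧ (∈?≡ u v))
    ... | tri> u≮v _ v<u rewrite dec-false (u Fin.<? v) u≮v | dec-true (v Fin.<? u) v<u = cong ⟦_⟧
        (trans (∈?≡ v u) (symmetric v u))
    ... | tri≈ u≮v refl _ rewrite dec-false (u Fin.<? u) u≮v = sym (cong ⟦_⟧ (false-from (adjacency-irrefl u)))

  deg≤maxDegree : ∀ v → deg adjacency v ≤ maxDegree G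
  deg≤maxDegree v with v ∈? V G
  ... | yes v∈V = subst (_≤ maxDegree G) (degree≡ v) (All.lookup (xs≤max 0 (degrees G)) (∈-map⁺ (degree G)
      (∈-filter⁺ (_∈? V G) (∈-allFin v) v∈V)))
  ... | no v∉V = ≤-trans (≤-reflexive (sum-0 empty)) z≤n
    where
    empty : ∀ u → ⟦ adjacency v u ⟧ ≡ 0
    empty u with adjacency v u in e
    ... | true = contradiction (∈-lookup (adjacency-supp v u e)) v∉V
    ... | false = refl

  -- Since `k≥1`, every vertex of one side has a neighbour on the other and hence belongs to `V G`.
  free-adjacency : ∀ k → 1 ≤ k → ¬ ContainsK k k G → Free k adjacency
  free-adjacency k k≥1 free C J #C #J complete = free
    ( Vec.tabulate C , Vec.tabulate J
    , (λ a∈C → let b , p = some J #J in ∈-lookup (adjacency-supp _ b (complete _ b (∈-tabulate⁻ a∈C) p)))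
    , (λ b∈J → let a , p = some C #C in ∈-lookup (adjacency-supp _ a (adjacency-sym a _ (complete a _ p (∈-tabulate⁻ b∈J)))))
    , trans (∣tabulate∣ C) #C , trans (∣tabulate∣ J) #J
    , (λ {v} v∈C v∈J → adjacency-irrefl v (complete v v (∈-tabulate⁻ v∈C) (∈-tabulate⁻ v∈J)))
    , λ {a} {b} a∈C b∈J → ∈-lookup (complete a b (∈-tabulate⁻ a∈C) (∈-tabulate⁻ b∈J)) )
    where
    some : ∀ (X : Fin n → Bool) → # X ≡ k → ∃[ i ] X i ≡ true
    some X eq = let i , pos = sum>0 (λ i → ⟦ X i ⟧) (subst (0 <_) (sym eq) k≥1) in i , ⟦⟧>0 pos

module _ {n} (E : Rel n) (E-sym : Symmetric E) (irr : Irreflexive E) where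

  support : Fin n → Bool
  support v = does (1 ≤? deg E v)

  spanned : Graph n
  spanned = record
    { V = Vec.tabulate support
    ; N = λ v → Vec.tabulate (E v)
    ; N-sym = λ {u} {v} p → ∈-tabulate (E-sym u v (∈-tabulate⁻ p))
    ; N-irrefl = λ {v} p → irr v (∈-tabulate⁻ p)
    ; N⊆V = λ {v} {u} p → ∈-tabulate (dec-true (1 ≤? deg E u) (≤-trans (≤-reflexive
        (sym (⟦⟧≡1 (E-sym v u (∈-tabulate⁻ p))))) (term≤sum (λ w → ⟦ E u w ⟧) v)))
    }

  degree-spanned : ∀ v → degree spanned v ≡ deg E v
  degree-spanned v = ∣tabulate∣ (E v)

  edges-spanned : 2 * length (edges spanned) ≡ sum (deg E)
  edges-spanned = trans (handshake spanned) (sum-cong-≗ (λ u → sum-cong-≗ (λ v → cong ⟦_⟧ (lookup∘tabulate (E u) v))))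

almostRegular-spanned : ∀ {n} (G : Graph n) p → 1 ≤ p → AlmostRegularSubgraph p (adjacency G) →
  Σ (Graph n) λ H → H ⊆ᴳ G × (Σ (NonZero (order H)) λ nz → 64 AlmostRegular H × p * order H ≤ 2 * length (edges H))
almostRegular-spanned {n} G p p≥1 (F , F⊑ , (F-sym , (v₀ , pos) , md) , high) =
  H , ((λ u∈H → let v , q = sum>0 (λ v → ⟦ F _ v ⟧) (does-true (1 ≤? deg F _) (∈-tabulate⁻ u∈H)) in ∈-lookup (adjacency-supp G _ v (F⊑ _ v (⟦⟧>0 q)))) ,
       λ {v} u∈N → ∈-lookup (F⊑ v _ (∈-tabulate⁻ u∈N))) ,
  nz , regular , many
  where
  irr : Irreflexive F
  irr v e = adjacency-irrefl G v (F⊑ v v e)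
  H = spanned F F-sym irr
  order≡ : order H ≡ # (support F F-sym irr)
  order≡ = ∣tabulate∣ (support F F-sym irr)
  nz : NonZero (order H)
  nz = >-nonZero (subst (0 <_) (sym order≡) (≤-trans (≤-reflexive (sym (⟦⟧≡1 (dec-true (1 ≤? deg F v₀) pos))))
      (term≤sum (λ v → ⟦ support F F-sym irr v ⟧) v₀)))
  low : ∀ v → 0 < deg F v → p ≤ deg F v
  low v pos = case md v of λ where
    (inj₁ z) → contradiction (subst (0 <_) z pos) λ ()
    (inj₂ q) → q
  -- `minDegree` takes its minimum with the base value `n`, so this value has to be at least `p` as
  -- well.
  p≤n : p ≤ n
  p≤n = ≤-trans (low v₀ pos) (≤-trans (sum-mono (λ u → ⟦⟧≤1 (F v₀ u)))
      (≤-reflexive (trans (sum-const n 1) (*-identityʳ n))))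
  regular : 64 AlmostRegular H
  regular = ≤-trans
    (max≤v⁺ {xs = degrees H} z≤n (All.map⁺ (All.tabulate (λ {v} _ → subst (_≤ 64 * p) (sym
        (degree-spanned F F-sym irr v)) (high v)))))
    (*-monoʳ-≤ 64 (v≤min⁺ {xs = degrees H} p≤n (All.map⁺ (All.map (λ {v} v∈V → subst (p ≤_) (sym
        (degree-spanned F F-sym irr v))
      (low v (does-true (1 ≤? deg F v) (∈-tabulate⁻ v∈V)))) (All.all-filter (_∈? V H) (allFin n))))))
  many : p * order H ≤ 2 * length (edges H)
  many = begin
    p * order H ≡⟨ cong (p *_) order≡ ⟩
    p * # (support F F-sym irr) ≡⟨ *-sum p (λ v → ⟦ support F F-sym irr v ⟧) ⟩
    sum (λ v → p * ⟦ support F F-sym irr v ⟧) ≤⟨ sum-mono pt ⟩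
    sum (deg F) ≡⟨ sym (edges-spanned F F-sym irr) ⟩
    2 * length (edges H) ∎
    where
    open ≤-Reasoning
    pt : ∀ v → p * ⟦ support F F-sym irr v ⟧ ≤ deg F v
    pt v with support F F-sym irr v in e
    ... | true = ≤-trans (≤-reflexive (*-identityʳ p)) (low v (does-true (1 ≤? deg F v) e))
    ... | false = ≤-trans (≤-reflexive (*-zeroʳ p)) z≤n

-- A single edge, for the case in which the promised average degree is at most 1.
edge-subgraph : ∀ {n} (E : Rel n) → Symmetric E → 0 < sum (deg E) → AlmostRegularSubgraph 1 E
edge-subgraph {n} E E-sym pos = F , F⊑E , (F-sym , (u , F-pos) , low) , high
  where
  first = sum>0 (deg E) pos
  u = proj₁ first
  second = sum>0 (λ v → ⟦ E u v ⟧) (proj₂ first)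
  v = proj₁ second
  e : E u v ≡ true
  e = ⟦⟧>0 (proj₂ second)
  is : Fin n → Fin n → Bool
  is x y = does (x ≟ y)
  F : Rel n
  F x y = (is x u ∧ is y v) ∨ (is x v ∧ is y u)
  both : ∀ {x y a b} → is x a ∧ is y b ≡ true → x ≡ a × y ≡ b
  both {x} {y} {a} {b} p = let p₁ , p₂ = ∧-true {is x a} p in does-true (x ≟ a) p₁ , does-true (y ≟ b) p₂
  is-refl : ∀ x → is x x ≡ true
  is-refl x = dec-true (x ≟ x) refl
  Fuv : F u v ≡ true
  Fuv = true-∨ˡ (true-∧ (is-refl u) (is-refl v))
  Fvu : F v u ≡ true
  Fvu = true-∨ʳ (is v u ∧ is u v) (true-∧ (is-refl v) (is-refl u))
  cases : ∀ {x y} → F x y ≡ true → (x ≡ u × y ≡ v) ⊎ (x ≡ v × y ≡ u)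
  cases {x} {y} p = case ∨-true (is x u ∧ is y v) p of λ where
    (inj₁ q) → inj₁ (both {x} {y} {u} {v} q)
    (inj₂ q) → inj₂ (both {x} {y} {v} {u} q)
  F⊑E : F ⊑ E
  F⊑E x y p = case cases {x} {y} p of λ where
    (inj₁ (refl , refl)) → e
    (inj₂ (refl , refl)) → E-sym u v e
  F-sym : Symmetric F
  F-sym x y p = case cases {x} {y} p of λ where
    (inj₁ (refl , refl)) → Fvu
    (inj₂ (refl , refl)) → Fuv
  F-pos : 0 < deg F u
  F-pos = ≤-trans (≤-reflexive (sym (⟦⟧≡1 Fuv))) (term≤sum (λ y → ⟦ F u y ⟧) v)
  low : ∀ x → deg F x ≡ 0 ⊎ 1 ≤ deg F x
  low x with deg F x
  ... | zero = inj₁ refl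
  ... | suc _ = inj₂ (s≤s z≤n)
  high : ∀ x → deg F x ≤ 64 * 1
  high x = ≤-trans (≤-trans (sum-mono pt) (≤-reflexive (trans (sum-+ (λ y → ⟦ is y v ⟧ * 1) _)
      (cong₂ _+_ (sum-δ v (λ _ → 1)) (sum-δ u (λ _ → 1)))))) (s≤s (s≤s z≤n))
    where
    pt : ∀ y → ⟦ F x y ⟧ ≤ ⟦ is y v ⟧ * 1 + ⟦ is y u ⟧ * 1
    pt y with is x u | is y v | is x v | is y u
    ... | _     | true  | _     | _     = ≤-trans (⟦⟧≤1 _) (s≤s z≤n)
    ... | false | false | false | _     = z≤n
    ... | true  | false | false | _     = z≤n
    ... | false | false | true  | false = z≤n
    ... | true  | false | true  | false = z≤n
    ... | false | false | true  | true  = s≤s z≤n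
    ... | true  | false | true  | true  = s≤s z≤n

-- Integer logarithms and their comparison with Dedekind cuts

between : ∀ (f : ℕ → ℕ) x t → f 0 ≤ x → x < f t → ∃[ j ] f j ≤ x × x < f (suc j)
between f x zero low high = contradiction high (≤⇒≯ low)
between f x (suc t) low high with f t ≤? x
... | yes p = t , p , high
... | no p = between f x t low (≰⇒> p)

n<2^n : ∀ n → n < 2 ^ n
n<2^n zero = s≤s z≤n
n<2^n (suc n) = ≤-trans (s≤s (n<2^n n)) (≤-trans (+-monoˡ-≤ (2 ^ n) (m^n>0 2 n)) (≤-reflexive
    (cong (2 ^ n +_) (sym (+-identityʳ _)))))

log-floor : ∀ r → 2 ≤ r → ∃[ ℓ ] 1 ≤ ℓ × 2 ^ ℓ ≤ r × r < 2 ^ suc ℓ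
log-floor r r≥2 with between (2 ^_) r r (≤-trans (s≤s z≤n) r≥2) (n<2^n r)
... | zero , _ , r<2 = contradiction r<2 (≤⇒≯ r≥2)
... | suc ℓ , low , high = suc ℓ , s≤s z≤n , low , high

-- Searching for the predecessor of `Δ` moves the strict inequality from the upper to the lower end;
-- a strict lower end is what the cut of log log Δ calls for.
loglog-ceiling : ∀ Δ → 3 ≤ Δ → ∃[ J ] 2 ^ (2 ^ J) < Δ × Δ ≤ 2 ^ (2 ^ suc J)
loglog-ceiling (suc Δ) Δ≥3 with between (λ j → 2 ^ (2 ^ j)) Δ (suc Δ) (s≤s⁻¹ Δ≥3)
  (<-trans (n<2^n Δ) (^-monoʳ-< 2 (s≤s (s≤s z≤n)) (≤-<-trans (n≤1+n Δ) (n<2^n (suc Δ)))))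
... | J , low , high = J , s≤s low , high

-- Natural numerators and denominators reduce comparisons of rationals to inequalities in ℕ.
_IsFraction_/_ : ℚᵘ → ℕ → ℕ → Set
x IsFraction a / d = ↥ x ≡ ℤ.+ a × ↧ₙ x ≡ d

nat-fraction : ∀ m → natℚ m IsFraction m / 1
nat-fraction m = refl , refl

ratio-fraction : ∀ m d .{{_ : NonZero d}} → ((ℤ.+ m) ℚ./ d) IsFraction m / d
ratio-fraction m (suc d) = refl , refl

*-fraction : ∀ {x y a b d e} → x IsFraction a / d → y IsFraction b / e → (x ℚ.* y) IsFraction (a * b) / (d * e)
*-fraction {mkℚᵘ _ d} {mkℚᵘ _ e} {a} {b} (refl , refl) (refl , refl) = sym (ℤ.pos-* a b) , refl

^-fraction : ∀ {x a d} → x IsFraction a / d → ∀ n → (x ^ℚ n) IsFraction (a ^ n) / (d ^ n)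
^-fraction f zero = refl , refl
^-fraction {x} f (suc n) = *-fraction {x} {x ^ℚ n} f (^-fraction {x} f n)

fraction-< : ∀ {x y a b d e} → x IsFraction a / d → y IsFraction b / e → a * e < b * d → x ℚ.< y
fraction-< {mkℚᵘ _ d} {mkℚᵘ _ e} {a} {b} (refl , refl) (refl , refl) lt =
  *<* (subst₂ ℤ._<_ (ℤ.pos-* a (suc e)) (ℤ.pos-* b (suc d)) (ℤ.+<+ lt))

<-fraction : ∀ {x y a d} → x IsFraction a / d → x ℚ.< y → ∃[ b ] y IsFraction b / (↧ₙ y) × a * ↧ₙ y < b * d
<-fraction {mkℚᵘ _ d} {mkℚᵘ (ℤ.+ b) e} {a} (refl , refl) (*<* lt) = b , (refl , refl) ,
  ℤ.drop‿+<+ (subst₂ ℤ._<_ (sym (ℤ.pos-* a (suc e))) (sym (ℤ.pos-* b (suc d))) lt)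
<-fraction {mkℚᵘ _ d} {mkℚᵘ ℤ.-[1+ b ] e} {a} (refl , refl) (*<* lt) with subst (ℤ._< _) (sym (ℤ.pos-* a (suc e))) lt
... | ()

fractions-< : ∀ {x y a b d e} → x IsFraction a / d → y IsFraction b / e → x ℚ.< y → a * e < b * d
fractions-< {x} {y} {a} {b} {d} {e} f g@(p , refl) lt with <-fraction {x} {y} f lt
... | b′ , (p′ , _) , lt′ = subst (λ z → a * e < z * d) (ℤ.+-injective (trans (sym p′) p)) lt′

-- The bound (J + 1) / 4 < log log Δ is crude, but it is positive for J = 0; there it rests on
-- 5/4 < log (5/2) and 1/4 < log (5/4).
loglog-lower : ∀ Δ J → 2 ^ (2 ^ J) < Δ → 3 ≤ Δ → lower (log (log (fromℕ Δ))) (mkℚᵘ (ℤ.+ suc J) 3)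
loglog-lower Δ zero _ Δ≥3 = mkℚᵘ (ℤ.+ 5) 3 ,
  (mkℚᵘ (ℤ.+ 5) 1 , fraction-< (refl , refl) (nat-fraction Δ) (<-≤-trans (n<1+n 5) (*-monoˡ-≤ 2 Δ≥3)) ,
    fraction-< (nat-fraction 0) (refl , refl) z<s ,
    fraction-< (nat-fraction 32) (^-fraction {mkℚᵘ (ℤ.+ 5) 1} (refl , refl) 4) (<ᵇ⇒< (32 * 16) (625 * 1) _)) ,
  fraction-< (nat-fraction 0) (refl , refl) z<s ,
  fraction-< (nat-fraction 2) (^-fraction {mkℚᵘ (ℤ.+ 5) 3} (refl , refl) 4) (<ᵇ⇒< (2 * 256) (625 * 1) _)
loglog-lower (suc Δ) J@(suc j) lt _ = natℚ (2 ^ J) ,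
  (l , fraction-< {l} {natℚ (suc Δ)} (refl , refl) (refl , refl) (≤-reflexive (ring₁ Δ)) ,
    fraction-< {0ℚᵘ} {l} (refl , refl) (refl , refl) (≤-trans (s≤s z≤n) (≤-trans (m≤n+m (suc Δ) Δ)
        (≤-reflexive (sym (*-identityʳ (Δ + suc Δ)))))) ,
    fraction-< {natℚ (2 ^ (2 ^ J))} {l ^ℚ 1} (refl , refl) (^-fraction {l} (refl , refl) 1) half) ,
  fraction-< {0ℚᵘ} {natℚ (2 ^ J)} (refl , refl) (refl , refl)
      (≤-trans (m^n>0 2 J) (≤-reflexive (sym (*-identityʳ (2 ^ J))))) ,
  fraction-< {natℚ (2 ^ suc J)} {natℚ (2 ^ J) ^ℚ 4} (refl , refl) (^-fraction {natℚ (2 ^ J)} (refl , refl) 4)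
    (subst₂ _<_ (sym (*-identityʳ (2 ^ suc J))) (trans (sym (^-*-assoc 2 J 4)) (sym (*-identityʳ ((2 ^ J) ^ 4))))
      (^-monoʳ-< 2 (s≤s (s≤s z≤n)) (≤-trans (m≤m+n (3 + j) (1 + 3 * j)) (≤-reflexive (ring₂ j)))))
  where
  -- Half a unit below the argument `suc Δ` of the logarithm: the lower cut needs a rational
  -- strictly between `2 ^ (2 ^ J)` and that argument.
  l = mkℚᵘ (ℤ.+ (Δ + suc Δ)) 1
  ring₁ : ∀ x → suc ((x + suc x) * 1) ≡ suc x * 2
  ring₁ = solve-∀
  ring₂ : ∀ j → 3 + j + (1 + 3 * j) ≡ suc j * 4
  ring₂ = solve-∀
  half : 2 ^ (2 ^ J) * 2 ^ 1 < (Δ + suc Δ) ^ 1 * 1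
  half = ≤-trans (s≤s (*-monoˡ-≤ 2 (s≤s⁻¹ lt))) (≤-reflexive (ring₃ Δ))
    where
    ring₃ : ∀ x → suc (x * 2) ≡ (x + suc x) * 1 * 1
    ring₃ = solve-∀

-- Let u = a / b with witness v > r and v^b < 2^a. If a ≤ l b, then 2^a ≤ (2^l)^b ≤ r^b ≤ v^b, a
-- contradiction; for negative a, v^b is at least 1.
log-upper : ∀ r l u → 1 ≤ r → 2 ^ l ≤ r → upper (log (fromℕ r)) u → natℚ l ℚ.< u
log-upper r l (mkℚᵘ a b-1) r≥1 le (v , r<v , _ , vᵇ<) = go a vᵇ<
  where
  b = suc b-1
  w = <-fraction {natℚ r} {v} (nat-fraction r) r<v
  x = proj₁ w
  d = ↧ₙ v
  rd<x : r * d < x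
  rd<x = subst (r * d <_) (*-identityʳ x) (proj₂ (proj₂ w))
  vᵇ-fraction : (v ^ℚ b) IsFraction (x ^ b) / (d ^ b)
  vᵇ-fraction = ^-fraction {v} (proj₁ (proj₂ w)) b
  rᵇdᵇ≤xᵇ : r ^ b * d ^ b ≤ x ^ b
  rᵇdᵇ≤xᵇ = ≤-trans (≤-reflexive (sym (^-distrib-* r d b))) (^-monoˡ-≤ b (<⇒≤ rd<x))
    where
    ^-distrib-* : ∀ m n k → (m * n) ^ k ≡ m ^ k * n ^ k
    ^-distrib-* m n zero = refl
    ^-distrib-* m n (suc k) = trans (cong (m * n *_) (^-distrib-* m n k)) (ring m n (m ^ k) (n ^ k))
      where
      ring : ∀ a b c d → a * b * (c * d) ≡ a * c * (b * d)
      ring = solve-∀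
  go : ∀ a → (v ^ℚ b) ℚ.< (2^ℤ a) → natℚ l ℚ.< mkℚᵘ a b-1
  go (ℤ.+ a) lt = fraction-< {natℚ l} {mkℚᵘ (ℤ.+ a) b-1} (refl , refl) (refl , refl)
      (subst (l * b <_) (sym (*-identityʳ a))
    (≰⇒> λ a≤lb → <-irrefl refl (<-≤-trans (fractions-< {v ^ℚ b} {natℚ (2 ^ a)} vᵇ-fraction (refl , refl) lt)
      (begin
        2 ^ a * d ^ b ≤⟨ *-monoˡ-≤ (d ^ b) (^-monoʳ-≤ 2 a≤lb) ⟩
        2 ^ (l * b) * d ^ b ≡⟨ cong (_* d ^ b) (sym (^-*-assoc 2 l b)) ⟩
        (2 ^ l) ^ b * d ^ b ≤⟨ *-monoˡ-≤ (d ^ b) (^-monoˡ-≤ b le) ⟩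
        r ^ b * d ^ b ≤⟨ rᵇdᵇ≤xᵇ ⟩
        x ^ b ≡⟨ sym (*-identityʳ _) ⟩
        x ^ b * 1 ∎))))
    where open ≤-Reasoning
  go ℤ.-[1+ a ] lt = contradiction (fractions-< {v ^ℚ b} {2^ℤ ℤ.-[1+ a ]} vᵇ-fraction
      (ratio-fraction 1 (2 ^ suc a) {{m^n≢0 2 (suc a)}}) lt) (≤⇒≯ (begin
      1 * d ^ b ≤⟨ *-monoˡ-≤ (d ^ b) (m^n>0 r b) ⟩
      r ^ b * d ^ b ≤⟨ rᵇdᵇ≤xᵇ ⟩
      x ^ b ≤⟨ m≤m*n (x ^ b) (2 ^ suc a) ⟩
      x ^ b * 2 ^ suc a ∎))
    where
    open ≤-Reasoning
    instance
      _ = >-nonZero r≥1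
      _ = m^n≢0 2 (suc a)

-- The integer `l` is at most log r, so the quotient is at most r / (c l), and the last hypothesis
-- compares this with e / v.
÷-log-≤ : ∀ r l c e v .{{_ : NonZero v}} → 1 ≤ r → 2 ^ l ≤ r → r * v ≤ e * (c * l) →
  r ÷ (c · log (fromℕ r)) ≤ᶜ fromℚ ((ℤ.+ e) ℚ./ v)
÷-log-≤ r l c e v@(suc _) r≥1 le bound p@(mkℚᵘ ℤ.-[1+ _ ] _) _ = ℚ.<-≤-trans (ℚ.negative⁻¹ p)
    (ℚ.nonNegative⁻¹ ((ℤ.+ e) ℚ./ v))
÷-log-≤ r l c e v@(suc _) r≥1 le bound p@(mkℚᵘ (ℤ.+ x) d-1) (u , (w , log<w , cw<u) , pu<r) =
  let a , w-fraction , lb<a = <-fraction {natℚ l} {w} (refl , refl) (log-upper r l w r≥1 le log<w)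
      y , u-fraction , caf<yb = <-fraction {natℚ c ℚ.* w} {u} (*-fraction {natℚ c} {w} (refl , refl) w-fraction) cw<u
      xy<rdf = fractions-< {p ℚ.* u} {natℚ r} (*-fraction {p} {u} (refl , refl) u-fraction) (refl , refl) pu<r
  in fraction-< {p} {(ℤ.+ e) ℚ./ v} (refl , refl) (refl , refl) (arith a (↧ₙ w) y (↧ₙ u) lb<a caf<yb xy<rdf)
  where
  d = suc d-1
  arith : ∀ a b y f → l * b < a * 1 → c * a * f < y * (1 * b) → x * y * 1 < r * (d * f) → x * v < e * d
  arith a b y f h₁ h₂ h₃ = *-cancelʳ-< (c * l) _ _ (begin-strict
    x * v * (c * l) ≡⟨ ring₁ x v (c * l) ⟩
    x * (c * l) * v <⟨ *-monoˡ-< v xcl<rd ⟩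
    r * d * v ≡⟨ ring₁ r d v ⟩
    r * v * d ≤⟨ *-monoˡ-≤ d bound ⟩
    e * (c * l) * d ≡⟨ ring₁ e (c * l) d ⟩
    e * d * (c * l) ∎)
    where
    open ≤-Reasoning
    ring₁ : ∀ x y z → x * y * z ≡ x * z * y
    ring₁ = solve-∀
    ring₂ : ∀ c l f b → c * l * f * b ≡ c * (l * b) * f
    ring₂ = solve-∀
    clf<y : c * l * f < y
    clf<y = *-cancelʳ-< b _ _ (begin-strict
      c * l * f * b ≡⟨ ring₂ c l f b ⟩
      c * (l * b) * f ≤⟨ *-monoˡ-≤ f (*-monoʳ-≤ c (≤-trans (<⇒≤ h₁) (≤-reflexive (*-identityʳ a)))) ⟩
      c * a * f <⟨ h₂ ⟩
      y * (1 * b) ≡⟨ cong (y *_) (*-identityˡ b) ⟩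
      y * b ∎)
    xcl<rd : x * (c * l) < r * d
    xcl<rd = *-cancelʳ-< f _ _ (begin-strict
      x * (c * l) * f ≡⟨ *-assoc x _ f ⟩
      x * (c * l * f) ≤⟨ *-monoʳ-≤ x (<⇒≤ clf<y) ⟩
      x * y ≡⟨ sym (*-identityʳ _) ⟩
      x * y * 1 <⟨ h₃ ⟩
      r * (d * f) ≡⟨ sym (*-assoc r d f) ⟩
      r * d * f ∎)

-- As log log Δ exceeds (J + 1) / 4, every natural number below c (J + 1) / 4 is in the lower cut;
-- the density hypothesis enters the combinatorial argument in this form.
≤-·loglog : ∀ c Δ J e v .{{_ : NonZero v}} → 2 ^ (2 ^ J) < Δ → 3 ≤ Δ → c · log (log (fromℕ Δ)) ≤ᶜ fromℚ
    ((ℤ.+ e) ℚ./ v) →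
  ∀ x → 4 * x < c * suc J → x * v < e
≤-·loglog c Δ J e v lt Δ≥3 below x 4x< = subst (x * v <_) (*-identityʳ e)
  (fractions-< {natℚ x} {(ℤ.+ e) ℚ./ v} (refl , refl) (ratio-fraction e v)
    (below (natℚ x) (mkℚᵘ (ℤ.+ suc J) 3 , loglog-lower Δ J lt Δ≥3 ,
      fraction-< {natℚ x} {natℚ c ℚ.* mkℚᵘ (ℤ.+ suc J) 3} (refl , refl)
          (*-fraction {natℚ c} {mkℚᵘ (ℤ.+ suc J) 3} (refl , refl) (refl , refl))
        (subst₂ _<_ (*-comm 4 x) (sym (*-identityʳ _)) 4x<))))

-- Choice of the parameters

-- With q = 1 + ⌊r / (c ℓ)⌋, rounding up at most doubles the quotient because c ℓ < r. So q c ℓ ≤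
-- 2r, and the 160 in `c` leaves 80.
scale-factor : ∀ k r ℓ c → c ≡ 160 * (k + 1) → 1 ≤ ℓ → c * ℓ < r → ∃[ q ] 1 ≤ q × r ≤ q * (c * ℓ) × 80 *
    (k * q * ℓ) ≤ r
scale-factor k r ℓ c c≡ ℓ≥1 M<r = q , s≤s z≤n , above , *-cancelˡ-≤ 2 (begin
  2 * (80 * (k * q * ℓ)) ≤⟨ m≤m+n _ (160 * (q * ℓ)) ⟩
  2 * (80 * (k * q * ℓ)) + 160 * (q * ℓ) ≡⟨ ring k q ℓ ⟩
  q * (160 * (k + 1) * ℓ) ≡⟨ cong (λ z → q * (z * ℓ)) (sym c≡) ⟩
  q * (c * ℓ) ≤⟨ +-mono-≤ (<⇒≤ M<r) (m/n*n≤m r (c * ℓ)) ⟩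
  r + r ≡⟨ cong (λ z → r + z) (sym (+-identityʳ r)) ⟩
  2 * r ∎)
  where
  open ≤-Reasoning
  instance
    M-nz : NonZero (c * ℓ)
    M-nz = >-nonZero (*-mono-≤ (subst (1 ≤_) (sym c≡) (*-mono-≤ {1} {160} (s≤s z≤n) (m≤n+m 1 k))) ℓ≥1)
  q : ℕ
  q = suc (r / (c * ℓ))
  above : r ≤ q * (c * ℓ)
  above = ≤-trans (≤-reflexive (m≡m%n+[m/n]*n r (c * ℓ))) (+-monoˡ-≤ (r / (c * ℓ) * (c * ℓ)) (<⇒≤ (m%n<n r (c * ℓ))))
  ring : ∀ k q ℓ → 2 * (80 * (k * q * ℓ)) + 160 * (q * ℓ) ≡ q * (160 * (k + 1) * ℓ)
  ring = solve-∀

-- Squaring the bound on `b * (k * q * ℓ)` gives ℓ², which absorbs `suc ℓ` at the cost of a factor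
-- 2. In the application c₁ = 4 comes from the bound on log log Δ, c₂ c₃ = 2 · 64 from the passage
-- to minimum degree `64 * q′`, and c₄ = 200 from `q′`.
density : ∀ a b c₁ c₂ c₃ c₄ k q ℓ r j → 1 ≤ k → 1 ≤ q → 1 ≤ ℓ → 1 ≤ j → 2 * (c₁ * c₂ * c₃ * c₄) < a * b * b →
    b * (k * q * ℓ) ≤ r →
  c₁ * (c₂ * (c₃ * (c₄ * (k * k * (q * q) * (suc ℓ * j))))) < a * r ^ 2 * j
density a b c₁ c₂ c₃ c₄ k q ℓ r j k≥1 q≥1 ℓ≥1 j≥1 consts bound = begin-strict
  c₁ * (c₂ * (c₃ * (c₄ * (k * k * (q * q) * (suc ℓ * j))))) ≡⟨ ring₁ c₁ c₂ c₃ c₄ k q ℓ j ⟩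
  c₁ * c₂ * c₃ * c₄ * (k * q * (k * q)) * (1 + ℓ) * j ≤⟨ *-monoˡ-≤ j
      (*-monoʳ-≤ (c₁ * c₂ * c₃ * c₄ * (k * q * (k * q))) (+-monoˡ-≤ ℓ ℓ≥1)) ⟩
  c₁ * c₂ * c₃ * c₄ * (k * q * (k * q)) * (ℓ + ℓ) * j ≡⟨ ring₂ (c₁ * c₂ * c₃ * c₄) (k * q) ℓ j ⟩
  2 * (c₁ * c₂ * c₃ * c₄) * (k * q * (k * q) * ℓ * j) <⟨ *-monoˡ-< (k * q * (k * q) * ℓ * j) {{nz}} consts ⟩
  a * b * b * (k * q * (k * q) * ℓ * j) ≤⟨ *-monoʳ-≤ (a * b * b)
      (*-monoˡ-≤ j (*-monoʳ-≤ (k * q * (k * q)) (m≤m*n ℓ ℓ {{>-nonZero ℓ≥1}}))) ⟩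
  a * b * b * (k * q * (k * q) * (ℓ * ℓ) * j) ≡⟨ ring₃ a b (k * q) ℓ j ⟩
  a * (b * (k * q * ℓ) * (b * (k * q * ℓ) * 1)) * j ≤⟨ *-monoˡ-≤ j
      (*-monoʳ-≤ a (*-mono-≤ bound (*-monoˡ-≤ 1 bound))) ⟩
  a * r ^ 2 * j ∎
  where
  open ≤-Reasoning
  nz : NonZero (k * q * (k * q) * ℓ * j)
  nz = >-nonZero (*-mono-≤ (*-mono-≤ (*-mono-≤ (*-mono-≤ k≥1 q≥1) (*-mono-≤ k≥1 q≥1)) ℓ≥1) j≥1)
  ring₁ : ∀ c₁ c₂ c₃ c₄ k q ℓ j → c₁ * (c₂ * (c₃ * (c₄ * (k * k * (q * q) * (suc ℓ * j))))) ≡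
      c₁ * c₂ * c₃ * c₄ * (k * q * (k * q)) * (1 + ℓ) * j
  ring₁ = solve-∀
  ring₂ : ∀ c x ℓ j → c * (x * x) * (ℓ + ℓ) * j ≡ 2 * c * (x * x * ℓ * j)
  ring₂ = solve-∀
  ring₃ : ∀ a b x ℓ j → a * b * b * (x * x * (ℓ * ℓ) * j) ≡ a * (b * (x * ℓ) * (b * (x * ℓ) * 1)) * j
  ring₃ = solve-∀

module Assembly {n} (G : Graph n) .{{G-nz : NonZero (order G)}} (k r ℓ J c : ℕ) (k≥1 : 1 ≤ k) (r≥1 : 1 ≤ r)
    (ℓ≥1 : 1 ≤ ℓ)
  (2^ℓ≤r : 2 ^ ℓ ≤ r) (r<2^ : r < 2 ^ suc ℓ) (c≡ : c ≡ 160 * (k + 1)) (¬K : ¬ ContainsK k k G)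
  (maxdeg : maxDegree G ≤ 2 ^ (2 ^ suc J))
  (dense : ∀ x → 4 * x < 80 * r ^ 2 * suc J → x * order G < 2 * length (edges G)) where

  private
    Goal : Set
    Goal = Σ (Graph n) λ H → H ⊆ᴳ G × (Σ (NonZero (order H)) λ nz →
      64 AlmostRegular H × r ÷ (c · log (fromℕ r)) ≤ᶜ fromℚ (avgDegree H {{nz}}))

    conclude : ∀ p → 1 ≤ p → r ≤ p * (c * ℓ) → AlmostRegularSubgraph p (adjacency G) → Goal
    conclude p p≥1 r≤pM sub = let H , H⊆G , nz , regular , many = almostRegular-spanned G p p≥1 sub in
      H , H⊆G , nz , regular ,
      ÷-log-≤ r ℓ c (2 * length (edges H)) (order H) {{nz}} r≥1 2^ℓ≤r
        (≤-trans (*-monoˡ-≤ (order H) r≤pM) (≤-trans (≤-reflexive (ring p (c * ℓ) (order H)))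
            (*-monoˡ-≤ (c * ℓ) many)))
      where
      ring : ∀ p m o → p * m * o ≡ p * o * m
      ring = solve-∀

    trivial : r ≤ c * ℓ → Goal
    trivial r≤M = conclude 1 ≤-refl (≤-trans r≤M (≤-reflexive (sym (*-identityˡ _))))
      (edge-subgraph (adjacency G) (adjacency-sym G) (subst (0 <_) (handshake G)
        (dense 0 (*-mono-≤ {1} (*-mono-≤ {1} {80} (s≤s z≤n) (m^n>0 r {{>-nonZero r≥1}} 2)) (s≤s z≤n)))))

    large : ∀ q → 1 ≤ q → r ≤ q * (c * ℓ) → 80 * (k * q * ℓ) ≤ r → ∀ q′ → q′ ≡ 200 *
        (k * k * (q * q) * (suc ℓ * suc J)) → Goal
    large q q≥1 r≤qM bound q′ q′≡ =
      let p , q≤p , sub = almostRegular-subgraph k q (suc ℓ) (suc J) q′ k≥1 q≥1 (s≤s z≤n) (s≤s z≤n) k≤ q≤ q′≡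
                            (adjacency G) (adjacency-sym G) (adjacency-irrefl G)
                            (λ v → ≤-trans (deg≤maxDegree G v) maxdeg) (free-adjacency G k k≥1 ¬K)
                            (lookup (V G)) (adjacency-supp G)
                            (subst₂ (λ x y → 2 * (64 * q′) * x < y) (∣∣≡# (V G)) (handshake G)
                                (dense (2 * (64 * q′)) dense′))
      in conclude p (≤-trans q≥1 q≤p) (≤-trans r≤qM (*-monoˡ-≤ (c * ℓ) q≤p)) sub
      where
      kqℓ≤ : k * q * ℓ ≤ 2 ^ suc ℓ
      kqℓ≤ = ≤-trans (m≤n*m (k * q * ℓ) 80) (≤-trans bound (<⇒≤ r<2^))
      kq≤ : k * q ≤ 2 ^ suc ℓ
      kq≤ = ≤-trans (m≤m*n (k * q) ℓ {{>-nonZero ℓ≥1}}) kqℓ≤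
      k≤ : k ≤ 2 ^ suc ℓ
      k≤ = ≤-trans (m≤m*n k q {{>-nonZero q≥1}}) kq≤
      q≤ : q ≤ 2 ^ suc ℓ
      q≤ = ≤-trans (m≤n*m q k {{>-nonZero k≥1}}) kq≤
      dense′ : 4 * (2 * (64 * q′)) < 80 * r ^ 2 * suc J
      dense′ = subst (λ z → 4 * (2 * (64 * z)) < 80 * r ^ 2 * suc J) (sym q′≡)
        (density 80 80 4 2 64 200 k q ℓ r (suc J) k≥1 q≥1 ℓ≥1 (s≤s z≤n) (<ᵇ⇒< 204800 512000 _) bound)

  almostRegular : Goal
  almostRegular with r ≤? c * ℓ
  ... | yes r≤M = trivial r≤M
  ... | no r≰M = let q , q≥1 , r≤qM , bound = scale-factor k r ℓ c c≡ ℓ≥1 (≰⇒> r≰M) in large q q≥1 r≤qM bound _ refl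

theorem5p3 : Σ ℕ λ r₀ → ∀ (k r Δ : ℕ) → k ≥ 1 → r ≥ 1 → r ≥ r₀ → Δ ≥ 3 →
    ∀ (n : ℕ) (G : Graph n) .{{_ : NonZero (order G)}} →
    ¬ ContainsK k k G →
    maxDegree G ≤ Δ →
    (80 * r ^ℕ 2) · log (log (fromℕ Δ)) ≤ᶜ fromℚ (avgDegree G) →
    Σ (Graph n) λ H → H ⊆ᴳ G × (Σ (NonZero (order H)) λ nz →
    64 AlmostRegular H
    × r ÷ ((160 * (k + 1)) · log (fromℕ r)) ≤ᶜ fromℚ (avgDegree H {{nz}}))
-- From r = 2 on, ⌊log r⌋ is at least 1; values of r that are small against k log r fall under the
-- single-edge case.
theorem5p3 = 2 , λ k r Δ k≥1 r≥1 r≥2 Δ≥3 n G {{_}} ¬K maxdeg avg →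
  let ℓ , ℓ≥1 , 2^ℓ≤r , r<2^ = log-floor r r≥2
      J , J-low , J-high = loglog-ceiling Δ Δ≥3
  in Assembly.almostRegular G k r ℓ J (160 * (k + 1)) k≥1 r≥1 ℓ≥1 2^ℓ≤r r<2^ refl ¬K (≤-trans maxdeg J-high)
       (≤-·loglog (80 * r ^ 2) Δ J (2 * length (edges G)) (order G) J-low Δ≥3 avg)
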